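{- Let $p\in(0,1)$, $q=1-p$, $\rho=p/q$, and let $m$ be a fixed positive integer. Let $\mathfrak{it}_n$ be the total weight on $[n]$ of the virtual weighted species $\mathcal T$ of all tournaments with ties, and let $\mathfrak{it}^{(m)}_n$ be the total weight on $[n]$ of its subspecies of tournaments with ties consisting of exactly $m$ strongly connected components. Then, as $n\to\infty$, $$\frac{\mathfrak{it}^{(m)}_n}{\mathfrak{it}_n}\approx m\sum_{k\ge0}\Big(\mathfrak{it}^{(m-1)}_k-2\,\mathfrak{it}^{(m)}_k+\mathfrak{it}^{(m+1)}_k\Big)\cdot\binom nk\cdot\frac{q^{nk}}{q^{k(k+1)/2}},$$ where, by convention, $\mathfrak{it}^{(0)}_0=1$ and $\mathfrak{it}^{(0)}_k=0$ for $k>0$.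
   Context: A tournament with ties on $[n]=\{1,\dots,n\}$ is a directed graph with vertex set $[n]$ in which every pair of distinct vertices is joined either by exactly one directed edge (in one of the two directions) or by two oppositely directed edges. The weight of a tournament with ties $t$ is $w(t)=(\rho-1)^{\ell}$, where $\ell$ is the number of pairs of vertices joined by two edges (with $0^0=1$); weights may be negative if $\rho<1$. Total weight on $[n]$ means the sum of the weights of all the relevant tournaments with ties on $[n]$. For $j\ge1$ one has $\mathfrak{it}^{(j)}_0=0$ (the empty tournament has $0$ strongly connected components). Notation $\approx$: $p_n\approx\sum_{k\ge0}c_kg_k(n)$ (here $g_k(n)=\binom nk q^{nk-k(k+1)/2}$) means that $g_{k+1}(n)=o(g_k(n))$ for every $k$ and, for every integer $r\ge0$, $p_n=\sum_{k=0}^rc_kg_k(n)+O(g_{r+1}(n))$ as $n\to\infty$. -}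

module Defs where

open import Algebra.Apartness.Bundles using (HeytingField)
open import Algebra.Bundles using (CommutativeRing)
import Algebra.Properties.Monoid.Mult as MonoidMult
import Algebra.Properties.Monoid.Sum as MonoidSum
import Algebra.Properties.Semiring.Exp as SemiringExp
open import Data.Bool.Base using (Bool; true; false; T)
import Data.Bool.Properties as Bool
open import Data.Fin.Base as Fin using (Fin; toℕ)
import Data.Fin.Properties as Fin
open import Data.Fin.Subset using (Subset)
open import Data.List.Base as List
  using (List; []; _∷_; length; filter; foldr; allFin; deduplicate;
         cartesianProduct; cartesianProductWith)
open import Data.List.Membership.Propositional using (_∈_)
open import Data.List.Membership.Propositional.Properties using (∈-allFin)
open import Data.List.Relation.Unary.Any using (here; there)
open import Data.Nat.Base as ℕ using (ℕ; zero; suc)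
open import Data.Nat.Combinatorics using (_C_)
open import Data.Nat.DivMod using (_/_)
import Data.Nat.Properties as ℕ
open import Data.Product.Base using (Σ-syntax; _×_; _,_; proj₁; proj₂)
open import Data.Sum.Base using (_⊎_; inj₁; inj₂)
open import Data.Vec.Base as Vec using (Vec; lookup; tabulate)
import Data.Vec.Properties as Vec
open import Function.Bundles using (_⇔_; Equivalence)
open import Level using (_⊔_) renaming (suc to lsuc)
open import Relation.Binary.Construct.Closure.ReflexiveTransitive
  using (Star; ε; _◅_; _◅◅_)
open import Relation.Binary.Core using (Rel)
open import Relation.Binary.Lattice.Definitions using (Supremum)
open import Relation.Binary.PropositionalEquality.Core using (_≡_; _≢_; refl)
open import Relation.Binary.Structures using (IsStrictPartialOrder)
open import Relation.Nullary.Decidable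
  using (Dec; does; map′; ¬?; _×-dec_; _⊎-dec_; _→-dec_; T?)
open import Relation.Nullary.Negation using (¬_)

------------------------------------------------------------------------
-- The real numbers

-- The real numbers are described axiomatically, as a complete Archimedean
-- ordered field.  The axioms are phrased so that they make sense without
-- excluded middle: the order is not assumed decidable, x ≤ y means
-- ¬ (y < x), binary maxima are part of the structure, and completeness is
-- convergence of Cauchy sequences.  Classically these axioms determine ℝ up
-- to isomorphism.

record CompleteOrderedField c ℓ₁ ℓ₂ : Set (lsuc (c ⊔ ℓ₁ ⊔ ℓ₂)) where
  field
    heytingField : HeytingField c ℓ₁ ℓ₂

  open HeytingField heytingField public hiding (apartnessRelation)

  commutativeRing : CommutativeRing c ℓ₁
  commutativeRing = record { isCommutativeRing = isCommutativeRing }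

  open CommutativeRing commutativeRing public
    using (semiring; +-monoid)
  open MonoidMult +-monoid public using () renaming (_×_ to infixr 8 _·_)
  open MonoidSum +-monoid public using (sum; sum⁺-syntax)
  open SemiringExp semiring public using (_^_)

  infix  4 _<_ _≤_
  infixl 6 _∨_
  infixl 7 divide

  field
    _<_                  : Rel Carrier ℓ₂
    _∨_                  : Carrier → Carrier → Carrier
    isStrictPartialOrder : IsStrictPartialOrder _≈_ _<_
    #⇔<⊎>                : ∀ {x y} → (x # y) ⇔ (x < y ⊎ y < x)
    +-monoˡ-<            : ∀ {x y} z → x < y → x + z < y + z
    *-pos                : ∀ {x y} → 0# < x → 0# < y → 0# < x * y

  open IsStrictPartialOrder isStrictPartialOrder public
    using (<-respˡ-≈; <-respʳ-≈)
    renaming (trans to <-trans; irrefl to <-irrefl; asym to <-asym)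

  _≤_ : Rel Carrier ℓ₂
  x ≤ y = ¬ (y < x)

  ∣_∣ : Carrier → Carrier
  ∣ x ∣ = x ∨ - x

  field
    supremum    : Supremum _≤_ _∨_
    archimedean : ∀ x → Σ[ n ∈ ℕ ] x < n · 1#
    complete    : (s : ℕ → Carrier) →
                  (∀ ε → 0# < ε → Σ[ N ∈ ℕ ] ∀ i j → N ℕ.≤ i → N ℕ.≤ j →
                    ∣ s i - s j ∣ ≤ ε) →
                  Σ[ x ∈ Carrier ] ∀ ε → 0# < ε → Σ[ N ∈ ℕ ] ∀ i → N ℕ.≤ i →
                    ∣ s i - x ∣ ≤ ε

  pos⇒#0 : ∀ {x} → 0# < x → x # 0#
  pos⇒#0 0<x = Equivalence.from #⇔<⊎> (inj₂ 0<x)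

  -- #⇒invertible inverts y - 0#, which is ≈ y.
  divide : Carrier → (y : Carrier) → y # 0# → Carrier
  divide x y y#0 = x * proj₁ (#⇒invertible y#0)

  syntax divide x y y#0 = x ÷ y [ y#0 ]

------------------------------------------------------------------------
-- Asymptotics of sequences as n → ∞

module Asymptotics {c ℓ₁ ℓ₂} (ℝ : CompleteOrderedField c ℓ₁ ℓ₂) where
  open CompleteOrderedField ℝ

  _=O_ : (f g : ℕ → Carrier) → Set (c ⊔ ℓ₂)
  f =O g = Σ[ K ∈ Carrier ] Σ[ N ∈ ℕ ] ∀ n → N ℕ.≤ n → ∣ f n ∣ ≤ K * ∣ g n ∣

  _=o_ : (f g : ℕ → Carrier) → Set (c ⊔ ℓ₂)
  f =o g = ∀ ε → 0# < ε → Σ[ N ∈ ℕ ] ∀ n → N ℕ.≤ n → ∣ f n ∣ ≤ ε * ∣ g n ∣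

  -- f n ≈ Σ_{k ≥ 0} a k * g k n
  AsymptoticExpansion : (f a : ℕ → Carrier) (g : ℕ → ℕ → Carrier) → Set (c ⊔ ℓ₂)
  AsymptoticExpansion f a g =
    (∀ k → g (suc k) =o g k) ×
    (∀ r → (λ n → f n - ∑[ k ≤ r ] (a (toℕ k) * g (toℕ k) n)) =O g (suc r))

------------------------------------------------------------------------
-- Tournaments with ties

-- Adjacency matrices, so that equal digraphs are propositionally equal.
Digraph : ℕ → Set
Digraph n = Vec (Vec Bool n) n

Edge : ∀ {n} → Digraph n → Rel (Fin n) _
Edge A i j = T (lookup (lookup A i) j)

edge? : ∀ {n} (A : Digraph n) i j → Dec (Edge A i j)
edge? A i j = T? _

IsTournamentWithTies : ∀ {n} → Digraph n → Set
IsTournamentWithTies A =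
  (∀ i → ¬ Edge A i i) × (∀ i j → i ≢ j → Edge A i j ⊎ Edge A j i)

isTournamentWithTies? : ∀ {n} (A : Digraph n) → Dec (IsTournamentWithTies A)
isTournamentWithTies? A =
  Fin.all? (λ i → ¬? (edge? A i i)) ×-dec
  Fin.all? (λ i → Fin.all? λ j →
    ¬? (i Fin.≟ j) →-dec (edge? A i j ⊎-dec edge? A j i))

numTies : ∀ {n} → Digraph n → ℕ
numTies {n} A = length (filter tied? (cartesianProduct (allFin n) (allFin n)))
  where
  tied? : ((i , j) : Fin n × Fin n) → Dec (i Fin.< j × Edge A i j × Edge A j i)
  tied? (i , j) = i Fin.<? j ×-dec (edge? A i j ×-dec edge? A j i)

------------------------------------------------------------------------
-- Strongly connected components

MutuallyReachable : ∀ {n} → Digraph n → Rel (Fin n) _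
MutuallyReachable A i j = Star (Edge A) i j × Star (Edge A) j i

-- Reachability is decided by Warshall's algorithm: Via A ks i j says that j
-- is reachable from i through intermediate vertices in ks.
module _ {n} (A : Digraph n) where
  private
    Via : List (Fin n) → Rel (Fin n) _
    Via []       i j = i ≡ j ⊎ Edge A i j
    Via (k ∷ ks) i j = Via ks i j ⊎ (Via ks i k × Via ks k j)

    via? : ∀ ks i j → Dec (Via ks i j)
    via? []       i j = (i Fin.≟ j) ⊎-dec edge? A i j
    via? (k ∷ ks) i j = via? ks i j ⊎-dec (via? ks i k ×-dec via? ks k j)

    via-refl : ∀ ks {i} → Via ks i i
    via-refl []       = inj₁ refl
    via-refl (k ∷ ks) = inj₁ (via-refl ks)

    via-edge : ∀ ks {i j} → Edge A i j → Via ks i j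
    via-edge []       e = inj₂ e
    via-edge (k ∷ ks) e = inj₁ (via-edge ks e)

    via-trans : ∀ {ks i j k} → k ∈ ks → Via ks i k → Via ks k j → Via ks i j
    via-trans (here refl) (inj₁ p)       (inj₁ r)       = inj₂ (p , r)
    via-trans (here refl) (inj₁ p)       (inj₂ (_ , r)) = inj₂ (p , r)
    via-trans (here refl) (inj₂ (p , _)) (inj₁ r)       = inj₂ (p , r)
    via-trans (here refl) (inj₂ (p , _)) (inj₂ (_ , r)) = inj₂ (p , r)
    via-trans (there k∈)  (inj₁ p)       (inj₁ r)       = inj₁ (via-trans k∈ p r)
    via-trans (there k∈)  (inj₁ p)       (inj₂ (r , s)) = inj₂ (via-trans k∈ p r , s)
    via-trans (there k∈)  (inj₂ (p , r)) (inj₁ s)       = inj₂ (p , via-trans k∈ r s)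
    via-trans (there k∈)  (inj₂ (p , _)) (inj₂ (_ , s)) = inj₂ (p , s)

    via⇒star : ∀ ks {i j} → Via ks i j → Star (Edge A) i j
    via⇒star []       (inj₁ refl)    = ε
    via⇒star []       (inj₂ e)       = e ◅ ε
    via⇒star (k ∷ ks) (inj₁ p)       = via⇒star ks p
    via⇒star (k ∷ ks) (inj₂ (p , r)) = via⇒star ks p ◅◅ via⇒star ks r

    star⇒via : ∀ {i j} → Star (Edge A) i j → Via (allFin n) i j
    star⇒via ε       = via-refl (allFin n)
    star⇒via (e ◅ p) =
      via-trans (∈-allFin _) (via-edge (allFin n) e) (star⇒via p)

  reachable? : ∀ i j → Dec (Star (Edge A) i j)
  reachable? i j = map′ (via⇒star (allFin n)) star⇒via (via? (allFin n) i j)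

  mutuallyReachable? : ∀ i j → Dec (MutuallyReachable A i j)
  mutuallyReachable? i j = reachable? i j ×-dec reachable? j i

  component : Fin n → Subset n
  component i = tabulate λ j → does (mutuallyReachable? i j)

  components : List (Subset n)
  components = deduplicate (Vec.≡-dec Bool._≟_) (List.map component (allFin n))

  numComponents : ℕ
  numComponents = length components

------------------------------------------------------------------------
-- Enumeration

vecs : ∀ {a} {X : Set a} → List X → ∀ n → List (Vec X n)
vecs xs zero    = Vec.[] ∷ []
vecs xs (suc n) = cartesianProductWith Vec._∷_ xs (vecs xs n)

digraphs : ∀ n → List (Digraph n)
digraphs n = vecs (vecs (true ∷ false ∷ []) n) n

tournaments : ∀ n → List (Digraph n)
tournaments n = filter isTournamentWithTies? (digraphs n)

tournamentsWithComponents : ℕ → ∀ n → List (Digraph n)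
tournamentsWithComponents m n =
  filter (λ t → numComponents t ℕ.≟ m) (tournaments n)

------------------------------------------------------------------------
-- Weights

module Weights {c ℓ₁ ℓ₂} (ℝ : CompleteOrderedField c ℓ₁ ℓ₂)
  (p : CompleteOrderedField.Carrier ℝ)
  (0<p : CompleteOrderedField._<_ ℝ (CompleteOrderedField.0# ℝ) p)
  (p<1 : CompleteOrderedField._<_ ℝ p (CompleteOrderedField.1# ℝ)) where

  open CompleteOrderedField ℝ

  q : Carrier
  q = 1# - p

  0<q : 0# < q
  0<q = <-respˡ-≈ (-‿inverseʳ p) (+-monoˡ-< (- p) p<1)

  0<q^ : ∀ n → 0# < q ^ n
  0<q^ zero    = <-trans 0<p p<1
  0<q^ (suc n) = *-pos 0<q (0<q^ n)

  ρ : Carrier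
  ρ = p ÷ q [ pos⇒#0 0<q ]

  weight : ∀ {n} → Digraph n → Carrier
  weight t = (ρ - 1#) ^ numTies t

  totalWeight : ∀ {n} → List (Digraph n) → Carrier
  totalWeight = foldr (λ t w → weight t + w) 0#

  𝔦𝔱 : ℕ → Carrier
  𝔦𝔱 n = totalWeight (tournaments n)

  𝔦𝔱⁽_⁾ : ℕ → ℕ → Carrier
  𝔦𝔱⁽ zero  ⁾ zero    = 1#
  𝔦𝔱⁽ zero  ⁾ (suc k) = 0#
  𝔦𝔱⁽ suc m ⁾ k       = totalWeight (tournamentsWithComponents (suc m) k)

  -- For n < k the binomial coefficient vanishes, so a negative exponent
  -- n k - k (k + 1) / 2 does no harm.
  scale : ℕ → ℕ → Carrier
  scale k n =
    (n C k) · (q ^ (n ℕ.* k) ÷ q ^ triangle [ pos⇒#0 (0<q^ triangle) ])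
    where
    triangle : ℕ
    triangle = (k ℕ.* suc k) / 2

{-# OPTIONS --safe #-}
-- Scale a total weight on [n] by q ^ (n (n - 1) / 2).  Since a pair of
-- vertices has total weight 1 / q, the sequence of all tournaments becomes
-- constantly 1, and the product of species becomes
--   (u ⊛ v) n = Σ_k (n C k) q ^ (k (n - k)) u k v (n - k).
-- Splitting off the first strongly connected component shows that
-- 1 = δ + σ ⊛ 1 and that m components correspond to σ ^ m, where σ is the
-- scaled weight of the strongly connected tournaments.  The factor
-- q ^ (k (n - k)) makes bounded sequences closed under ⊛, makes σ bounded, and
-- makes a product of two bounded sequences vanishing below R of order
-- 2 ^ n q ^ (R n).  So with σ = ρ + τ, where ρ is the truncation of σ below R,
-- everything divisible by τ ⊛ τ is negligible.  Modulo τ ⊛ τ, the equation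
-- (δ - ρ - τ) ⊛ 1 = δ gives τ = (δ - ρ)² ⊛ 1 - (δ - ρ), so that
--   σ ^ m = m ρ ^ (m - 1) ⊛ (δ - ρ)² ⊛ 1 + (a finitely supported sequence),
-- and α ⊛ 1 for finitely supported α is a finite combination of the functions
-- (n C k) q ^ (k (n - k)).
module Submission where

open import Defs
open import Algebra.Bundles using (CommutativeRing)
import Algebra.Properties.AbelianGroup as AbelianGroupProperties
import Algebra.Properties.CommutativeMonoid.Sum as CommutativeMonoidSum
import Algebra.Properties.CommutativeSemiring.Exp as CommutativeSemiringExp
import Algebra.Properties.Monoid.Sum as MonoidSum
import Algebra.Properties.Ring as RingProperties
import Algebra.Properties.Semiring.Exp as SemiringExp
import Algebra.Properties.Semiring.Mult as SemiringMult
import Algebra.Properties.Semiring.Mult.TCOptimised as TCMult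
import Algebra.Solver.Ring as RingSolver
open import Algebra.Solver.Ring.AlmostCommutativeRing
  using (AlmostCommutativeRing; fromCommutativeRing; _-Raw-AlmostCommutative⟶_)
open import Data.Bool.Base using (Bool; true; false; T; if_then_else_; _∧_)
import Data.Bool.Properties as Bool
open import Data.Empty using (⊥; ⊥-elim)
open import Data.Fin.Base as Fin using (Fin; zero; suc; toℕ)
import Data.Fin.Properties as Fin
open import Data.Integer.Base as ℤ using (ℤ; +_; -[1+_])
import Data.Integer.Properties as ℤ
open import Data.List.Base as List
  using (List; []; _∷_; allFin; length; filter; foldr; cartesianProduct;
         cartesianProductWith; concat; _++_)
open import Data.List.Membership.Propositional using (_∈_)
open import Data.List.Membership.Propositional.Properties
  using (∈-lookup; ∈-allFin; ∈-map⁺; ∈-map⁻; ∈-filter⁺; ∈-filter⁻; ∈-concat⁺′; ∈-concat⁻′;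
         ∈-deduplicate⁺; ∈-deduplicate⁻; ∈-cartesianProductWith⁺; ∈-cartesianProductWith⁻)
open import Data.List.Membership.Propositional.Properties.WithK using (unique∧set⇒bag)
import Data.List.Properties as List
open import Data.List.Relation.Binary.BagAndSetEquality using (∼bag⇒↭)
open import Data.List.Relation.Binary.Disjoint.Propositional using (Disjoint)
open import Data.List.Relation.Binary.Permutation.Propositional as Permutation using (_↭_)
open import Data.List.Relation.Unary.All as All using ([]; _∷_)
import Data.List.Relation.Unary.All.Properties as All
open import Data.List.Relation.Unary.AllPairs as AllPairs using ([]; _∷_)
import Data.List.Relation.Unary.AllPairs.Properties as AllPairs
open import Data.List.Relation.Unary.Any as Any using (here; there)
open import Data.List.Relation.Unary.Any.Properties using (lookup-index)
import Data.List.Relation.Unary.Unique.DecPropositional.Properties as UniqueDec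
open import Data.List.Relation.Unary.Unique.Propositional using (Unique)
import Data.List.Relation.Unary.Unique.Propositional.Properties as Unique
open import Data.Maybe.Base as Maybe using (Maybe)
open import Data.Nat.Base as ℕ using (ℕ; zero; suc; _∸_) renaming (_≤_ to _≤ℕ_)
open import Data.Nat.Combinatorics using (_C_; nCk+nC[k+1]≡[n+1]C[k+1]; k>n⇒nCk≡0)
open import Data.Nat.DivMod using (_/_; m*n/n≡m)
import Data.Nat.ListAction as ℕ
import Data.Nat.ListAction.Properties as ℕ
import Data.Nat.Properties as ℕ
import Data.Nat.Tactic.RingSolver as ℕ-Solver
open import Data.Product.Base using (Σ-syntax; ∃-syntax; _×_; _,_; proj₁; proj₂)
open import Data.Sum.Base as Sum using (_⊎_; inj₁; inj₂; [_,_]′)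
open import Data.Sum.Properties using (inj₁-injective; inj₂-injective)
open import Data.Unit.Base using (⊤; tt)
open import Data.Vec.Base as Vec using (Vec; []; _∷_; lookup; tabulate)
import Data.Vec.Properties as Vec
open import Function.Base using (_∘_; id)
open import Function.Bundles using (Equivalence; mk⇔)
open import Function.Definitions using (Injective)
open import Level using (_⊔_)
open import Relation.Binary.Bundles using (Poset)
open import Relation.Binary.PropositionalEquality.Core as ≡ using (_≡_)
open import Relation.Binary.PropositionalEquality.Properties using (module ≡-Reasoning)
import Relation.Binary.Reasoning.PartialOrder as PosetReasoning
import Relation.Binary.Reasoning.Setoid as SetoidReasoning
open import Relation.Nullary.Decidable
  using (Dec; yes; no; does; dec-true; does-⇔; dec⇒maybe)
open import Relation.Nullary.Negation using (¬_)
open import Relation.Unary using (Pred; Decidable)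

-- The analytic core is that the sum of (n C k) q ^ (k (n - k)) over 0 < k < n eventually drops
-- below 1/2. Passing from n + 1 to n + 2 vertices multiplies it by at most q + q ^ n, up to an
-- error 2 q ^ (n + 1). Both the closure of bounded sequences under ⊛ and the boundedness of σ rest
-- on this recurrence. The factor 2 ^ n in a product of two tails is a crude count of subsets. It is
-- absorbed by truncating not at M, the number of terms wanted, but at R = M + j with 2 q ^ j ≤ 1:
-- then 2 ^ n q ^ (R n) ≤ q ^ (M n), which the scale function of index M dominates. Truncation
-- leaves the coefficients alone because entry k of a twisted product depends only on entries up to
-- k. The second difference in the coefficients is (1 - ρ)² ρ ^ (m - 1) written out in powers of ρ.
-- The order on the reals is not decidable, so arguments about signs go through apartness and
-- explicit bounds rather than case distinctions.

-- A ring solver with integer coefficients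

module IntegerSolver {c ℓ} (R : CommutativeRing c ℓ) where
  open CommutativeRing R
  open AbelianGroupProperties +-abelianGroup using (⁻¹-involutive; ⁻¹-∙-comm; ε⁻¹≈ε)
  open RingProperties ring using (-‿distribˡ-*; -‿distribʳ-*)
  open TCMult semiring using (×-homo-+; ×1-homo-*) renaming (_×_ to infixl 8 _·_)
  open SetoidReasoning setoid

  private
    -- The optimised multiple makes `ι 1` compute to `1#`, so that `con (+ 1)` denotes `1#` itself
    -- and `1-homo` is `refl`.
    ι : ℕ → Carrier
    ι n = n · 1#

    -- Equality in the ring need not be decidable, but equality of integer coefficients is, which
    -- lets the solver cancel terms. The solver serves both the field and the ring of sequences.
    ⟦_⟧ : ℤ → Carrier
    ⟦ + n      ⟧ = ι n
    ⟦ -[1+ n ] ⟧ = - ι (suc n)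

    -‿homo : ∀ i → ⟦ ℤ.- i ⟧ ≈ - ⟦ i ⟧
    -‿homo (+ zero)  = sym ε⁻¹≈ε
    -‿homo (+ suc n) = refl
    -‿homo -[1+ n ]  = sym (⁻¹-involutive _)

    ι-suc : ∀ n → ι (suc n) ≈ 1# + ι n
    ι-suc n = ×-homo-+ 1# 1 n

    ⊖-homo : ∀ m n → ⟦ m ℤ.⊖ n ⟧ ≈ ι m - ι n
    ⊖-homo zero    zero    = sym (-‿inverseʳ 0#)
    ⊖-homo zero    (suc n) = sym (+-identityˡ _)
    ⊖-homo (suc m) zero    = sym (trans (+-congˡ ε⁻¹≈ε) (+-identityʳ _))
    ⊖-homo (suc m) (suc n) = begin
      ⟦ suc m ℤ.⊖ suc n ⟧           ≡⟨ ≡.cong ⟦_⟧ (ℤ.[1+m]⊖[1+n]≡m⊖n m n) ⟩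
      ⟦ m ℤ.⊖ n ⟧                   ≈⟨ ⊖-homo m n ⟩
      ι m - ι n                     ≈⟨ +-congʳ (+-identityʳ _) ⟨
      ι m + 0# - ι n                ≈⟨ +-congʳ (+-congˡ (-‿inverseʳ 1#)) ⟨
      ι m + (1# - 1#) - ι n         ≈⟨ +-congʳ (+-assoc _ _ _) ⟨
      ι m + 1# - 1# - ι n           ≈⟨ +-assoc _ _ _ ⟩
      ι m + 1# + (- 1# - ι n)       ≈⟨ +-cong (+-comm _ _) (⁻¹-∙-comm 1# (ι n)) ⟩
      1# + ι m - (1# + ι n)         ≈⟨ +-cong (ι-suc m) (-‿cong (ι-suc n)) ⟨
      ι (suc m) - ι (suc n)         ∎

    +-homo : ∀ i j → ⟦ i ℤ.+ j ⟧ ≈ ⟦ i ⟧ + ⟦ j ⟧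
    +-homo (+ m)    (+ n)    = ×-homo-+ 1# m n
    +-homo (+ m)    -[1+ n ] = ⊖-homo m (suc n)
    +-homo -[1+ m ] (+ n)    = trans (⊖-homo n (suc m)) (+-comm _ _)
    +-homo -[1+ m ] -[1+ n ] = begin
      - ι (suc (suc (m ℕ.+ n)))     ≡⟨ ≡.cong (λ k → - ι (suc k)) (ℕ.+-suc m n) ⟨
      - ι (suc m ℕ.+ suc n)         ≈⟨ -‿cong (×-homo-+ 1# (suc m) (suc n)) ⟩
      - (ι (suc m) + ι (suc n))     ≈⟨ ⁻¹-∙-comm _ _ ⟨
      - ι (suc m) - ι (suc n)       ∎

    *-homo⁺ : ∀ m n → ⟦ + m ℤ.* + n ⟧ ≈ ι m * ι n
    *-homo⁺ m n = begin
      ⟦ + m ℤ.* + n ⟧   ≡⟨ ≡.cong ⟦_⟧ (ℤ.pos-* m n) ⟨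
      ι (m ℕ.* n)       ≈⟨ ×1-homo-* m n ⟩
      ι m * ι n         ∎

    *-homo : ∀ i j → ⟦ i ℤ.* j ⟧ ≈ ⟦ i ⟧ * ⟦ j ⟧
    *-homo (+ m)    (+ n)    = *-homo⁺ m n
    *-homo (+ m)    -[1+ n ] = begin
      ⟦ + m ℤ.* -[1+ n ] ⟧         ≡⟨ ≡.cong ⟦_⟧ (ℤ.neg-distribʳ-* (+ m) (+ suc n)) ⟨
      ⟦ ℤ.- (+ m ℤ.* + suc n) ⟧    ≈⟨ -‿homo (+ m ℤ.* + suc n) ⟩
      - ⟦ + m ℤ.* + suc n ⟧        ≈⟨ -‿cong (*-homo⁺ m (suc n)) ⟩
      - (ι m * ι (suc n))          ≈⟨ -‿distribʳ-* _ _ ⟩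
      ι m * - ι (suc n)            ∎
    *-homo -[1+ m ] (+ n)    = begin
      ⟦ -[1+ m ] ℤ.* + n ⟧         ≡⟨ ≡.cong ⟦_⟧ (ℤ.neg-distribˡ-* (+ suc m) (+ n)) ⟨
      ⟦ ℤ.- (+ suc m ℤ.* + n) ⟧    ≈⟨ -‿homo (+ suc m ℤ.* + n) ⟩
      - ⟦ + suc m ℤ.* + n ⟧        ≈⟨ -‿cong (*-homo⁺ (suc m) n) ⟩
      - (ι (suc m) * ι n)          ≈⟨ -‿distribˡ-* _ _ ⟩
      - ι (suc m) * ι n            ∎
    *-homo -[1+ m ] -[1+ n ] = begin
      ι (suc m ℕ.* suc n)          ≈⟨ ×1-homo-* (suc m) (suc n) ⟩
      ι (suc m) * ι (suc n)        ≈⟨ ⁻¹-involutive _ ⟨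
      - - (ι (suc m) * ι (suc n))  ≈⟨ -‿cong (-‿distribˡ-* _ _) ⟩
      - (- ι (suc m) * ι (suc n))  ≈⟨ -‿distribʳ-* _ _ ⟩
      - ι (suc m) * - ι (suc n)    ∎

    almostCommutativeRing : AlmostCommutativeRing c ℓ
    almostCommutativeRing = fromCommutativeRing R

    morphism : ℤ.+-*-rawRing -Raw-AlmostCommutative⟶ almostCommutativeRing
    morphism = record
      { ⟦_⟧    = ⟦_⟧
      ; +-homo = +-homo
      ; *-homo = *-homo
      ; -‿homo = -‿homo
      ; 0-homo = refl
      ; 1-homo = refl
      }

    _coeff≟_ : ∀ i j → Maybe (⟦ i ⟧ ≈ ⟦ j ⟧)
    i coeff≟ j = Maybe.map (λ eq → reflexive (≡.cong ⟦_⟧ eq)) (dec⇒maybe (i ℤ.≟ j))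

  open RingSolver ℤ.+-*-rawRing almostCommutativeRing morphism _coeff≟_ public
    using (solve; _:=_; _:+_; _:*_; _:-_; :-_; con)

-- This is n (n - 1) / 2, the number of pairs of vertices and hence the exponent of the normalising
-- power of q; `triangular (suc k)` is the k (k + 1) / 2 of the scale.
triangular : ℕ → ℕ
triangular zero    = 0
triangular (suc n) = n ℕ.+ triangular n

-- The right-hand side is n (n + 1). This lets a bound on triangular multiples of `x ^ n` control n²
-- x ^ n.
n*n≤2triangular : ∀ n → n ℕ.* n ℕ.≤ triangular (suc n) ℕ.+ triangular (suc n)
n*n≤2triangular zero    = ℕ.z≤n
n*n≤2triangular (suc n) = begin
  suc n ℕ.* suc n
    ≡⟨ square n ⟩
  suc (n ℕ.+ (n ℕ.+ n ℕ.* n))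
    ≤⟨ ℕ.s≤s (ℕ.+-monoʳ-≤ n (ℕ.+-monoʳ-≤ n (n*n≤2triangular n))) ⟩
  suc (n ℕ.+ (n ℕ.+ (Δ ℕ.+ Δ)))
    ≤⟨ ℕ.n≤1+n _ ⟩
  suc (suc (n ℕ.+ (n ℕ.+ (Δ ℕ.+ Δ))))
    ≡⟨ swap n Δ ⟩
  suc n ℕ.+ Δ ℕ.+ (suc n ℕ.+ Δ) ∎
  where
  open ℕ.≤-Reasoning
  Δ = triangular (suc n)
  square : ∀ n → suc n ℕ.* suc n ≡ suc (n ℕ.+ (n ℕ.+ n ℕ.* n))
  square = ℕ-Solver.solve-∀
  swap : ∀ n Δ → suc (suc (n ℕ.+ (n ℕ.+ (Δ ℕ.+ Δ)))) ≡ suc n ℕ.+ Δ ℕ.+ (suc n ℕ.+ Δ)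
  swap = ℕ-Solver.solve-∀

-- Order, absolute value and powers in a constructive ordered field

module OrderedField {c ℓ₁ ℓ₂} (ℝ : CompleteOrderedField c ℓ₁ ℓ₂) where
  open CompleteOrderedField ℝ
  open AbelianGroupProperties (CommutativeRing.+-abelianGroup commutativeRing) using ()
    renaming (ε⁻¹≈ε to -0≈0)
  open IntegerSolver commutativeRing public
  private module ≈-Reasoning = SetoidReasoning setoid
  open SemiringMult semiring using (×-homo-+; ×-congʳ; ×-assoc-*; ×-comm-*; ×-assocˡ)

  ≤-reflexive : ∀ {x y} → x ≈ y → x ≤ y
  ≤-reflexive x≈y y<x = <-irrefl (sym x≈y) y<x

  <⇒≤ : ∀ {x y} → x < y → x ≤ y
  <⇒≤ x<y y<x = <-asym x<y y<x

  <⇒# : ∀ {x y} → x < y → x # y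
  <⇒# x<y = Equivalence.from #⇔<⊎> (inj₁ x<y)

  #⇒<⊎> : ∀ {x y} → x # y → x < y ⊎ y < x
  #⇒<⊎> = Equivalence.to #⇔<⊎>

  -- Since ≤ is a negated <, transitivity comes from cotransitivity of apartness: given z < x, the
  -- element y is apart from z or from x, and each resulting position of y contradicts one of the
  -- two hypotheses.
  ≤-trans : ∀ {x y z} → x ≤ y → y ≤ z → x ≤ z
  ≤-trans {x} {y} {z} x≤y y≤z z<x with #-cotrans (<⇒# z<x) y
  ... | inj₁ z#y with #⇒<⊎> z#y
  ...   | inj₁ z<y = y≤z z<y
  ...   | inj₂ y<z = x≤y (<-trans y<z z<x)
  ≤-trans {x} {y} {z} x≤y y≤z z<x | inj₂ y#x with #⇒<⊎> y#x
  ...   | inj₁ y<x = x≤y y<x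
  ...   | inj₂ x<y = y≤z (<-trans z<x x<y)

  ≤-antisym : ∀ {x y} → x ≤ y → y ≤ x → x ≈ y
  ≤-antisym {x} {y} x≤y y≤x = proj₁ (tight x y) λ x#y → case (#⇒<⊎> x#y)
    where
    case : x < y ⊎ y < x → _
    case (inj₁ x<y) = y≤x x<y
    case (inj₂ y<x) = x≤y y<x

  ≤-poset : Poset c ℓ₁ ℓ₂
  ≤-poset = record
    { _≤_ = _≤_
    ; isPartialOrder = record
      { isPreorder = record
        { isEquivalence = isEquivalence
        ; reflexive     = ≤-reflexive
        ; trans         = ≤-trans
        }
      ; antisym = ≤-antisym
      }
    }

  module ≤-Reasoning = PosetReasoning ≤-poset

  ≤-refl : ∀ {x} → x ≤ x
  ≤-refl = ≤-reflexive refl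

  ≤-resp-≈ : ∀ {x x′ y y′} → x ≈ x′ → y ≈ y′ → x ≤ y → x′ ≤ y′
  ≤-resp-≈ x≈x′ y≈y′ x≤y =
    ≤-trans (≤-reflexive (sym x≈x′)) (≤-trans x≤y (≤-reflexive y≈y′))

  <-resp-≈ : ∀ {x x′ y y′} → x ≈ x′ → y ≈ y′ → x < y → x′ < y′
  <-resp-≈ x≈x′ y≈y′ x<y = <-respˡ-≈ x≈x′ (<-respʳ-≈ y≈y′ x<y)

  private
    cancel-+ : ∀ x z → x + z + - z ≈ x
    cancel-+ = solve 2 (λ x z → x :+ z :+ :- z := x) refl

  +-monoˡ-≤ : ∀ {x y} z → x ≤ y → x + z ≤ y + z
  +-monoˡ-≤ z x≤y yz<xz =
    x≤y (<-resp-≈ (cancel-+ _ z) (cancel-+ _ z) (+-monoˡ-< (- z) yz<xz))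

  +-monoʳ-≤ : ∀ {x y} z → x ≤ y → z + x ≤ z + y
  +-monoʳ-≤ z x≤y = ≤-resp-≈ (+-comm _ _) (+-comm _ _) (+-monoˡ-≤ z x≤y)

  +-mono-≤ : ∀ {x y u v} → x ≤ y → u ≤ v → x + u ≤ y + v
  +-mono-≤ x≤y u≤v = ≤-trans (+-monoˡ-≤ _ x≤y) (+-monoʳ-≤ _ u≤v)

  0≤+ : ∀ {x y} → 0# ≤ x → 0# ≤ y → 0# ≤ x + y
  0≤+ 0≤x 0≤y = ≤-resp-≈ (+-identityˡ 0#) refl (+-mono-≤ 0≤x 0≤y)

  x<y⇒0<y-x : ∀ {x y} → x < y → 0# < y - x
  x<y⇒0<y-x {x} x<y = <-respˡ-≈ (-‿inverseʳ x) (+-monoˡ-< (- x) x<y)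

  x≤y⇒0≤y-x : ∀ {x y} → x ≤ y → 0# ≤ y - x
  x≤y⇒0≤y-x {x} x≤y = ≤-resp-≈ (-‿inverseʳ x) refl (+-monoˡ-≤ (- x) x≤y)

  0≤y-x⇒x≤y : ∀ {x y} → 0# ≤ y - x → x ≤ y
  0≤y-x⇒x≤y {x} {y} 0≤ = ≤-resp-≈ (+-identityˡ x)
    (solve 2 (λ x y → y :- x :+ x := y) refl x y) (+-monoˡ-≤ x 0≤)

  0<y-x⇒x<y : ∀ {x y} → 0# < y - x → x < y
  0<y-x⇒x<y {x} {y} 0< = <-resp-≈ (+-identityˡ x)
    (solve 2 (λ x y → y :- x :+ x := y) refl x y) (+-monoˡ-< x 0<)

  x<0⇒0<-x : ∀ {x} → x < 0# → 0# < - x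
  x<0⇒0<-x x<0 = <-respʳ-≈ (+-identityˡ _) (x<y⇒0<y-x x<0)

  invertible⇒#0 : ∀ {x y} → x * y ≈ 1# → x # 0#
  invertible⇒#0 {x} {y} xy≈1 =
    invertible⇒# (y , trans (*-comm _ _) x-0*y≈1 , x-0*y≈1)
    where
    x-0*y≈1 : (x - 0#) * y ≈ 1#
    x-0*y≈1 = trans (*-congʳ (trans (+-congˡ -0≈0) (+-identityʳ x))) xy≈1

  #0⇒invertible : ∀ {x} → x # 0# → Σ[ y ∈ Carrier ] x * y ≈ 1#
  #0⇒invertible {x} x#0 with #⇒invertible x#0
  ... | y , _ , x-0*y≈1 =
    y , trans (*-congʳ (sym (trans (+-congˡ -0≈0) (+-identityʳ x)))) x-0*y≈1

  -- An inverse of the product, multiplied by y, is an inverse of x.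
  *#0⇒#0 : ∀ {x y} → x * y # 0# → x # 0#
  *#0⇒#0 xy#0 with #0⇒invertible xy#0
  ... | z , xyz≈1 = invertible⇒#0 (trans (sym (*-assoc _ _ _)) xyz≈1)

  0≤∧#0⇒0< : ∀ {x} → 0# ≤ x → x # 0# → 0# < x
  0≤∧#0⇒0< 0≤x x#0 with #⇒<⊎> x#0
  ... | inj₁ x<0 = ⊥-elim (0≤x x<0)
  ... | inj₂ 0<x = 0<x

  -- The factors cannot be compared with 0 directly. But a negative product is apart from 0, which
  -- makes both factors apart from 0 and so positive, and then the product is positive as well.
  0≤* : ∀ {x y} → 0# ≤ x → 0# ≤ y → 0# ≤ x * y
  0≤* {x} {y} 0≤x 0≤y xy<0 = <-asym xy<0 (*-pos 0<x 0<y)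
    where
    0<x : 0# < x
    0<x = 0≤∧#0⇒0< 0≤x (*#0⇒#0 (<⇒# xy<0))
    0<y : 0# < y
    0<y = 0≤∧#0⇒0< 0≤y (*#0⇒#0 (<⇒# (<-respˡ-≈ (*-comm x y) xy<0)))

  *-monoʳ-≤ : ∀ {x y z} → 0# ≤ z → x ≤ y → z * x ≤ z * y
  *-monoʳ-≤ {x} {y} {z} 0≤z x≤y = 0≤y-x⇒x≤y (≤-resp-≈ refl
    (solve 3 (λ x y z → z :* (y :- x) := z :* y :- z :* x) refl x y z)
    (0≤* 0≤z (x≤y⇒0≤y-x x≤y)))

  *-monoˡ-≤ : ∀ {x y z} → 0# ≤ z → x ≤ y → x * z ≤ y * z
  *-monoˡ-≤ 0≤z x≤y = ≤-resp-≈ (*-comm _ _) (*-comm _ _) (*-monoʳ-≤ 0≤z x≤y)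

  *-mono-≤ : ∀ {x y u v} → 0# ≤ x → 0# ≤ v → x ≤ y → u ≤ v → x * u ≤ y * v
  *-mono-≤ 0≤x 0≤v x≤y u≤v = ≤-trans (*-monoʳ-≤ 0≤x u≤v) (*-monoˡ-≤ 0≤v x≤y)

  *-cancelˡ-≤ : ∀ {x y z} → 0# < z → z * x ≤ z * y → x ≤ y
  *-cancelˡ-≤ {x} {y} {z} 0<z zx≤zy y<x = zx≤zy (0<y-x⇒x<y (<-respʳ-≈
    (solve 3 (λ x y z → z :* (x :- y) := z :* x :- z :* y) refl x y z)
    (*-pos 0<z (x<y⇒0<y-x y<x))))

  -- Stands in for division by 2: several estimates below are proved doubled and then halved.
  0≤2x⇒0≤x : ∀ {x} → 0# ≤ x + x → 0# ≤ x
  0≤2x⇒0≤x {x} 0≤2x x<0 = 0≤2x (<-trans (+-monoˡ-< x x<0) (<-respˡ-≈ (sym (+-identityˡ x)) x<0))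

  2x≤2y⇒x≤y : ∀ {x y} → x + x ≤ y + y → x ≤ y
  2x≤2y⇒x≤y {x} {y} 2x≤2y = 0≤y-x⇒x≤y (0≤2x⇒0≤x (≤-resp-≈ refl
    (solve 2 (λ x y → (y :+ y) :- (x :+ x) := (y :- x) :+ (y :- x)) refl x y)
    (x≤y⇒0≤y-x 2x≤2y)))

  -- Being invertible, 1 is apart from 0; and 1 < 0 would make the square of - 1, which is 1,
  -- positive.
  0<1 : 0# < 1#
  0<1 with #⇒<⊎> (invertible⇒#0 (*-identityˡ 1#))
  ... | inj₁ 1<0 = <-respʳ-≈ (solve 0 (:- con (+ 1) :* :- con (+ 1) := con (+ 1)) refl)
                     (*-pos (x<0⇒0<-x 1<0) (x<0⇒0<-x 1<0))
  ... | inj₂ 0<1 = 0<1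

  0≤1 : 0# ≤ 1#
  0≤1 = <⇒≤ 0<1

  0<x⇒Σ-inverse : ∀ {x} → 0# < x → Σ[ y ∈ Carrier ] (0# < y × x * y ≈ 1#)
  0<x⇒Σ-inverse {x} 0<x with #0⇒invertible (pos⇒#0 0<x)
  ... | y , xy≈1 with #⇒<⊎> (invertible⇒#0 (trans (*-comm y x) xy≈1))
  ...   | inj₂ 0<y = y , 0<y , xy≈1
  ...   | inj₁ y<0 = ⊥-elim (<-asym 0<1 (<-respˡ-≈ xy≈1 (0<y-x⇒x<y (<-respʳ-≈
            (solve 2 (λ x y → x :* (:- y) := con (+ 0) :- x :* y) refl x y)
            (*-pos 0<x (x<0⇒0<-x y<0))))))

  ÷-unique : ∀ {x y z} (y#0 : y # 0#) → z * y ≈ x → x ÷ y [ y#0 ] ≈ z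
  ÷-unique {x} {y} {z} y#0 zy≈x with #⇒invertible y#0
  ... | w , _ , y-0*w≈1 = begin
    x * w               ≈⟨ *-congʳ zy≈x ⟨
    z * y * w           ≈⟨ solve 3 (λ z y w → z :* y :* w := z :* ((y :- con (+ 0)) :* w)) refl z y w ⟩
    z * ((y - 0#) * w)  ≈⟨ *-congˡ y-0*w≈1 ⟩
    z * 1#              ≈⟨ *-identityʳ z ⟩
    z                   ∎
    where open ≈-Reasoning

  ÷-* : ∀ x {y} (y#0 : y # 0#) → x ÷ y [ y#0 ] * y ≈ x
  ÷-* x {y} y#0 with #⇒invertible y#0
  ... | w , w*y-0≈1 , _ = begin
    x * w * y           ≈⟨ solve 3 (λ x y w → x :* w :* y := x :* (w :* (y :- con (+ 0)))) refl x y w ⟩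
    x * (w * (y - 0#))  ≈⟨ *-congˡ w*y-0≈1 ⟩
    x * 1#              ≈⟨ *-identityʳ x ⟩
    x                   ∎
    where open ≈-Reasoning

  -- Absolute values

  -- ∣ x ∣ is a binary supremum, used only through its universal property: a bound on it is a bound
  -- on x and on - x. The estimates below therefore propagate upper bounds.
  ∣∣-least : ∀ {x a} → x ≤ a → - x ≤ a → ∣ x ∣ ≤ a
  ∣∣-least {x} {a} = proj₂ (proj₂ (supremum x (- x))) a

  x≤∣x∣ : ∀ x → x ≤ ∣ x ∣
  x≤∣x∣ x = proj₁ (supremum x (- x))

  -x≤∣x∣ : ∀ x → - x ≤ ∣ x ∣
  -x≤∣x∣ x = proj₁ (proj₂ (supremum x (- x)))

  0≤∣x∣ : ∀ x → 0# ≤ ∣ x ∣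
  0≤∣x∣ x = 0≤2x⇒0≤x (≤-resp-≈ (-‿inverseʳ x) refl (+-mono-≤ (x≤∣x∣ x) (-x≤∣x∣ x)))

  0≤x⇒∣x∣≤ : ∀ {x a} → 0# ≤ x → x ≤ a → ∣ x ∣ ≤ a
  0≤x⇒∣x∣≤ {x} {a} 0≤x x≤a = ∣∣-least x≤a (≤-trans
    (0≤y-x⇒x≤y (≤-resp-≈ refl (solve 1 (λ x → x :+ x := x :- :- x) refl x) (0≤+ 0≤x 0≤x))) x≤a)

  ∣0∣≤0 : ∣ 0# ∣ ≤ 0#
  ∣0∣≤0 = 0≤x⇒∣x∣≤ ≤-refl ≤-refl

  ∣∣≤-resp-≈ : ∀ {x y a} → x ≈ y → ∣ x ∣ ≤ a → ∣ y ∣ ≤ a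
  ∣∣≤-resp-≈ x≈y ∣x∣≤a = ∣∣-least
    (≤-trans (≤-reflexive (sym x≈y)) (≤-trans (x≤∣x∣ _) ∣x∣≤a))
    (≤-trans (≤-reflexive (-‿cong (sym x≈y))) (≤-trans (-x≤∣x∣ _) ∣x∣≤a))

  ∣-x∣≤ : ∀ {x a} → ∣ x ∣ ≤ a → ∣ - x ∣ ≤ a
  ∣-x∣≤ {x} ∣x∣≤a = ∣∣-least (≤-trans (-x≤∣x∣ x) ∣x∣≤a)
    (≤-trans (≤-reflexive (solve 1 (λ x → :- :- x := x) refl x)) (≤-trans (x≤∣x∣ x) ∣x∣≤a))

  ∣+∣≤ : ∀ {x y a b} → ∣ x ∣ ≤ a → ∣ y ∣ ≤ b → ∣ x + y ∣ ≤ a + b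
  ∣+∣≤ {x} {y} ∣x∣≤a ∣y∣≤b = ∣∣-least
    (+-mono-≤ (≤-trans (x≤∣x∣ x) ∣x∣≤a) (≤-trans (x≤∣x∣ y) ∣y∣≤b))
    (≤-trans (≤-reflexive (solve 2 (λ x y → :- (x :+ y) := :- x :+ :- y) refl x y))
      (+-mono-≤ (≤-trans (-x≤∣x∣ x) ∣x∣≤a) (≤-trans (-x≤∣x∣ y) ∣y∣≤b)))

  -- 2ab ∓ 2xy = (a ∓ x)(b + y) + (a ± x)(b - y), and all factors are
  -- nonnegative.
  ∣*∣≤ : ∀ {x y a b} → ∣ x ∣ ≤ a → ∣ y ∣ ≤ b → ∣ x * y ∣ ≤ a * b
  ∣*∣≤ {x} {y} {a} {b} ∣x∣≤a ∣y∣≤b = ∣∣-least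
    (2x≤2y⇒x≤y (0≤y-x⇒x≤y (≤-resp-≈ refl
      (solve 4 (λ x y a b → (a :- x) :* (b :- :- y) :+ (a :- :- x) :* (b :- y)
                  := a :* b :+ a :* b :- (x :* y :+ x :* y)) refl x y a b)
      (0≤+ (0≤* 0≤a-x 0≤b+y) (0≤* 0≤a+x 0≤b-y)))))
    (2x≤2y⇒x≤y (0≤y-x⇒x≤y (≤-resp-≈ refl
      (solve 4 (λ x y a b → (a :- :- x) :* (b :- :- y) :+ (a :- x) :* (b :- y)
                  := a :* b :+ a :* b :- (:- (x :* y) :+ :- (x :* y))) refl x y a b)
      (0≤+ (0≤* 0≤a+x 0≤b+y) (0≤* 0≤a-x 0≤b-y)))))
    where
    0≤a-x = x≤y⇒0≤y-x (≤-trans (x≤∣x∣ x) ∣x∣≤a)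
    0≤a+x = x≤y⇒0≤y-x (≤-trans (-x≤∣x∣ x) ∣x∣≤a)
    0≤b-y = x≤y⇒0≤y-x (≤-trans (x≤∣x∣ y) ∣y∣≤b)
    0≤b+y = x≤y⇒0≤y-x (≤-trans (-x≤∣x∣ y) ∣y∣≤b)

  -- Multiples and powers

  ·≈* : ∀ n x → n · x ≈ (n · 1#) * x
  ·≈* n x = trans (×-congʳ n (sym (*-identityˡ x))) (sym (×-assoc-* n 1# x))

  0≤· : ∀ n {x} → 0# ≤ x → 0# ≤ n · x
  0≤· zero    0≤x = ≤-refl
  0≤· (suc n) 0≤x = 0≤+ 0≤x (0≤· n 0≤x)

  ·-monoʳ-≤ : ∀ n {x y} → x ≤ y → n · x ≤ n · y
  ·-monoʳ-≤ zero    x≤y = ≤-refl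
  ·-monoʳ-≤ (suc n) x≤y = +-mono-≤ x≤y (·-monoʳ-≤ n x≤y)

  ·-monoˡ-≤ : ∀ {m n x} → 0# ≤ x → m ℕ.≤ n → m · x ≤ n · x
  ·-monoˡ-≤ {n = n} 0≤x ℕ.z≤n       = 0≤· n 0≤x
  ·-monoˡ-≤         0≤x (ℕ.s≤s m≤n) = +-monoʳ-≤ _ (·-monoˡ-≤ 0≤x m≤n)

  archimedean′ : ∀ x {y} → 0# < y → Σ[ N ∈ ℕ ] ∀ n → N ℕ.≤ n → x ≤ n · y
  archimedean′ x {y} 0<y with 0<x⇒Σ-inverse 0<y
  ... | z , _ , yz≈1 with archimedean (x * z)
  ...   | N , xz<N = N , λ n N≤n → begin
    x               ≈⟨ *-identityʳ x ⟨
    x * 1#          ≈⟨ *-congˡ yz≈1 ⟨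
    x * (y * z)     ≈⟨ solve 3 (λ x y z → x :* (y :* z) := x :* z :* y) refl x y z ⟩
    x * z * y       ≤⟨ *-monoˡ-≤ (<⇒≤ 0<y) (<⇒≤ xz<N) ⟩
    (N · 1#) * y    ≈⟨ ·≈* N y ⟨
    N · y           ≤⟨ ·-monoˡ-≤ (<⇒≤ 0<y) N≤n ⟩
    n · y           ∎
    where open ≤-Reasoning

  0≤^ : ∀ {x} n → 0# ≤ x → 0# ≤ x ^ n
  0≤^ zero    0≤x = 0≤1
  0≤^ (suc n) 0≤x = 0≤* 0≤x (0≤^ n 0≤x)

  module _ {x d} (0≤x : 0# ≤ x) (0≤d : 0# ≤ d) (x+d≈1 : x + d ≈ 1#) where
    open ≤-Reasoning

    private
      x≤1 : x ≤ 1#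
      x≤1 = ≤-resp-≈ (+-identityʳ x) x+d≈1 (+-monoʳ-≤ x 0≤d)

    ^≤1 : ∀ n → x ^ n ≤ 1#
    ^≤1 zero    = ≤-refl
    ^≤1 (suc n) = ≤-resp-≈ refl (*-identityˡ 1#) (*-mono-≤ 0≤x 0≤1 x≤1 (^≤1 n))

    ^-antitone : ∀ {m n} → m ℕ.≤ n → x ^ n ≤ x ^ m
    ^-antitone {n = n} ℕ.z≤n       = ^≤1 n
    ^-antitone         (ℕ.s≤s m≤n) = *-monoʳ-≤ 0≤x (^-antitone m≤n)

    -- A form of Bernoulli's inequality. The step is a convex combination, with weights x and d, of
    -- the previous bound and of x ^ suc n ≤ 1. Together with the Archimedean axiom it yields x ^ n
    -- → 0.
    n·d*x^n≤1 : ∀ n → (n · d) * x ^ n ≤ 1#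
    n·d*x^n≤1 zero    = ≤-resp-≈ (sym (zeroˡ 1#)) refl 0≤1
    n·d*x^n≤1 (suc n) = begin
      (d + n · d) * (x * x ^ n)
        ≈⟨ solve 4 (λ d e x y → (d :+ e) :* (x :* y) := x :* (e :* y) :+ d :* (x :* y)) refl d (n · d) x (x ^ n) ⟩
      x * ((n · d) * x ^ n) + d * x ^ suc n
        ≤⟨ +-mono-≤ (*-monoʳ-≤ 0≤x (n·d*x^n≤1 n)) (*-monoʳ-≤ 0≤d (^≤1 (suc n))) ⟩
      x * 1# + d * 1#  ≈⟨ +-cong (*-identityʳ x) (*-identityʳ d) ⟩
      x + d            ≈⟨ x+d≈1 ⟩
      1#               ∎

    -- The same convex combination one order higher, now with the linear bound as second ingredient.
    -- Quadratic growth on the left is what forces n · x ^ n → 0.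
    triangular·d²*x^n≤1 : ∀ n → (triangular (suc n) · (d * d)) * x ^ n ≤ 1#
    triangular·d²*x^n≤1 zero    = ≤-resp-≈ (sym (zeroˡ 1#)) refl 0≤1
    triangular·d²*x^n≤1 (suc n) = begin
      ((suc n ℕ.+ triangular (suc n)) · (d * d)) * (x * x ^ n)
        ≈⟨ *-congʳ (×-homo-+ (d * d) (suc n) (triangular (suc n))) ⟩
      (suc n · (d * d) + Δ) * (x * x ^ n)
        ≈⟨ *-congʳ (+-congʳ (×-comm-* (suc n) d d)) ⟨
      (d * (suc n · d) + Δ) * (x * x ^ n)
        ≈⟨ solve 5 (λ d e t x y → (d :* e :+ t) :* (x :* y) := x :* (t :* y) :+ d :* (e :* (x :* y)))
             refl d (suc n · d) Δ x (x ^ n) ⟩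
      x * (Δ * x ^ n) + d * ((suc n · d) * x ^ suc n)
        ≤⟨ +-mono-≤ (*-monoʳ-≤ 0≤x (triangular·d²*x^n≤1 n)) (*-monoʳ-≤ 0≤d (n·d*x^n≤1 (suc n))) ⟩
      x * 1# + d * 1#  ≈⟨ +-cong (*-identityʳ x) (*-identityʳ d) ⟩
      x + d            ≈⟨ x+d≈1 ⟩
      1#               ∎
      where Δ = triangular (suc n) · (d * d)

  <-≤-trans : ∀ {x y z} → x < y → y ≤ z → x < z
  <-≤-trans {x} {y} {z} x<y y≤z with #-cotrans (<⇒# x<y) z
  ... | inj₁ x#z with #⇒<⊎> x#z
  ...   | inj₁ x<z = x<z
  ...   | inj₂ z<x = ⊥-elim (y≤z (<-trans z<x x<y))
  <-≤-trans {x} {y} {z} x<y y≤z | inj₂ z#y with #⇒<⊎> z#y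
  ...   | inj₁ z<y = ⊥-elim (y≤z z<y)
  ...   | inj₂ y<z = <-trans x<y y<z

  0<suc· : ∀ n {x} → 0# < x → 0# < suc n · x
  0<suc· n 0<x = <-≤-trans 0<x (≤-resp-≈ (+-identityʳ _) refl (+-monoʳ-≤ _ (0≤· n (<⇒≤ 0<x))))

  ·-*-distrib : ∀ m n x y → (m · x) * (n · y) ≈ (m ℕ.* n) · (x * y)
  ·-*-distrib m n x y = begin
    (m · x) * (n · y)    ≈⟨ ×-assoc-* m x (n · y) ⟩
    m · (x * (n · y))    ≈⟨ ×-congʳ m (×-comm-* n x y) ⟩
    m · (n · (x * y))    ≈⟨ ×-assocˡ (x * y) m n ⟩
    (m ℕ.* n) · (x * y)  ∎
    where open ≈-Reasoning

  module _ {x d} (0≤x : 0# ≤ x) (0<d : 0# < d) (x+d≈1 : x + d ≈ 1#) where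
    open ≤-Reasoning

    A*x^n→0 : ∀ A {ε} → 0# < ε → Σ[ N ∈ ℕ ] ∀ n → N ℕ.≤ n → A * x ^ n ≤ ε
    A*x^n→0 A {ε} 0<ε = let N , A≤ = archimedean′ A (*-pos 0<ε 0<d) in N , λ n N≤n → begin
      A * x ^ n                ≤⟨ *-monoˡ-≤ (0≤^ n 0≤x) (A≤ n N≤n) ⟩
      (n · (ε * d)) * x ^ n    ≈⟨ *-congʳ (×-comm-* n ε d) ⟨
      (ε * (n · d)) * x ^ n    ≈⟨ *-assoc _ _ _ ⟩
      ε * ((n · d) * x ^ n)    ≤⟨ *-monoʳ-≤ (<⇒≤ 0<ε) (n·d*x^n≤1 0≤x (<⇒≤ 0<d) x+d≈1 n) ⟩
      ε * 1#                   ≈⟨ *-identityʳ ε ⟩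
      ε                        ∎

    -- Multiplied by n d², the claim reads n² d² x ^ n ≤ n d² ε. The left side is at most 2 by the
    -- second-order bound, and N is chosen to make the right side at least 2.
    n·x^n→0 : ∀ {ε} → 0# < ε → Σ[ N ∈ ℕ ] ∀ n → N ℕ.≤ n → n · x ^ n ≤ ε
    n·x^n→0 {ε} 0<ε = let N , 2≤ = archimedean′ (1# + 1#) (*-pos 0<ε (*-pos 0<d 0<d)) in
      -- `suc N` keeps n positive, as cancelling the factor n d² requires.
      suc N , λ { (suc n) (ℕ.s≤s N≤n) →
      *-cancelˡ-≤ (0<suc· n (*-pos 0<d 0<d)) (step (suc n) (2≤ (suc n) (ℕ.m≤n⇒m≤1+n N≤n))) }
      where
      step : ∀ n → 1# + 1# ≤ n · (ε * (d * d)) → (n · (d * d)) * (n · x ^ n) ≤ (n · (d * d)) * ε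
      step n 2≤n = begin
        (n · (d * d)) * (n · x ^ n)   ≈⟨ ·-*-distrib n n (d * d) (x ^ n) ⟩
        (n ℕ.* n) · (d * d * x ^ n)
          ≤⟨ ·-monoˡ-≤ (0≤* (0≤* (<⇒≤ 0<d) (<⇒≤ 0<d)) (0≤^ n 0≤x)) (n*n≤2triangular n) ⟩
        (triangular (suc n) ℕ.+ triangular (suc n)) · (d * d * x ^ n)
          ≈⟨ ×-homo-+ _ (triangular (suc n)) (triangular (suc n)) ⟩
        triangular (suc n) · (d * d * x ^ n) + triangular (suc n) · (d * d * x ^ n)
          ≈⟨ +-cong (×-assoc-* (triangular (suc n)) _ _) (×-assoc-* (triangular (suc n)) _ _) ⟨
        (triangular (suc n) · (d * d)) * x ^ n + (triangular (suc n) · (d * d)) * x ^ n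
          ≤⟨ +-mono-≤ (triangular·d²*x^n≤1 0≤x (<⇒≤ 0<d) x+d≈1 n) (triangular·d²*x^n≤1 0≤x (<⇒≤ 0<d) x+d≈1 n) ⟩
        1# + 1#                       ≤⟨ 2≤n ⟩
        n · (ε * (d * d))             ≈⟨ ×-comm-* n ε (d * d) ⟨
        ε * (n · (d * d))             ≈⟨ *-comm _ _ ⟩
        (n · (d * d)) * ε             ∎

-- Exponential generating functions without division by factorials:
-- the sum of φ |S| |[n] ∖ S| over all S ⊆ [n], by recursion on whether the
-- first element lies in S.
module BinomialSum {c ℓ₁ ℓ₂} (ℝ : CompleteOrderedField c ℓ₁ ℓ₂) where
  open CompleteOrderedField ℝ
  open OrderedField ℝ
  open SemiringMult semiring using (×-homo-+)
  open CommutativeMonoidSum (CommutativeRing.+-commutativeMonoid commutativeRing)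
    using (∑-distrib-+; sum-cong-≋)
  private module ≈-Reasoning = SetoidReasoning setoid

  Σ⊆ : (ℕ → ℕ → Carrier) → ℕ → Carrier
  Σ⊆ φ zero    = φ 0 0
  Σ⊆ φ (suc n) = Σ⊆ (λ k l → φ (suc k) l) n + Σ⊆ (λ k l → φ k (suc l)) n

  Σ⊆-cong : ∀ {φ ψ} n → (∀ k l → k ℕ.+ l ≡ n → φ k l ≈ ψ k l) → Σ⊆ φ n ≈ Σ⊆ ψ n
  Σ⊆-cong zero    φ≈ψ = φ≈ψ 0 0 ≡.refl
  Σ⊆-cong (suc n) φ≈ψ = +-cong
    (Σ⊆-cong n λ k l eq → φ≈ψ (suc k) l (≡.cong suc eq))
    (Σ⊆-cong n λ k l eq → φ≈ψ k (suc l) (≡.trans (ℕ.+-suc k l) (≡.cong suc eq)))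

  Σ⊆-mono-≤ : ∀ {φ ψ} n → (∀ k l → k ℕ.+ l ≡ n → φ k l ≤ ψ k l) → Σ⊆ φ n ≤ Σ⊆ ψ n
  Σ⊆-mono-≤ zero    φ≤ψ = φ≤ψ 0 0 ≡.refl
  Σ⊆-mono-≤ (suc n) φ≤ψ = +-mono-≤
    (Σ⊆-mono-≤ n λ k l eq → φ≤ψ (suc k) l (≡.cong suc eq))
    (Σ⊆-mono-≤ n λ k l eq → φ≤ψ k (suc l) (≡.trans (ℕ.+-suc k l) (≡.cong suc eq)))

  ∣Σ⊆∣≤ : ∀ {φ ψ} n → (∀ k l → k ℕ.+ l ≡ n → ∣ φ k l ∣ ≤ ψ k l) → ∣ Σ⊆ φ n ∣ ≤ Σ⊆ ψ n
  ∣Σ⊆∣≤ zero    φ≤ψ = φ≤ψ 0 0 ≡.refl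
  ∣Σ⊆∣≤ (suc n) φ≤ψ = ∣+∣≤
    (∣Σ⊆∣≤ n λ k l eq → φ≤ψ (suc k) l (≡.cong suc eq))
    (∣Σ⊆∣≤ n λ k l eq → φ≤ψ k (suc l) (≡.trans (ℕ.+-suc k l) (≡.cong suc eq)))

  Σ⊆-distrib-+ : ∀ φ ψ n → Σ⊆ (λ k l → φ k l + ψ k l) n ≈ Σ⊆ φ n + Σ⊆ ψ n
  Σ⊆-distrib-+ φ ψ zero    = refl
  Σ⊆-distrib-+ φ ψ (suc n) = trans
    (+-cong (Σ⊆-distrib-+ (λ k l → φ (suc k) l) (λ k l → ψ (suc k) l) n)
            (Σ⊆-distrib-+ (λ k l → φ k (suc l)) (λ k l → ψ k (suc l)) n))
    (solve 4 (λ a b c d → (a :+ b) :+ (c :+ d) := (a :+ c) :+ (b :+ d)) refl _ _ _ _)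

  *-distribˡ-Σ⊆ : ∀ x φ n → x * Σ⊆ φ n ≈ Σ⊆ (λ k l → x * φ k l) n
  *-distribˡ-Σ⊆ x φ zero    = refl
  *-distribˡ-Σ⊆ x φ (suc n) = trans (distribˡ _ _ _)
    (+-cong (*-distribˡ-Σ⊆ x (λ k l → φ (suc k) l) n) (*-distribˡ-Σ⊆ x (λ k l → φ k (suc l)) n))

  Σ⊆-0 : ∀ n → Σ⊆ (λ _ _ → 0#) n ≈ 0#
  Σ⊆-0 zero    = refl
  Σ⊆-0 (suc n) = trans (+-cong (Σ⊆-0 n) (Σ⊆-0 n)) (+-identityˡ 0#)

  Σ⊆-const : ∀ x n → Σ⊆ (λ _ _ → x) n ≈ (1# + 1#) ^ n * x
  Σ⊆-const x zero    = sym (*-identityˡ x)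
  Σ⊆-const x (suc n) = trans (+-cong (Σ⊆-const x n) (Σ⊆-const x n))
    (solve 2 (λ y x → y :* x :+ y :* x := (con (+ 1) :+ con (+ 1)) :* y :* x) refl _ x)

  Σ⊆-flip : ∀ φ n → Σ⊆ φ n ≈ Σ⊆ (λ k l → φ l k) n
  Σ⊆-flip φ zero    = refl
  Σ⊆-flip φ (suc n) = trans
    (+-cong (Σ⊆-flip (λ k l → φ (suc k) l) n) (Σ⊆-flip (λ k l → φ k (suc l)) n)) (+-comm _ _)

  δ : ℕ → Carrier
  δ zero    = 1#
  δ (suc n) = 0#

  Σ⊆-δ : ∀ (φ : ℕ → ℕ → Carrier) n → Σ⊆ (λ k l → δ k * φ k l) n ≈ φ 0 n
  Σ⊆-δ φ zero    = *-identityˡ _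
  Σ⊆-δ φ (suc n) = begin
    Σ⊆ (λ k l → 0# * φ (suc k) l) n + Σ⊆ (λ k l → δ k * φ k (suc l)) n
      ≈⟨ +-cong (trans (Σ⊆-cong n λ _ _ _ → zeroˡ _) (Σ⊆-0 n)) (Σ⊆-δ (λ k l → φ k (suc l)) n) ⟩
    0# + φ 0 (suc n)  ≈⟨ +-identityˡ _ ⟩
    φ 0 (suc n)       ∎
    where open ≈-Reasoning

  Σ< : ℕ → (ℕ → Carrier) → Carrier
  Σ< N f = sum {N} λ k → f (toℕ k)

  private
    Pascal-sum : ∀ (f : ℕ → Carrier) n N →
      Σ< (suc N) (λ k → (suc n C k) · f k) ≈
      Σ< N (λ k → (n C k) · f (suc k)) + Σ< (suc N) (λ k → (n C k) · f k)
    Pascal-sum f n N = begin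
      1 · f 0 + Σ< N (λ k → (suc n C suc k) · f (suc k))
        ≈⟨ +-congˡ (sum-cong-≋ {N} λ k → trans
             (reflexive (≡.cong (_· f (suc (toℕ k))) (≡.sym (nCk+nC[k+1]≡[n+1]C[k+1] n (toℕ k)))))
             (×-homo-+ _ (n C toℕ k) _)) ⟩
      1 · f 0 + Σ< N (λ k → (n C k) · f (suc k) + (n C suc k) · f (suc k))
        ≈⟨ +-congˡ (∑-distrib-+ {N} _ _) ⟩
      1 · f 0 + (Σ< N (λ k → (n C k) · f (suc k)) + Σ< N (λ k → (n C suc k) · f (suc k)))
        ≈⟨ solve 3 (λ a b c → a :+ (b :+ c) := b :+ (a :+ c)) refl _ _ _ ⟩
      Σ< N (λ k → (n C k) · f (suc k)) + (1 · f 0 + Σ< N (λ k → (n C suc k) · f (suc k))) ∎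
      where open ≈-Reasoning

  -- Subsets are grouped by size, and Pascal's rule matches the recursion of `Σ⊆`. The cut-off N is
  -- independent of n, so a finitely supported factor yields a fixed number of summands as n grows.
  Σ⊆-binomial : ∀ φ N n → (∀ k l → N ℕ.≤ k → φ k l ≈ 0#) →
    Σ⊆ φ n ≈ Σ< N (λ k → (n C k) · φ k (n ∸ k))
  Σ⊆-binomial φ zero    n vanish =
    trans (Σ⊆-cong n λ k l _ → vanish k l ℕ.z≤n) (Σ⊆-0 n)
  Σ⊆-binomial φ (suc N) zero vanish = begin
    φ 0 0               ≈⟨ trans (+-identityʳ _) (+-identityʳ _) ⟨
    1 · φ 0 0 + 0#      ≈⟨ +-congˡ (trans (sum-cong-≋ {N} λ _ → refl) (sum-replicate-zero N)) ⟨
    1 · φ 0 0 + Σ< N (λ k → (0 C suc k) · φ (suc k) 0) ∎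
    where open ≈-Reasoning
          open MonoidSum +-monoid using (sum-replicate-zero)
  Σ⊆-binomial φ (suc N) (suc n) vanish = begin
    Σ⊆ (λ k l → φ (suc k) l) n + Σ⊆ (λ k l → φ k (suc l)) n
      ≈⟨ +-cong (Σ⊆-binomial _ N n λ k l N≤k → vanish (suc k) l (ℕ.s≤s N≤k))
                (Σ⊆-binomial _ (suc N) n λ k l → vanish k (suc l)) ⟩
    Σ< N (λ k → (n C k) · φ (suc k) (n ∸ k)) +
    Σ< (suc N) (λ k → (n C k) · φ k (suc (n ∸ k)))
      ≈⟨ +-congˡ (sum-cong-≋ {suc N} λ k → shift (toℕ k)) ⟩
    Σ< N (λ k → (n C k) · φ (suc k) (n ∸ k)) +
    Σ< (suc N) (λ k → (n C k) · φ k (suc n ∸ k))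
      ≈⟨ Pascal-sum (λ k → φ k (suc n ∸ k)) n N ⟨
    Σ< (suc N) (λ k → (suc n C k) · φ k (suc n ∸ k)) ∎
    where
    open ≈-Reasoning
    -- For k > n truncated subtraction makes the two arguments differ, but there the binomial
    -- coefficient is 0.
    shift : ∀ k → (n C k) · φ k (suc (n ∸ k)) ≈ (n C k) · φ k (suc n ∸ k)
    shift k with k ℕ.≤? n
    ... | yes k≤n = reflexive (≡.cong (λ m → (n C k) · φ k m) (≡.sym (ℕ.+-∸-assoc 1 k≤n)))
    ... | no  k≰n rewrite k>n⇒nCk≡0 (ℕ.≰⇒> k≰n) = refl

-- The commutative ring of sequences under the twisted product

module TwistedProduct {c ℓ₁ ℓ₂} (ℝ : CompleteOrderedField c ℓ₁ ℓ₂)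
  (q : CompleteOrderedField.Carrier ℝ) where
  open CompleteOrderedField ℝ
  open OrderedField ℝ using (solve; _:=_; _:+_; _:*_; con)
  open BinomialSum ℝ
  open SemiringExp semiring using (^-homo-*; ^-congʳ)
  private module ≈-Reasoning = SetoidReasoning setoid

  Sequence : Set c
  Sequence = ℕ → Carrier

  infix  4 _≋_
  infixl 7 _⊛_
  infixl 6 _⊕_

  _≋_ : Sequence → Sequence → Set ℓ₁
  u ≋ v = ∀ n → u n ≈ v n

  _⊕_ : Sequence → Sequence → Sequence
  (u ⊕ v) n = u n + v n

  _⊛_ : Sequence → Sequence → Sequence
  (u ⊛ v) n = Σ⊆ (λ k l → q ^ (k ℕ.* l) * (u k * v l)) n

  private
    shift : Sequence → Sequence
    shift u n = u (suc n)

    twist : Sequence → Sequence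
    twist u n = q ^ n * u n

    -- The shift is a twisted derivation; all ring laws follow from this by
    -- induction on the index.
    ⊛-suc : ∀ u v n → (u ⊛ v) (suc n) ≈ (shift u ⊛ twist v) n + (twist u ⊛ shift v) n
    ⊛-suc u v n = +-cong
      (Σ⊆-cong n λ k l _ → begin
        q ^ (l ℕ.+ k ℕ.* l) * (u (suc k) * v l)
          ≈⟨ *-congʳ (^-homo-* q l (k ℕ.* l)) ⟩
        q ^ l * q ^ (k ℕ.* l) * (u (suc k) * v l)
          ≈⟨ solve 4 (λ a b c d → a :* b :* (c :* d) := b :* (c :* (a :* d))) refl _ _ _ _ ⟩
        q ^ (k ℕ.* l) * (u (suc k) * (q ^ l * v l)) ∎)
      (Σ⊆-cong n λ k l _ → begin
        q ^ (k ℕ.* suc l) * (u k * v (suc l))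
          ≡⟨ ≡.cong (λ e → q ^ e * (u k * v (suc l))) (ℕ.*-suc k l) ⟩
        q ^ (k ℕ.+ k ℕ.* l) * (u k * v (suc l))
          ≈⟨ *-congʳ (^-homo-* q k (k ℕ.* l)) ⟩
        q ^ k * q ^ (k ℕ.* l) * (u k * v (suc l))
          ≈⟨ solve 4 (λ a b c d → a :* b :* (c :* d) := b :* (a :* c :* d)) refl _ _ _ _ ⟩
        q ^ (k ℕ.* l) * (q ^ k * u k * v (suc l)) ∎)
      where open ≈-Reasoning

    twist-⊛ : ∀ u v → twist (u ⊛ v) ≋ twist u ⊛ twist v
    twist-⊛ u v n = trans (*-distribˡ-Σ⊆ (q ^ n) _ n) (Σ⊆-cong n λ { k l ≡.refl → begin
        q ^ (k ℕ.+ l) * (q ^ (k ℕ.* l) * (u k * v l))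
          ≈⟨ *-congʳ (^-homo-* q k l) ⟩
        q ^ k * q ^ l * (q ^ (k ℕ.* l) * (u k * v l))
          ≈⟨ solve 5 (λ a b c d e → a :* b :* (c :* (d :* e)) := c :* (a :* d :* (b :* e))) refl _ _ _ _ _ ⟩
        q ^ (k ℕ.* l) * (q ^ k * u k * (q ^ l * v l)) ∎ })
      where open ≈-Reasoning

  ⊛-cong : ∀ {u u′ v v′} → u ≋ u′ → v ≋ v′ → u ⊛ v ≋ u′ ⊛ v′
  ⊛-cong u≋u′ v≋v′ n = Σ⊆-cong n λ k l _ → *-congˡ (*-cong (u≋u′ k) (v≋v′ l))

  ⊛-comm : ∀ u v → u ⊛ v ≋ v ⊛ u
  ⊛-comm u v n = trans (Σ⊆-flip _ n) (Σ⊆-cong n λ k l _ →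
    *-cong (^-congʳ q (ℕ.*-comm l k)) (*-comm _ _))

  ⊛-distribʳ : ∀ w u v → (u ⊕ v) ⊛ w ≋ u ⊛ w ⊕ v ⊛ w
  ⊛-distribʳ w u v n = trans
    (Σ⊆-cong n λ k l _ → solve 4 (λ a b c d → a :* ((b :+ c) :* d) := a :* (b :* d) :+ a :* (c :* d)) refl _ _ _ _)
    (Σ⊆-distrib-+ _ _ n)

  ⊛-distribˡ : ∀ w u v → w ⊛ (u ⊕ v) ≋ w ⊛ u ⊕ w ⊛ v
  ⊛-distribˡ w u v n = trans (⊛-comm w (u ⊕ v) n)
    (trans (⊛-distribʳ w u v n) (+-cong (⊛-comm u w n) (⊛-comm v w n)))

  ⊛-identityˡ : ∀ u → δ ⊛ u ≋ u
  ⊛-identityˡ u n = begin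
    Σ⊆ (λ k l → q ^ (k ℕ.* l) * (δ k * u l)) n
      ≈⟨ Σ⊆-cong n (λ k l _ → solve 3 (λ a b c → a :* (b :* c) := b :* (a :* c)) refl _ _ _) ⟩
    Σ⊆ (λ k l → δ k * (q ^ (k ℕ.* l) * u l)) n
      ≈⟨ Σ⊆-δ (λ k l → q ^ (k ℕ.* l) * u l) n ⟩
    1# * u n
      ≈⟨ *-identityˡ _ ⟩
    u n ∎
    where open ≈-Reasoning

  -- As in the Leibniz rule for a triple product, the shift of either side expands into three terms,
  -- one for each factor shifted, and these agree by induction. Multiplicativity of `twist`
  -- distributes the powers of q over the unshifted factors.
  ⊛-assoc : ∀ u v w → (u ⊛ v) ⊛ w ≋ u ⊛ (v ⊛ w)
  ⊛-assoc u v w zero = solve 3 (λ a b c →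
    con (+ 1) :* ((con (+ 1) :* (a :* b)) :* c) := con (+ 1) :* (a :* (con (+ 1) :* (b :* c)))) refl _ _ _
  ⊛-assoc u v w (suc n) = begin
    ((u ⊛ v) ⊛ w) (suc n)
      ≈⟨ ⊛-suc (u ⊛ v) w n ⟩
    (shift (u ⊛ v) ⊛ twist w) n + (twist (u ⊛ v) ⊛ shift w) n
      ≈⟨ +-cong (trans (⊛-cong (⊛-suc u v) (λ _ → refl) n) (⊛-distribʳ (twist w) _ _ n))
                (⊛-cong (twist-⊛ u v) (λ _ → refl) n) ⟩
    ((shift u ⊛ twist v) ⊛ twist w) n + ((twist u ⊛ shift v) ⊛ twist w) n + ((twist u ⊛ twist v) ⊛ shift w) n
      ≈⟨ +-cong (+-cong (⊛-assoc (shift u) (twist v) (twist w) n) (⊛-assoc (twist u) (shift v) (twist w) n))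
                (⊛-assoc (twist u) (twist v) (shift w) n) ⟩
    (shift u ⊛ (twist v ⊛ twist w)) n + (twist u ⊛ (shift v ⊛ twist w)) n + (twist u ⊛ (twist v ⊛ shift w)) n
      ≈⟨ +-assoc _ _ _ ⟩
    (shift u ⊛ (twist v ⊛ twist w)) n + ((twist u ⊛ (shift v ⊛ twist w)) n + (twist u ⊛ (twist v ⊛ shift w)) n)
      ≈⟨ +-cong (⊛-cong (λ _ → refl) (twist-⊛ v w) n) (⊛-distribˡ (twist u) _ _ n) ⟨
    (shift u ⊛ twist (v ⊛ w)) n + (twist u ⊛ (shift v ⊛ twist w ⊕ twist v ⊛ shift w)) n
      ≈⟨ +-congˡ (⊛-cong (λ _ → refl) (⊛-suc v w) n) ⟨
    (shift u ⊛ twist (v ⊛ w)) n + (twist u ⊛ shift (v ⊛ w)) n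
      ≈⟨ ⊛-suc u (v ⊛ w) n ⟨
    (u ⊛ (v ⊛ w)) (suc n) ∎
    where open ≈-Reasoning

  -- Packaged as a ring so that the algebra of `LinearisedPowers`, stated over any commutative ring,
  -- applies to sequences.
  sequenceRing : CommutativeRing c ℓ₁
  sequenceRing = record
    { Carrier = Sequence
    ; _≈_ = _≋_
    ; _+_ = _⊕_
    ; _*_ = _⊛_
    ; -_  = λ u n → - u n
    ; 0#  = λ _ → 0#
    ; 1#  = δ
    ; isCommutativeRing = record
      { isRing = record
        { +-isAbelianGroup = record
          { isGroup = record
            { isMonoid = record
              { isSemigroup = record
                { isMagma = record
                  { isEquivalence = record
                    { refl  = λ _ → refl
                    ; sym   = λ u≋v n → sym (u≋v n)
                    ; trans = λ u≋v v≋w n → trans (u≋v n) (v≋w n)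
                    }
                  ; ∙-cong = λ u≋u′ v≋v′ n → +-cong (u≋u′ n) (v≋v′ n)
                  }
                ; assoc = λ u v w n → +-assoc _ _ _
                }
              ; identity = (λ u n → +-identityˡ _) , (λ u n → +-identityʳ _)
              }
            ; inverse = (λ u n → -‿inverseˡ _) , (λ u n → -‿inverseʳ _)
            ; ⁻¹-cong = λ u≋v n → -‿cong (u≋v n)
            }
          ; comm = λ u v n → +-comm _ _
          }
        ; *-cong = ⊛-cong
        ; *-assoc = ⊛-assoc
        ; *-identity = ⊛-identityˡ , λ u n → trans (⊛-comm u δ n) (⊛-identityˡ u n)
        ; distrib = ⊛-distribˡ , ⊛-distribʳ
        }
      ; *-comm = ⊛-comm
      }
    }

-- Eventual statements and bounded sequences

Eventually : ∀ {a} → (ℕ → Set a) → Set a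
Eventually P = Σ[ N ∈ ℕ ] ∀ n → N ℕ.≤ n → P n

eventually-map₂ : ∀ {a b c} {P : ℕ → Set a} {Q : ℕ → Set b} {R : ℕ → Set c} →
  (∀ n → P n → Q n → R n) → Eventually P → Eventually Q → Eventually R
eventually-map₂ f (M , p) (N , q) = M ℕ.+ N , λ n M+N≤n →
  f n (p n (ℕ.m+n≤o⇒m≤o M M+N≤n)) (q n (ℕ.m+n≤o⇒n≤o M M+N≤n))

eventually-map : ∀ {a b} {P : ℕ → Set a} {Q : ℕ → Set b} →
  (∀ n → P n → Q n) → Eventually P → Eventually Q
eventually-map f (N , p) = N , λ n N≤n → f n (p n N≤n)

module BoundedSequences {c ℓ₁ ℓ₂} (ℝ : CompleteOrderedField c ℓ₁ ℓ₂) where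
  open CompleteOrderedField ℝ
  open OrderedField ℝ

  Bounded : (ℕ → Carrier) → Set _
  Bounded u = Σ[ K ∈ Carrier ] ∀ n → ∣ u n ∣ ≤ K

  prefix-bounded : ∀ (u : ℕ → Carrier) N → Σ[ K ∈ Carrier ] (0# ≤ K × ∀ n → n ℕ.< N → ∣ u n ∣ ≤ K)
  prefix-bounded u zero    = 0# , ≤-refl , λ _ ()
  prefix-bounded u (suc N) = let K , 0≤K , ≤K = prefix-bounded u N in
    K + ∣ u N ∣ , 0≤+ 0≤K (0≤∣x∣ _) , λ n n<1+N → bound ≤K 0≤K n (ℕ.m<1+n⇒m<n∨m≡n n<1+N)
    where
    bound : ∀ {K} → (∀ n → n ℕ.< N → ∣ u n ∣ ≤ K) → 0# ≤ K → ∀ n →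
            n ℕ.< N ⊎ n ≡ N → ∣ u n ∣ ≤ K + ∣ u N ∣
    bound ≤K 0≤K n (inj₁ n<N)    = ≤-resp-≈ (+-identityʳ _) refl (+-mono-≤ (≤K n n<N) (0≤∣x∣ _))
    bound ≤K 0≤K n (inj₂ ≡.refl) = ≤-resp-≈ (+-identityˡ _) refl (+-monoˡ-≤ _ 0≤K)

  eventually-bounded⇒bounded : ∀ (u : ℕ → Carrier) {K} → 0# ≤ K → Eventually (λ n → ∣ u n ∣ ≤ K) → Bounded u
  eventually-bounded⇒bounded u {K} 0≤K (N , ≤K) = let L , 0≤L , ≤L = prefix-bounded u N in
    L + K , λ n → bound ≤L 0≤L n (ℕ.<-≤-connex n N)
    where
    bound : ∀ {L} → (∀ n → n ℕ.< N → ∣ u n ∣ ≤ L) → 0# ≤ L → ∀ n →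
            n ℕ.< N ⊎ N ℕ.≤ n → ∣ u n ∣ ≤ L + K
    bound ≤L 0≤L n (inj₁ n<N) = ≤-resp-≈ (+-identityʳ _) refl (+-mono-≤ (≤L n n<N) 0≤K)
    bound ≤L 0≤L n (inj₂ N≤n) = ≤-resp-≈ (+-identityˡ _) refl (+-mono-≤ 0≤L (≤K n N≤n))

  bound-nonneg : ∀ {x K} → ∣ x ∣ ≤ K → 0# ≤ K
  bound-nonneg ∣x∣≤K = ≤-trans (0≤∣x∣ _) ∣x∣≤K

-- Estimates for the twisted product

module TwistedEstimates {c ℓ₁ ℓ₂} (ℝ : CompleteOrderedField c ℓ₁ ℓ₂)
  {q p : CompleteOrderedField.Carrier ℝ}
  (0<q : CompleteOrderedField._<_ ℝ (CompleteOrderedField.0# ℝ) q)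
  (0<p : CompleteOrderedField._<_ ℝ (CompleteOrderedField.0# ℝ) p)
  (q+p≈1 : CompleteOrderedField._≈_ ℝ (CompleteOrderedField._+_ ℝ q p) (CompleteOrderedField.1# ℝ)) where

  open CompleteOrderedField ℝ
  open OrderedField ℝ
  open BinomialSum ℝ
  open TwistedProduct ℝ q
  open BoundedSequences ℝ
  open SemiringExp semiring using (^-homo-*; ^-congʳ)
  private module ≈-Reasoning = SetoidReasoning setoid

  0≤q : 0# ≤ q
  0≤q = <⇒≤ 0<q

  0≤p : 0# ≤ p
  0≤p = <⇒≤ 0<p

  0≤q^ : ∀ n → 0# ≤ q ^ n
  0≤q^ n = 0≤^ n 0≤q

  q^≤1 : ∀ n → q ^ n ≤ 1#
  q^≤1 = ^≤1 0≤q 0≤p q+p≈1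

  q^-antitone : ∀ {m n} → m ℕ.≤ n → q ^ n ≤ q ^ m
  q^-antitone = ^-antitone 0≤q 0≤p q+p≈1

  0<q^n : ∀ n → 0# < q ^ n
  0<q^n zero    = 0<1
  0<q^n (suc n) = *-pos 0<q (0<q^n n)

  -- The weight q ^ (k l) on proper nonempty subsets only. The two trivial subsets have weight 1 for
  -- every n and would keep the sum from becoming small.
  interior : ℕ → ℕ → Carrier
  interior zero    l       = 0#
  interior (suc k) zero    = 0#
  interior (suc k) (suc l) = q ^ (suc k ℕ.* suc l)

  0≤interior : ∀ k l → 0# ≤ interior k l
  0≤interior zero    l       = ≤-refl
  0≤interior (suc k) zero    = ≤-refl
  0≤interior (suc k) (suc l) = 0≤q^ (suc k ℕ.* suc l)

  -- The δ terms restore the trivial subsets; the inequality is strict at k = l = 0, which both of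
  -- them count.
  q^≤interior : ∀ k l → q ^ (k ℕ.* l) ≤ interior k l + (δ k * 1# + δ l * 1#)
  q^≤interior zero zero = ≤-resp-≈ refl
    (solve 0 (con (+ 1) :+ con (+ 1) := con (+ 0) :+ (con (+ 1) :* con (+ 1) :+ con (+ 1) :* con (+ 1))) refl)
    (≤-resp-≈ (+-identityʳ 1#) refl (+-monoʳ-≤ 1# 0≤1))
  q^≤interior zero (suc l) = ≤-reflexive
    (solve 0 (con (+ 1) := con (+ 0) :+ (con (+ 1) :* con (+ 1) :+ con (+ 0) :* con (+ 1))) refl)
  q^≤interior (suc k) zero = ≤-reflexive (trans (^-congʳ q (ℕ.*-zeroʳ k))
    (solve 0 (con (+ 1) := con (+ 0) :+ (con (+ 0) :* con (+ 1) :+ con (+ 1) :* con (+ 1))) refl))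
  q^≤interior (suc k) (suc l) = ≤-reflexive
    (solve 1 (λ x → x := x :+ (con (+ 0) :* con (+ 1) :+ con (+ 0) :* con (+ 1))) refl _)

  Σ⊆-interior : ℕ → Carrier
  Σ⊆-interior = Σ⊆ interior

  0≤Σ⊆-interior : ∀ n → 0# ≤ Σ⊆-interior n
  0≤Σ⊆-interior n = ≤-resp-≈ (Σ⊆-0 n) refl (Σ⊆-mono-≤ n λ k l _ → 0≤interior k l)

  Σ⊆-δʳ : ∀ (φ : ℕ → ℕ → Carrier) n → Σ⊆ (λ k l → δ l * φ k l) n ≈ φ n 0
  Σ⊆-δʳ φ n = trans (Σ⊆-flip _ n) (Σ⊆-δ (λ k l → φ l k) n)

  -- (1 - q ^ a) (1 - q ^ b) ≥ 0
  q^a+q^b≤1+q^[a+b] : ∀ a b → q ^ a + q ^ b ≤ 1# + q ^ (a ℕ.+ b)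
  q^a+q^b≤1+q^[a+b] a b = 0≤y-x⇒x≤y (≤-resp-≈ refl eq
    (0≤* (x≤y⇒0≤y-x (q^≤1 a)) (x≤y⇒0≤y-x (q^≤1 b))))
    where
    eq : (1# - q ^ a) * (1# - q ^ b) ≈ 1# + q ^ (a ℕ.+ b) - (q ^ a + q ^ b)
    eq = trans (solve 2 (λ x y → (con (+ 1) :- x) :* (con (+ 1) :- y) := con (+ 1) :+ x :* y :- (x :+ y)) refl _ _)
      (+-congʳ (+-congˡ (sym (^-homo-* q a b))))

  -- The new vertex joins either side of the split. For k, l ≥ 1 the two weights add up to q ^ (k l)
  -- (q ^ k + q ^ l), and extracting one factor q from the bracket bounds it by q + q ^ n. A trivial
  -- split becomes interior in just one way, with weight q ^ suc n.
  interior-step : ∀ n k l → k ℕ.+ l ≡ suc n →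
    interior (suc k) l + interior k (suc l) ≤
    (q + q ^ n) * interior k l + (δ k * q ^ suc n + δ l * q ^ suc n)
  interior-step n zero (suc l) ≡.refl = ≤-reflexive (begin
    q ^ (suc n ℕ.+ 0) + 0#   ≈⟨ +-congʳ (^-congʳ q (ℕ.+-identityʳ (suc n))) ⟩
    q ^ suc n + 0#
      ≈⟨ solve 2 (λ x y → x :+ con (+ 0) := y :* con (+ 0) :+ (con (+ 1) :* x :+ con (+ 0) :* x)) refl _ _ ⟩
    (q + q ^ n) * 0# + (1# * q ^ suc n + 0# * q ^ suc n) ∎)
    where open ≈-Reasoning
  interior-step n (suc k) zero eq = ≤-reflexive (begin
    0# + q ^ (suc k ℕ.* 1)
      ≡⟨ ≡.cong (λ e → 0# + q ^ e) (≡.trans (ℕ.*-identityʳ (suc k)) (≡.trans (≡.sym (ℕ.+-identityʳ (suc k))) eq)) ⟩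
    0# + q ^ suc n
      ≈⟨ solve 2 (λ x y → con (+ 0) :+ x := y :* con (+ 0) :+ (con (+ 0) :* x :+ con (+ 1) :* x)) refl _ _ ⟩
    (q + q ^ n) * 0# + (0# * q ^ suc n + 1# * q ^ suc n) ∎)
    where open ≈-Reasoning
  interior-step .(k ℕ.+ suc l) (suc k) (suc l) ≡.refl = begin
    q ^ (suc (suc k) ℕ.* suc l) + q ^ (suc k ℕ.* suc (suc l))
      ≈⟨ +-cong (^-homo-* q (suc l) (suc k ℕ.* suc l))
                (trans (^-congʳ q (ℕ.*-suc (suc k) (suc l))) (^-homo-* q (suc k) (suc k ℕ.* suc l))) ⟩
    q * q ^ l * x + q * q ^ k * x
      ≈⟨ solve 4 (λ q a b x → q :* a :* x :+ q :* b :* x := x :* (q :* (b :+ a))) refl _ _ _ _ ⟩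
    x * (q * (q ^ k + q ^ l))
      ≤⟨ *-monoʳ-≤ (0≤q^ (suc k ℕ.* suc l)) (*-monoʳ-≤ 0≤q (q^a+q^b≤1+q^[a+b] k l)) ⟩
    x * (q * (1# + q ^ (k ℕ.+ l)))
      ≈⟨ solve 3 (λ q x y → x :* (q :* (con (+ 1) :+ y)) := (q :+ q :* y) :* x) refl q x _ ⟩
    (q + q ^ suc (k ℕ.+ l)) * x
      ≈⟨ *-congʳ (+-congˡ (^-congʳ q (≡.sym (ℕ.+-suc k l)))) ⟩
    (q + q ^ (k ℕ.+ suc l)) * x
      ≈⟨ solve 2 (λ y z → y := y :+ (con (+ 0) :* z :+ con (+ 0) :* z)) refl _ _ ⟩
    (q + q ^ (k ℕ.+ suc l)) * x + (0# * q ^ suc (k ℕ.+ suc l) + 0# * q ^ suc (k ℕ.+ suc l)) ∎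
    where
    open ≤-Reasoning
    x = q ^ (suc k ℕ.* suc l)

  -- A linear recurrence whose factor is eventually below 1, as q < 1, and whose error term decays.
  Σ⊆-interior-step : ∀ n →
    Σ⊆-interior (suc (suc n)) ≤ (q + q ^ n) * Σ⊆-interior (suc n) + (q ^ suc n + q ^ suc n)
  Σ⊆-interior-step n = begin
    Σ⊆-interior (suc (suc n))
      ≈⟨ Σ⊆-distrib-+ (λ k l → interior (suc k) l) (λ k l → interior k (suc l)) (suc n) ⟨
    Σ⊆ (λ k l → interior (suc k) l + interior k (suc l)) (suc n)
      ≤⟨ Σ⊆-mono-≤ (suc n) (interior-step n) ⟩
    Σ⊆ (λ k l → (q + q ^ n) * interior k l + (δ k * q ^ suc n + δ l * q ^ suc n)) (suc n)
      ≈⟨ trans (Σ⊆-distrib-+ (λ k l → (q + q ^ n) * interior k l)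
                             (λ k l → δ k * q ^ suc n + δ l * q ^ suc n) (suc n))
           (+-congˡ (Σ⊆-distrib-+ (λ k l → δ k * q ^ suc n) (λ k l → δ l * q ^ suc n) (suc n))) ⟩
    Σ⊆ (λ k l → (q + q ^ n) * interior k l) (suc n) +
      (Σ⊆ (λ k l → δ k * q ^ suc n) (suc n) + Σ⊆ (λ k l → δ l * q ^ suc n) (suc n))
      ≈⟨ +-cong (sym (*-distribˡ-Σ⊆ (q + q ^ n) interior (suc n)))
           (+-cong (Σ⊆-δ (λ _ _ → q ^ suc n) (suc n)) (Σ⊆-δʳ (λ _ _ → q ^ suc n) (suc n))) ⟩
    (q + q ^ n) * Σ⊆-interior (suc n) + (q ^ suc n + q ^ suc n) ∎
    where open ≤-Reasoning

  private
    two four : Carrier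
    two  = 1# + 1#
    four = two + two

    -- With θ = 1 - d, the bound 4 y ≤ 4 θ ^ j y₀ + 1 propagates along
    -- y ↦ θ y + 2 x as long as 8 x ≤ d.
    decay-step : ∀ {θ d x y y′ B} → 0# ≤ θ → θ + d ≈ 1# → (four + four) * x ≤ d →
      y′ ≤ θ * y + (x + x) → four * y ≤ B + 1# → four * y′ ≤ θ * B + 1#
    decay-step {θ} {d} {x} {y} {y′} {B} 0≤θ θ+d≈1 8x≤d y′≤ 4y≤ = begin
      four * y′                    ≤⟨ *-monoʳ-≤ 0≤4 y′≤ ⟩
      four * (θ * y + (x + x))
        ≈⟨ solve 3 (λ θ y x → 4: :* (θ :* y :+ (x :+ x)) := θ :* (4: :* y) :+ (4: :+ 4:) :* x) refl θ y x ⟩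
      θ * (four * y) + (four + four) * x  ≤⟨ +-mono-≤ (*-monoʳ-≤ 0≤θ 4y≤) 8x≤d ⟩
      θ * (B + 1#) + d             ≈⟨ solve 3 (λ θ B d → θ :* (B :+ con (+ 1)) :+ d := θ :* B :+ (θ :+ d)) refl θ B d ⟩
      θ * B + (θ + d)              ≈⟨ +-congˡ θ+d≈1 ⟩
      θ * B + 1#                   ∎
      where
      open ≤-Reasoning
      4: : ∀ {n} → _
      4: {n} = con {n} (+ 1) :+ con (+ 1) :+ (con (+ 1) :+ con (+ 1))
      0≤4 = 0≤+ (0≤+ 0≤1 0≤1) (0≤+ 0≤1 0≤1)

    tail-small : ∀ M d → q + q ^ M + d ≈ 1# →
      (∀ n → M ℕ.≤ n → (four + four) * q ^ suc n ≤ d) →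
      ∀ j → four * Σ⊆-interior (suc (M ℕ.+ j)) ≤ four * Σ⊆-interior (suc M) * (q + q ^ M) ^ j + 1#
    tail-small M d θ+d≈1 8q^≤d zero = begin
      four * Σ⊆-interior (suc (M ℕ.+ 0))   ≡⟨ ≡.cong (λ k → four * Σ⊆-interior (suc k)) (ℕ.+-identityʳ M) ⟩
      four * Σ⊆-interior (suc M)           ≈⟨ trans (+-identityʳ _) (*-identityʳ _) ⟨
      four * Σ⊆-interior (suc M) * 1# + 0# ≤⟨ +-monoʳ-≤ _ 0≤1 ⟩
      four * Σ⊆-interior (suc M) * 1# + 1# ∎
      where open ≤-Reasoning
    tail-small M d θ+d≈1 8q^≤d (suc j) = begin
      four * Σ⊆-interior (suc (M ℕ.+ suc j))
        ≡⟨ ≡.cong (λ k → four * Σ⊆-interior (suc k)) (ℕ.+-suc M j) ⟩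
      four * Σ⊆-interior (suc (suc (M ℕ.+ j)))
        ≤⟨ decay-step (0≤+ 0≤q (0≤q^ M)) θ+d≈1 (8q^≤d (M ℕ.+ j) (ℕ.m≤m+n M j))
             (≤-trans (Σ⊆-interior-step (M ℕ.+ j)) (+-monoˡ-≤ _ (*-monoˡ-≤ (0≤Σ⊆-interior (suc (M ℕ.+ j)))
               (+-monoʳ-≤ q (q^-antitone (ℕ.m≤m+n M j))))))
             (tail-small M d θ+d≈1 8q^≤d j) ⟩
      θ * (four * Σ⊆-interior (suc M) * θ ^ j) + 1#
        ≈⟨ +-congʳ (solve 3 (λ θ a b → θ :* (a :* b) := a :* (θ :* b)) refl _ _ _) ⟩
      four * Σ⊆-interior (suc M) * θ ^ suc j + 1# ∎
      where
      open ≤-Reasoning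
      θ = q + q ^ M

    -- One minus the contraction factor q + q ^ M of the recurrence, the d of `decay-step`.
    gap : ℕ → Carrier
    gap M = p - q ^ M

    gap-complement : ∀ M → q + q ^ M + gap M ≈ 1#
    gap-complement M =
      trans (solve 3 (λ q p x → q :+ x :+ (p :- x) := q :+ p) refl q p (q ^ M)) q+p≈1

    gap-monotone : ∀ {M N} → M ℕ.≤ N → gap M ≤ gap N
    gap-monotone {M} {N} M≤N = 0≤y-x⇒x≤y (≤-resp-≈ refl
      (solve 3 (λ p x y → x :- y := p :- y :- (p :- x)) refl p (q ^ M) (q ^ N))
      (x≤y⇒0≤y-x (q^-antitone M≤N)))

    gap-positive : Eventually λ M → 0# < gap M
    gap-positive = eventually-map
      (λ M 2q^≤p → <-≤-trans (0<q^n M) (0≤y-x⇒x≤y (≤-resp-≈ refl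
        (solve 2 (λ p x → p :- (con (+ 1) :+ con (+ 1)) :* x := p :- x :- x) refl p (q ^ M))
        (x≤y⇒0≤y-x 2q^≤p))))
      (A*x^n→0 0≤q 0<p q+p≈1 two 0<p)

    -- The requirement mentions M on both sides. Monotonicity of the gap breaks the circle: an index
    -- at which 8 q ^ n falls below the fixed gap at L is found first, and enlarging M beyond L only
    -- widens the gap.
    8q^≤gap : ∀ L → 0# < gap L →
      Σ[ M ∈ ℕ ] (0# < gap M × ∀ n → M ℕ.≤ n → (four + four) * q ^ suc n ≤ gap M)
    8q^≤gap L 0<gap = enlarge (A*x^n→0 0≤q 0<p q+p≈1 (four + four) 0<gap)
      where
      enlarge : Eventually (λ n → (four + four) * q ^ n ≤ gap L) → _
      enlarge (N , 8q^≤) = L ℕ.+ N ,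
        <-≤-trans 0<gap (gap-monotone (ℕ.m≤m+n L N)) ,
        λ n L+N≤n → ≤-trans (8q^≤ (suc n) (ℕ.m≤n⇒m≤1+n (ℕ.m+n≤o⇒n≤o L L+N≤n)))
                            (gap-monotone (ℕ.m≤m+n L N))

    eventually-offset : ∀ {a} {P : ℕ → Set a} M → Eventually (λ j → P (M ℕ.+ j)) → Eventually P
    eventually-offset {P = P} M (N , p) = M ℕ.+ N , λ n M+N≤n →
      ≡.subst P (ℕ.m+[n∸m]≡n (ℕ.m+n≤o⇒m≤o M M+N≤n))
        (p (n ∸ M) (≡.subst (ℕ._≤ n ∸ M) (ℕ.m+n∸m≡n M N) (ℕ.∸-monoˡ-≤ M M+N≤n)))

    Σ⊆-interior-small-from : ∀ M → 0# < gap M → (∀ n → M ℕ.≤ n → (four + four) * q ^ suc n ≤ gap M) →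
      Eventually λ n → Σ⊆-interior n + Σ⊆-interior n ≤ 1#
    Σ⊆-interior-small-from M 0<gap 8q^≤ = eventually-offset (suc M) (eventually-map
      -- Once the geometric term is at most 1, four times the sum is at most 2, and halving gives
      -- the claim.
      (λ j 4θ^≤1 → 2x≤2y⇒x≤y (begin
        (Σ⊆-interior (suc M ℕ.+ j) + Σ⊆-interior (suc M ℕ.+ j)) + (Σ⊆-interior (suc M ℕ.+ j) + Σ⊆-interior (suc M ℕ.+ j))
          ≈⟨ solve 1 (λ x → (x :+ x) :+ (x :+ x) :=
               (con (+ 1) :+ con (+ 1) :+ (con (+ 1) :+ con (+ 1))) :* x) refl _ ⟩
        four * Σ⊆-interior (suc (M ℕ.+ j))
          ≤⟨ tail-small M (gap M) (gap-complement M) 8q^≤ j ⟩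
        four * Σ⊆-interior (suc M) * (q + q ^ M) ^ j + 1#
          ≤⟨ +-monoˡ-≤ 1# 4θ^≤1 ⟩
        1# + 1# ∎))
      (A*x^n→0 (0≤+ 0≤q (0≤q^ M)) 0<gap (gap-complement M) (four * Σ⊆-interior (suc M)) 0<1))
      where open ≤-Reasoning

  -- The threshold 1/2 is what the induction bounding σ consumes: 1 + K / 2 ≤ K as soon as K ≥ 2.
  Σ⊆-interior-small : Eventually λ n → Σ⊆-interior n + Σ⊆-interior n ≤ 1#
  Σ⊆-interior-small =
    let L , 0<gap = gap-positive
        M , 0<gap′ , 8q^≤ = 8q^≤gap L (0<gap L ℕ.≤-refl)
    in Σ⊆-interior-small-from M 0<gap′ 8q^≤

  Σ⊆-interior-bounded : Bounded Σ⊆-interior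
  Σ⊆-interior-bounded = eventually-bounded⇒bounded Σ⊆-interior 0≤1
    (eventually-map (λ n 2Σ≤1 → 0≤x⇒∣x∣≤ (0≤Σ⊆-interior n) (≤-trans
      (≤-resp-≈ (+-identityʳ _) refl (+-monoʳ-≤ _ (0≤Σ⊆-interior n))) 2Σ≤1)) Σ⊆-interior-small)

  ∣q^*∣≤ : ∀ {x y A B} k l → ∣ x ∣ ≤ A → ∣ y ∣ ≤ B → ∣ q ^ (k ℕ.* l) * (x * y) ∣ ≤ q ^ (k ℕ.* l) * (A * B)
  ∣q^*∣≤ k l ∣x∣≤A ∣y∣≤B = ∣*∣≤ (0≤x⇒∣x∣≤ (0≤q^ (k ℕ.* l)) ≤-refl) (∣*∣≤ ∣x∣≤A ∣y∣≤B)

  -- The total of q ^ (k l) over all 2 ^ n subsets stays bounded: the interior part is bounded, and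
  -- the empty and the full set account for the extra 1 + 1.
  Bounded-⊛ : ∀ {u v} → Bounded u → Bounded v → Bounded (u ⊛ v)
  Bounded-⊛ {u} {v} (A , u≤A) (B , v≤B) =
    A * B * (proj₁ Σ⊆-interior-bounded + (1# + 1#)) , λ n → ≤-trans
      (∣Σ⊆∣≤ n λ k l _ → ≤-trans (∣q^*∣≤ k l (u≤A k) (v≤B l))
        (≤-trans (*-monoˡ-≤ 0≤AB (q^≤interior k l)) (≤-reflexive (*-comm _ _))))
      (begin
        Σ⊆ (λ k l → A * B * (interior k l + (δ k * 1# + δ l * 1#))) n
          ≈⟨ *-distribˡ-Σ⊆ (A * B) (λ k l → interior k l + (δ k * 1# + δ l * 1#)) n ⟨
        A * B * Σ⊆ (λ k l → interior k l + (δ k * 1# + δ l * 1#)) n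
          ≈⟨ *-congˡ (trans (Σ⊆-distrib-+ interior (λ k l → δ k * 1# + δ l * 1#) n)
               (+-congˡ (trans (Σ⊆-distrib-+ (λ k l → δ k * 1#) (λ k l → δ l * 1#) n)
                 (+-cong (Σ⊆-δ (λ _ _ → 1#) n) (Σ⊆-δʳ (λ _ _ → 1#) n))))) ⟩
        A * B * (Σ⊆-interior n + (1# + 1#))
          ≤⟨ *-monoʳ-≤ 0≤AB (+-monoˡ-≤ _ (≤-trans (x≤∣x∣ _) (proj₂ Σ⊆-interior-bounded n))) ⟩
        A * B * (proj₁ Σ⊆-interior-bounded + (1# + 1#)) ∎)
    where
    open ≤-Reasoning
    0≤AB = 0≤* (bound-nonneg (u≤A 0)) (bound-nonneg (v≤B 0))

  Bounded-⊕ : ∀ {u v} → Bounded u → Bounded v → Bounded (u ⊕ v)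
  Bounded-⊕ (A , u≤A) (B , v≤B) = A + B , λ n → ∣+∣≤ (u≤A n) (v≤B n)

  Bounded-neg : ∀ {u} → Bounded u → Bounded (λ n → - u n)
  Bounded-neg (A , u≤A) = A , λ n → ∣-x∣≤ (u≤A n)

  Bounded-const : ∀ x → Bounded (λ _ → x)
  Bounded-const x = ∣ x ∣ , λ _ → ≤-refl

  𝟏 : Sequence
  𝟏 _ = 1#

  module _ {σ : Sequence} (𝟏≋δ⊕σ⊛𝟏 : 𝟏 ≋ δ ⊕ σ ⊛ 𝟏) where

    σ₀≈0 : σ 0 ≈ 0#
    σ₀≈0 = begin
      σ 0                       ≈⟨ solve 1 (λ x → x := con (+ 1) :+ con (+ 1) :* (x :* con (+ 1)) :- con (+ 1)) refl _ ⟩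
      1# + 1# * (σ 0 * 1#) - 1# ≈⟨ +-congʳ (𝟏≋δ⊕σ⊛𝟏 0) ⟨
      1# - 1#                   ≈⟨ -‿inverseʳ 1# ⟩
      0#                        ∎
      where open ≈-Reasoning

    private
      split : ∀ n k l → k ℕ.+ l ≡ suc n →
        q ^ (k ℕ.* l) * (σ k * 1#) ≈ δ l * σ k + interior k l * σ k
      split n zero (suc l) eq = begin
        1# * (σ 0 * 1#)      ≈⟨ solve 1 (λ x → con (+ 1) :* (x :* con (+ 1)) := x) refl _ ⟩
        σ 0                  ≈⟨ σ₀≈0 ⟩
        0#                   ≈⟨ solve 1 (λ x → con (+ 0) :* x :+ con (+ 0) :* x := con (+ 0)) refl _ ⟨
        0# * σ 0 + 0# * σ 0  ∎
        where open ≈-Reasoning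
      split n (suc k) zero eq = trans (*-congʳ (^-congʳ q (ℕ.*-zeroʳ k)))
        (solve 1 (λ x → con (+ 1) :* (x :* con (+ 1)) := con (+ 1) :* x :+ con (+ 0) :* x) refl _)
      split n (suc k) (suc l) eq =
        solve 2 (λ x y → y :* (x :* con (+ 1)) := con (+ 0) :* x :+ y :* x) refl _ _

    -- In σ ⊛ 𝟏 the full set contributes `σ (suc n)` and the empty set `σ 0`, which is 0; the
    -- remaining terms involve smaller indices only.
    σ-recurrence : ∀ n → σ (suc n) ≈ 1# - Σ⊆ (λ k l → interior k l * σ k) (suc n)
    σ-recurrence n = begin
      σ (suc n)   ≈⟨ solve 2 (λ x y → x := x :+ y :- y) refl _ S ⟩
      σ (suc n) + S - S
        ≈⟨ +-congʳ (trans (Σ⊆-cong (suc n) (split n)) (trans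
             (Σ⊆-distrib-+ (λ k l → δ l * σ k) (λ k l → interior k l * σ k) (suc n))
             (+-congʳ (Σ⊆-δʳ (λ k l → σ k) (suc n))))) ⟨
      (σ ⊛ 𝟏) (suc n) - S
        ≈⟨ +-congʳ (trans (𝟏≋δ⊕σ⊛𝟏 (suc n)) (+-identityˡ _)) ⟨
      1# - S      ∎
      where
      open ≈-Reasoning
      S = Σ⊆ (λ k l → interior k l * σ k) (suc n)

    private
      interior-term : ∀ {K} n → 0# ≤ K → (∀ k → k ℕ.< n → ∣ σ k ∣ ≤ K) →
        ∀ k l → k ℕ.+ l ≡ n → ∣ interior k l * σ k ∣ ≤ K * interior k l
      interior-term n 0≤K σ≤K zero    l    _ = ∣∣≤-resp-≈ (sym (zeroˡ _)) (≤-trans ∣0∣≤0 (≤-reflexive (sym (zeroʳ _))))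
      interior-term n 0≤K σ≤K (suc k) zero _ = ∣∣≤-resp-≈ (sym (zeroˡ _)) (≤-trans ∣0∣≤0 (≤-reflexive (sym (zeroʳ _))))
      interior-term .(suc k ℕ.+ suc l) 0≤K σ≤K (suc k) (suc l) ≡.refl = ≤-trans
        (∣*∣≤ (0≤x⇒∣x∣≤ (0≤interior (suc k) (suc l)) ≤-refl)
              (σ≤K (suc k) (ℕ.m<m+n (suc k) (ℕ.s≤s ℕ.z≤n))))
        (≤-reflexive (*-comm _ _))

      -- By the recurrence, ∣ σ n ∣ is at most 1 plus K times the interior sum, hence at most 1 + K
      -- / 2 ≤ K. The interior weight vanishes at l = 0, so only bounds on earlier entries are used.
      σ-step : ∀ {K} n → 1# + 1# ≤ K → Σ⊆-interior n + Σ⊆-interior n ≤ 1# →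
        (∀ k → k ℕ.< n → ∣ σ k ∣ ≤ K) → ∣ σ n ∣ ≤ K
      σ-step {K} zero    2≤K 2Σ≤1 σ≤K = ∣∣≤-resp-≈ (sym σ₀≈0) (≤-trans ∣0∣≤0 (≤-trans (0≤+ 0≤1 0≤1) 2≤K))
      σ-step {K} (suc n) 2≤K 2Σ≤1 σ≤K = ∣∣≤-resp-≈ (sym (σ-recurrence n)) (≤-trans
        (∣+∣≤ (0≤x⇒∣x∣≤ 0≤1 ≤-refl) (∣-x∣≤ (∣Σ⊆∣≤ (suc n) (interior-term (suc n) 0≤K σ≤K))))
        (2x≤2y⇒x≤y (begin
          1# + Σ⊆ (λ k l → K * interior k l) (suc n) + (1# + Σ⊆ (λ k l → K * interior k l) (suc n))
            ≈⟨ (let eq = sym (*-distribˡ-Σ⊆ K interior (suc n)) in +-cong (+-congˡ eq) (+-congˡ eq)) ⟩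
          1# + K * Σ⊆-interior (suc n) + (1# + K * Σ⊆-interior (suc n))
            ≈⟨ solve 2 (λ K x → con (+ 1) :+ K :* x :+ (con (+ 1) :+ K :* x)
                 := con (+ 1) :+ con (+ 1) :+ K :* (x :+ x)) refl K _ ⟩
          1# + 1# + K * (Σ⊆-interior (suc n) + Σ⊆-interior (suc n))
            ≤⟨ +-mono-≤ 2≤K (*-monoʳ-≤ 0≤K 2Σ≤1) ⟩
          K + K * 1#
            ≈⟨ +-congˡ (*-identityʳ K) ⟩
          K + K ∎)))
        where
        open ≤-Reasoning
        0≤K = ≤-trans (0≤+ 0≤1 0≤1) 2≤K

    Bounded-σ : Bounded σ
    Bounded-σ = from Σ⊆-interior-small
      where
      from : Eventually (λ n → Σ⊆-interior n + Σ⊆-interior n ≤ 1#) → Bounded σ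
      from (N , 2Σ≤1) = K , λ n → below (suc n) n ℕ.≤-refl
        where
        prefix = prefix-bounded σ N
        L = proj₁ prefix
        -- L bounds the entries below N; the summand 1 + 1 secures 2 ≤ K for `σ-step` from N on.
        K = L + (1# + 1#)
        L≤K = ≤-resp-≈ (+-identityʳ L) refl (+-monoʳ-≤ L (0≤+ 0≤1 0≤1))
        2≤K = ≤-resp-≈ (+-identityˡ _) refl (+-monoˡ-≤ (1# + 1#) (proj₁ (proj₂ prefix)))
        below : ∀ n k → k ℕ.< n → ∣ σ k ∣ ≤ K
        below (suc n) k k<1+n with ℕ.m<1+n⇒m<n∨m≡n k<1+n | ℕ.<-≤-connex k N
        ... | inj₁ k<n    | _        = below n k k<n
        ... | inj₂ ≡.refl | inj₁ k<N = ≤-trans (proj₂ (proj₂ prefix) k k<N) L≤K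
        ... | inj₂ ≡.refl | inj₂ N≤k = σ-step k 2≤K (2Σ≤1 k N≤k) (below n)

  VanishesBelow : ℕ → Sequence → Set ℓ₁
  VanishesBelow R u = ∀ k → k ℕ.< R → u k ≈ 0#

  -- Sequences vanishing below R form an ideal. Hence τ ⊛ (τ ⊛ x) is a product of two such
  -- sequences, as the tail estimate demands.
  VanishesBelow-⊛ : ∀ {R u} v → VanishesBelow R u → VanishesBelow R (u ⊛ v)
  VanishesBelow-⊛ {R} {u} v u≈0 n n<R = trans
    (Σ⊆-cong n λ { k l ≡.refl → trans
      (*-congˡ (trans (*-congʳ (u≈0 k (ℕ.≤-<-trans (ℕ.m≤m+n k l) n<R))) (zeroˡ _))) (zeroʳ _) })
    (Σ⊆-0 n)

  private
    -- The difference of the two sides is (k - R) (l - R).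
    R[k+l]≤RR+kl : ∀ R k l → R ℕ.≤ k → R ℕ.≤ l → R ℕ.* (k ℕ.+ l) ℕ.≤ R ℕ.* R ℕ.+ k ℕ.* l
    R[k+l]≤RR+kl R k l R≤k R≤l = ≡.subst₂
      (λ k l → R ℕ.* (k ℕ.+ l) ℕ.≤ R ℕ.* R ℕ.+ k ℕ.* l) (ℕ.m+[n∸m]≡n R≤k) (ℕ.m+[n∸m]≡n R≤l)
      (ℕ.≤-trans (ℕ.m≤m+n _ ((k ∸ R) ℕ.* (l ∸ R))) (ℕ.≤-reflexive (expand R (k ∸ R) (l ∸ R))))
      where
      expand : ∀ R i j → R ℕ.* (R ℕ.+ i ℕ.+ (R ℕ.+ j)) ℕ.+ i ℕ.* j ≡ R ℕ.* R ℕ.+ (R ℕ.+ i) ℕ.* (R ℕ.+ j)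
      expand = ℕ-Solver.solve-∀

  -- Only splits with k, l ≥ R survive, and for these k l ≥ R n - R²; the 2 ^ n counts all subsets.
  -- The power q ^ (R R) stands on the left so that no exponent is negative.
  ⊛-tail-estimate : ∀ {u v} R A B → (∀ n → ∣ u n ∣ ≤ A) → (∀ n → ∣ v n ∣ ≤ B) →
    VanishesBelow R u → VanishesBelow R v →
    ∀ n → ∣ q ^ (R ℕ.* R) * (u ⊛ v) n ∣ ≤ (1# + 1#) ^ n * (q ^ (R ℕ.* n) * (A * B))
  ⊛-tail-estimate {u} {v} R A B u≤A v≤B u≈0 v≈0 n = ∣∣≤-resp-≈ (sym (*-distribˡ-Σ⊆ _ _ n))
    (≤-trans (∣Σ⊆∣≤ n term) (≤-reflexive (Σ⊆-const _ n)))
    where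
    open ≤-Reasoning
    0≤AB = 0≤* (bound-nonneg (u≤A 0)) (bound-nonneg (v≤B 0))
    0≤bound = 0≤* (0≤q^ (R ℕ.* n)) 0≤AB
    zero-term : ∀ {x y z} → x * y ≈ 0# → ∣ q ^ (R ℕ.* R) * (z * (x * y)) ∣ ≤ q ^ (R ℕ.* n) * (A * B)
    zero-term xy≈0 = ∣∣≤-resp-≈
      (sym (trans (*-congˡ (trans (*-congˡ xy≈0) (zeroʳ _))) (zeroʳ _))) (≤-trans ∣0∣≤0 0≤bound)
    term : ∀ k l → k ℕ.+ l ≡ n → ∣ q ^ (R ℕ.* R) * (q ^ (k ℕ.* l) * (u k * v l)) ∣ ≤ q ^ (R ℕ.* n) * (A * B)
    term k l k+l≡n with ℕ.<-≤-connex k R | ℕ.<-≤-connex l R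
    ... | inj₁ k<R | _        = zero-term (trans (*-congʳ (u≈0 k k<R)) (zeroˡ _))
    ... | inj₂ _   | inj₁ l<R = zero-term (trans (*-congˡ (v≈0 l l<R)) (zeroʳ _))
    ... | inj₂ R≤k | inj₂ R≤l = ≤-trans
      (∣*∣≤ (0≤x⇒∣x∣≤ (0≤q^ (R ℕ.* R)) ≤-refl) (∣q^*∣≤ k l (u≤A k) (v≤B l)))
      (begin
        q ^ (R ℕ.* R) * (q ^ (k ℕ.* l) * (A * B)) ≈⟨ *-assoc _ _ _ ⟨
        q ^ (R ℕ.* R) * q ^ (k ℕ.* l) * (A * B)   ≈⟨ *-congʳ (^-homo-* q (R ℕ.* R) (k ℕ.* l)) ⟨
        q ^ (R ℕ.* R ℕ.+ k ℕ.* l) * (A * B)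
          ≤⟨ *-monoˡ-≤ 0≤AB (q^-antitone (≡.subst (λ n → R ℕ.* n ℕ.≤ R ℕ.* R ℕ.+ k ℕ.* l) k+l≡n (R[k+l]≤RR+kl R k l R≤k R≤l))) ⟩
        q ^ (R ℕ.* n) * (A * B) ∎)

-- If t = 1 / (1 - ρ - τ), then modulo τ² both ρ + τ and all its powers are
-- linear in t, with coefficients polynomial in ρ.
module LinearisedPowers {c ℓ} (R : CommutativeRing c ℓ) where
  open CommutativeRing R
  open IntegerSolver R
  open SemiringExp semiring using (_^_)
  open SemiringMult semiring using (×-assoc-*; ×-congʳ) renaming (_×_ to infixr 8 _·_)
  open SetoidReasoning setoid

  private
    ·≈* : ∀ n x → n · x ≈ (n · 1#) * x
    ·≈* n x = trans (×-congʳ n (sym (*-identityˡ x))) (sym (×-assoc-* n 1# x))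

  -- This is (m + 1) x ^ m (1 - x)², expanded because the powers of σ are the normalised counts in
  -- the coefficients of the expansion.
  slope : ℕ → Carrier → Carrier
  slope m x = suc m · (x ^ m - 2 · x ^ suc m + x ^ suc (suc m))

  -- The part free of t. For finitely supported ρ it is finitely supported, so it disappears for
  -- large n.
  constantTerm : ℕ → Carrier → Carrier
  constantTerm m ρ = ρ ^ suc m - suc m · ρ ^ m * (1# - ρ)

  module _ (ρ τ : Carrier) where

    -- The cofactor of τ² in the expansion of (ρ + τ) ^ suc m about ρ. Multiplying that expansion by
    -- ρ + τ turns the linear term into a new τ² term, which is the first summand.
    quadraticPart : ℕ → Carrier
    quadraticPart zero    = 0#
    quadraticPart (suc m) = suc m · ρ ^ m + (ρ + τ) * quadraticPart m

    remainder : ℕ → Carrier → Carrier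
    remainder m t = quadraticPart m - suc m · ρ ^ m * t

    [ρ+τ]^1+m : ∀ m → (ρ + τ) ^ suc m ≈ ρ ^ suc m + suc m · ρ ^ m * τ + τ * τ * quadraticPart m
    [ρ+τ]^1+m zero = solve 2 (λ ρ τ → (ρ :+ τ) :* con (+ 1) :=
      ρ :* con (+ 1) :+ (con (+ 1) :+ con (+ 0)) :* τ :+ τ :* τ :* con (+ 0)) refl ρ τ
    [ρ+τ]^1+m (suc m) = begin
      (ρ + τ) * (ρ + τ) ^ suc m
        ≈⟨ *-congˡ ([ρ+τ]^1+m m) ⟩
      (ρ + τ) * (ρ ^ suc m + suc m · ρ ^ m * τ + τ * τ * Q)
        ≈⟨ *-congˡ (+-congʳ (+-congˡ (*-congʳ (·≈* (suc m) _)))) ⟩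
      (ρ + τ) * (ρ ^ suc m + N * ρ ^ m * τ + τ * τ * Q)
        ≈⟨ solve 5 (λ ρ τ y N Q → (ρ :+ τ) :* (ρ :* y :+ N :* y :* τ :+ τ :* τ :* Q) :=
             ρ :* (ρ :* y) :+ (ρ :* y :+ N :* (ρ :* y)) :* τ :+ τ :* τ :* (N :* y :+ (ρ :+ τ) :* Q))
             refl ρ τ (ρ ^ m) N Q ⟩
      ρ ^ suc (suc m) + (ρ ^ suc m + N * ρ ^ suc m) * τ + τ * τ * (N * ρ ^ m + (ρ + τ) * Q)
        ≈⟨ +-cong (+-congˡ (*-congʳ (+-congˡ (·≈* (suc m) _)))) (*-congˡ (+-congʳ (·≈* (suc m) _))) ⟨
      ρ ^ suc (suc m) + suc (suc m) · ρ ^ suc m * τ + τ * τ * quadraticPart (suc m) ∎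
      where
      N = suc m · 1#
      Q = quadraticPart m

    -- The linear term in τ is rewritten by adding a multiple of the vanishing expression t - (1 +
    -- (ρ + τ) t). The multiplier 1 - ρ + τ is conjugate to 1 - ρ - τ, so their product is (1 - ρ)²
    -- - τ², and τ becomes (1 - ρ)² t - (1 - ρ) - τ² t: linear in t up to a multiple of τ².
    powers-linear : ∀ {t} → t ≈ 1# + (ρ + τ) * t → ∀ m →
      (ρ + τ) ^ suc m ≈ slope m ρ * t + constantTerm m ρ + τ * (τ * remainder m t)
    powers-linear {t} t≈ m = begin
      (ρ + τ) ^ suc m
        ≈⟨ [ρ+τ]^1+m m ⟩
      ρ ^ suc m + suc m · ρ ^ m * τ + τ * τ * Q
        ≈⟨ +-congʳ (+-congˡ (*-congˡ (trans (sym (+-identityʳ τ)) (+-congˡ (sym vanishing))))) ⟩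
      ρ ^ suc m + suc m · ρ ^ m * (τ + (1# - ρ + τ) * (t - (1# + (ρ + τ) * t))) + τ * τ * Q
        ≈⟨ +-congʳ (+-congˡ (*-congʳ (·≈* (suc m) _))) ⟩
      ρ ^ suc m + N * ρ ^ m * (τ + (1# - ρ + τ) * (t - (1# + (ρ + τ) * t))) + τ * τ * Q
        ≈⟨ solve 6 (λ ρ τ t y N Q →
             ρ :* y :+ N :* y :* (τ :+ (con (+ 1) :- ρ :+ τ) :* (t :- (con (+ 1) :+ (ρ :+ τ) :* t))) :+ τ :* τ :* Q :=
             N :* (y :- (ρ :* y :+ (ρ :* y :+ con (+ 0))) :+ ρ :* (ρ :* y)) :* t
               :+ (ρ :* y :- N :* y :* (con (+ 1) :- ρ)) :+ τ :* (τ :* (Q :- N :* y :* t)))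
             refl ρ τ t (ρ ^ m) N Q ⟩
      N * (ρ ^ m - 2 · ρ ^ suc m + ρ ^ suc (suc m)) * t + (ρ ^ suc m - N * ρ ^ m * (1# - ρ))
        + τ * (τ * (Q - N * ρ ^ m * t))
        ≈⟨ +-cong (+-cong (*-congʳ (·≈* (suc m) _)) (+-congˡ (-‿cong (*-congʳ (·≈* (suc m) _)))))
             (*-congˡ (*-congˡ (+-congˡ (-‿cong (*-congʳ (·≈* (suc m) _)))))) ⟨
      slope m ρ * t + constantTerm m ρ + τ * (τ * remainder m t) ∎
      where
      N = suc m · 1#
      Q = quadraticPart m
      vanishing : (1# - ρ + τ) * (t - (1# + (ρ + τ) * t)) ≈ 0#
      vanishing = trans (*-congˡ (trans (+-congˡ (-‿cong (sym t≈))) (-‿inverseʳ t))) (zeroʳ _)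

  -- Used for two predicates: finite support, for the slope and the constant term, and boundedness,
  -- for the remainder.
  record IsSubring {p} (P : Carrier → Set p) : Set (c ⊔ p) where
    field
      0∈ : P 0#
      1∈ : P 1#
      +∈ : ∀ {x y} → P x → P y → P (x + y)
      -∈ : ∀ {x} → P x → P (- x)
      *∈ : ∀ {x y} → P x → P y → P (x * y)

    ·∈ : ∀ n {x} → P x → P (n · x)
    ·∈ zero    Px = 0∈
    ·∈ (suc n) Px = +∈ Px (·∈ n Px)

    ^∈ : ∀ {x} → P x → ∀ n → P (x ^ n)
    ^∈ Px zero    = 1∈
    ^∈ Px (suc n) = *∈ Px (^∈ Px n)

    slope∈ : ∀ m {x} → P x → P (slope m x)
    slope∈ m Px = ·∈ (suc m) (+∈ (+∈ (^∈ Px m) (-∈ (·∈ 2 (^∈ Px (suc m))))) (^∈ Px (suc (suc m))))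

    constantTerm∈ : ∀ m {ρ} → P ρ → P (constantTerm m ρ)
    constantTerm∈ m Pρ = +∈ (^∈ Pρ (suc m)) (-∈ (*∈ (·∈ (suc m) (^∈ Pρ m)) (+∈ 1∈ (-∈ Pρ))))

    remainder∈ : ∀ m {ρ τ t} → P ρ → P τ → P t → P (remainder ρ τ m t)
    remainder∈ m {ρ} {τ} Pρ Pτ Pt = +∈ (quadraticPart∈ m) (-∈ (*∈ (·∈ (suc m) (^∈ Pρ m)) Pt))
      where
      quadraticPart∈ : ∀ m → P (quadraticPart ρ τ m)
      quadraticPart∈ zero    = 0∈
      quadraticPart∈ (suc m) = +∈ (·∈ (suc m) (^∈ Pρ m)) (*∈ (+∈ Pρ Pτ) (quadraticPart∈ m))

-- Asymptotic expansion of the powers of σ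

module Expansion {c ℓ₁ ℓ₂} (ℝ : CompleteOrderedField c ℓ₁ ℓ₂)
  (p : CompleteOrderedField.Carrier ℝ)
  (0<p : CompleteOrderedField._<_ ℝ (CompleteOrderedField.0# ℝ) p)
  (p<1 : CompleteOrderedField._<_ ℝ p (CompleteOrderedField.1# ℝ)) where

  open CompleteOrderedField ℝ
  open OrderedField ℝ
  open Asymptotics ℝ
  open Weights ℝ p 0<p p<1 using (q; 0<q; 0<q^; scale)
  open SemiringExp semiring using (^-homo-*; ^-congʳ; ^-assocʳ)
  open SemiringMult semiring using (×-comm-*; ×-congʳ; ×-assoc-*)
  open CommutativeSemiringExp (CommutativeRing.commutativeSemiring commutativeRing) using (^-distrib-*)
  open CommutativeMonoidSum (CommutativeRing.+-commutativeMonoid commutativeRing) using (sum-cong-≋)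
  private module ≈-Reasoning = SetoidReasoning setoid

  q+p≈1 : q + p ≈ 1#
  q+p≈1 = solve 1 (λ p → con (+ 1) :- p :+ p := con (+ 1)) refl p

  open BinomialSum ℝ
  open TwistedProduct ℝ q
  open BoundedSequences ℝ
  open TwistedEstimates ℝ 0<q 0<p q+p≈1

  module Seq where
    open CommutativeRing sequenceRing public using (_-_)
    open LinearisedPowers sequenceRing public
    open SemiringExp (CommutativeRing.semiring sequenceRing) public using (_^_; ^-congˡ)
    open SemiringMult (CommutativeRing.semiring sequenceRing) public using () renaming (_×_ to infixr 8 _·_)

  isSubring-Bounded : Seq.IsSubring Bounded
  isSubring-Bounded = record
    { 0∈ = Bounded-const 0#
    ; 1∈ = 1# , λ { zero → 0≤x⇒∣x∣≤ 0≤1 ≤-refl ; (suc n) → ≤-trans ∣0∣≤0 0≤1 }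
    ; +∈ = Bounded-⊕
    ; -∈ = Bounded-neg
    ; *∈ = Bounded-⊛
    }

  FiniteSupport : Sequence → Set ℓ₁
  FiniteSupport u = Eventually λ n → u n ≈ 0#

  isSubring-FiniteSupport : Seq.IsSubring FiniteSupport
  isSubring-FiniteSupport = record
    { 0∈ = 0 , λ _ _ → refl
    ; 1∈ = 1 , λ { (suc n) _ → refl }
    ; +∈ = eventually-map₂ λ n u≈0 v≈0 → trans (+-cong u≈0 v≈0) (+-identityˡ 0#)
    ; -∈ = eventually-map λ n u≈0 → trans (-‿cong u≈0) (solve 0 (:- con (+ 0) := con (+ 0)) refl)
    ; *∈ = λ {u} {v} (M , u≈0) (N , v≈0) → M ℕ.+ N , λ n M+N≤n → trans
        (Σ⊆-cong n λ k l k+l≡n → trans (*-congˡ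
          (product≈0 u≈0 v≈0 k l (≡.subst (M ℕ.+ N ℕ.≤_) (≡.sym k+l≡n) M+N≤n))) (zeroʳ _))
        (Σ⊆-0 n)
    }
    where
    product≈0 : ∀ {u v : Sequence} {M N} → (∀ n → M ℕ.≤ n → u n ≈ 0#) → (∀ n → N ℕ.≤ n → v n ≈ 0#) →
      ∀ k l → M ℕ.+ N ℕ.≤ k ℕ.+ l → u k * v l ≈ 0#
    product≈0 {M = M} {N} u≈0 v≈0 k l M+N≤ with ℕ.≤-<-connex M k
    ... | inj₁ M≤k = trans (*-congʳ (u≈0 k M≤k)) (zeroˡ _)
    ... | inj₂ k<M = trans (*-congˡ (v≈0 l (ℕ.+-cancelˡ-≤ k N l
            (ℕ.≤-trans (ℕ.+-monoˡ-≤ N (ℕ.<⇒≤ k<M)) M+N≤)))) (zeroʳ _)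

  AgreeBelow : ℕ → Sequence → Sequence → Set ℓ₁
  AgreeBelow R u v = ∀ k → k ℕ.< R → u k ≈ v k

  -- Entry n of a twisted product involves only entries up to n. Truncating σ at R thus keeps the
  -- slope, and with it the expansion coefficients, unchanged below R.
  agree-^ : ∀ {R u v} → AgreeBelow R u v → ∀ m → AgreeBelow R (u Seq.^ m) (v Seq.^ m)
  agree-^ u~v zero    n n<R = refl
  agree-^ u~v (suc m) n n<R = Σ⊆-cong n λ { k l ≡.refl → *-congˡ (*-cong
    (u~v k (ℕ.≤-<-trans (ℕ.m≤m+n k l) n<R)) (agree-^ u~v m l (ℕ.≤-<-trans (ℕ.m≤n+m l k) n<R))) }

  ·-pointwise : ∀ m u n → (m Seq.· u) n ≈ m · u n
  ·-pointwise zero    u n = refl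
  ·-pointwise (suc m) u n = +-congˡ (·-pointwise m u n)

  slope-pointwise : ∀ m u n → Seq.slope m u n ≈
    suc m · ((u Seq.^ m) n - 2 · (u Seq.^ suc m) n + (u Seq.^ suc (suc m)) n)
  slope-pointwise m u n = trans (·-pointwise (suc m) _ n)
    (×-congʳ (suc m) (+-congʳ (+-congˡ (-‿cong (·-pointwise 2 (u Seq.^ suc m) n)))))

  truncate : ℕ → Sequence → Sequence
  truncate R u n with n ℕ.<? R
  ... | yes _ = u n
  ... | no  _ = 0#

  truncate-agrees : ∀ R u → AgreeBelow R (truncate R u) u
  truncate-agrees R u n n<R with n ℕ.<? R
  ... | yes _   = refl
  ... | no  n≮R = ⊥-elim (n≮R n<R)

  truncate-finiteSupport : ∀ R u → FiniteSupport (truncate R u)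
  truncate-finiteSupport R u = R , vanishes
    where
    vanishes : ∀ n → R ℕ.≤ n → truncate R u n ≈ 0#
    vanishes n R≤n with n ℕ.<? R
    ... | yes n<R = ⊥-elim (ℕ.<⇒≱ n<R R≤n)
    ... | no  _   = refl

  FiniteSupport⇒Bounded : ∀ {u} → FiniteSupport u → Bounded u
  FiniteSupport⇒Bounded {u} u≈0 = eventually-bounded⇒bounded u ≤-refl
    (eventually-map (λ n un≈0 → ∣∣≤-resp-≈ (sym un≈0) ∣0∣≤0) u≈0)

  -- The scale

  private
    k[1+k]/2 : ℕ → ℕ
    k[1+k]/2 k = (k ℕ.* suc k) / 2

    k[1+k]/2≡triangular : ∀ k → k[1+k]/2 k ≡ triangular (suc k)
    k[1+k]/2≡triangular k = ≡.trans (≡.cong (_/ 2) (double k)) (m*n/n≡m (triangular (suc k)) 2)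
      where
      double : ∀ k → k ℕ.* suc k ≡ triangular (suc k) ℕ.* 2
      double zero    = ≡.refl
      double (suc k) = ≡.trans (step k) (≡.trans (≡.cong (suc k ℕ.* 2 ℕ.+_) (double k))
        (≡.sym (ℕ.*-distribʳ-+ 2 (suc k) (triangular (suc k)))))
        where
        step : ∀ k → suc k ℕ.* suc (suc k) ≡ suc k ℕ.* 2 ℕ.+ k ℕ.* suc k
        step = ℕ-Solver.solve-∀

    quotient : ℕ → ℕ → Carrier
    quotient k n = q ^ (n ℕ.* k) ÷ q ^ k[1+k]/2 k [ pos⇒#0 (0<q^ (k[1+k]/2 k)) ]

    -- The exponent n k - k (k + 1) / 2 can be negative, so the quotient is handled through this
    -- equation and cancellation of the positive power of q.
    quotient-* : ∀ k n → q ^ triangular (suc k) * quotient k n ≈ q ^ (n ℕ.* k)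
    quotient-* k n = trans (*-comm _ _)
      (trans (*-congˡ (^-congʳ q (≡.sym (k[1+k]/2≡triangular k)))) (÷-* (q ^ (n ℕ.* k)) _))

    *-cancelˡ-≈ : ∀ {x y z} → 0# < z → z * x ≈ z * y → x ≈ y
    *-cancelˡ-≈ 0<z zx≈zy = ≤-antisym (*-cancelˡ-≤ 0<z (≤-reflexive zx≈zy))
                                      (*-cancelˡ-≤ 0<z (≤-reflexive (sym zx≈zy)))

    quotient-unique : ∀ k n {x} → q ^ triangular (suc k) * x ≈ q ^ (n ℕ.* k) → quotient k n ≈ x
    quotient-unique k n eq = *-cancelˡ-≈ (0<q^n (triangular (suc k))) (trans (quotient-* k n) (sym eq))

    q^≤quotient : ∀ k n → q ^ (n ℕ.* k) ≤ quotient k n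
    q^≤quotient k n = *-cancelˡ-≤ (0<q^n (triangular (suc k))) (begin
      q ^ triangular (suc k) * q ^ (n ℕ.* k)  ≤⟨ *-monoˡ-≤ (0≤q^ (n ℕ.* k)) (q^≤1 (triangular (suc k))) ⟩
      1# * q ^ (n ℕ.* k)                      ≈⟨ *-identityˡ _ ⟩
      q ^ (n ℕ.* k)                           ≈⟨ quotient-* k n ⟨
      q ^ triangular (suc k) * quotient k n   ∎)
      where open ≤-Reasoning

    0≤quotient : ∀ k n → 0# ≤ quotient k n
    0≤quotient k n = ≤-trans (0≤q^ (n ℕ.* k)) (q^≤quotient k n)

    quotient-suc : ∀ k n → quotient (suc k) n * q ^ suc k ≈ q ^ n * quotient k n
    quotient-suc k n = *-cancelˡ-≈ (0<q^n (triangular (suc k))) (begin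
      q ^ triangular (suc k) * (quotient (suc k) n * q ^ suc k)
        ≈⟨ solve 3 (λ a b c → a :* (b :* c) := c :* a :* b) refl _ _ _ ⟩
      q ^ suc k * q ^ triangular (suc k) * quotient (suc k) n
        ≈⟨ *-congʳ (^-homo-* q (suc k) (triangular (suc k))) ⟨
      q ^ triangular (suc (suc k)) * quotient (suc k) n
        ≈⟨ quotient-* (suc k) n ⟩
      q ^ (n ℕ.* suc k)
        ≈⟨ trans (^-congʳ q (ℕ.*-suc n k)) (^-homo-* q n (n ℕ.* k)) ⟩
      q ^ n * q ^ (n ℕ.* k)
        ≈⟨ *-congˡ (quotient-* k n) ⟨
      q ^ n * (q ^ triangular (suc k) * quotient k n)
        ≈⟨ solve 3 (λ a b c → a :* (b :* c) := b :* (a :* c)) refl _ _ _ ⟩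
      q ^ triangular (suc k) * (q ^ n * quotient k n) ∎)
      where open ≈-Reasoning

    -- Crude, but a factor n per step is harmless against the factor q ^ n.
    nC[1+k]≤n*nCk : ∀ n k → n C suc k ℕ.≤ n ℕ.* (n C k)
    nC[1+k]≤n*nCk zero    k = ℕ.z≤n
    nC[1+k]≤n*nCk (suc n) k = begin
      suc n C suc k                    ≡⟨ nCk+nC[k+1]≡[n+1]C[k+1] n k ⟨
      n C k ℕ.+ n C suc k              ≤⟨ ℕ.+-monoʳ-≤ (n C k) (nC[1+k]≤n*nCk n k) ⟩
      suc n ℕ.* (n C k)                ≤⟨ ℕ.*-monoʳ-≤ (suc n) (nCk≤[1+n]Ck k) ⟩
      suc n ℕ.* (suc n C k)            ∎
      where
      open ℕ.≤-Reasoning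
      nCk≤[1+n]Ck : ∀ k → n C k ℕ.≤ suc n C k
      nCk≤[1+n]Ck zero    = ℕ.≤-refl
      nCk≤[1+n]Ck (suc k) = ℕ.≤-trans (ℕ.m≤n+m (n C suc k) (n C k))
        (ℕ.≤-reflexive (nCk+nC[k+1]≡[n+1]C[k+1] n k))

    1≤nCk : ∀ {n k} → k ℕ.≤ n → 1 ℕ.≤ n C k
    1≤nCk ℕ.z≤n = ℕ.≤-refl
    1≤nCk (ℕ.s≤s {k} {n} k≤n) = ℕ.≤-trans (ℕ.≤-trans (1≤nCk k≤n) (ℕ.m≤m+n (n C k) (n C suc k)))
      (ℕ.≤-reflexive (nCk+nC[k+1]≡[n+1]C[k+1] n k))

  0≤scale : ∀ k n → 0# ≤ scale k n
  0≤scale k n = 0≤· (n C k) (0≤quotient k n)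

  -- The lower bound on the scale against which the tail is measured; k ≤ n makes the binomial
  -- coefficient at least 1.
  q^≤scale : ∀ {k n} → k ℕ.≤ n → q ^ (n ℕ.* k) ≤ scale k n
  q^≤scale {k} {n} k≤n = ≤-trans (q^≤quotient k n) (≤-resp-≈ (+-identityʳ _) refl
    (·-monoˡ-≤ (0≤quotient k n) (1≤nCk k≤n)))

  -- Consecutive scale functions have ratio at most n q ^ (n - k - 1); the factor q ^ suc k is kept
  -- on the left to avoid subtracting exponents.
  scale-suc : ∀ k n → scale (suc k) n * q ^ suc k ≤ (n · q ^ n) * scale k n
  scale-suc k n = begin
    scale (suc k) n * q ^ suc k                     ≈⟨ ×-assoc-* (n C suc k) _ _ ⟩
    (n C suc k) · (quotient (suc k) n * q ^ suc k)  ≈⟨ ×-congʳ (n C suc k) (quotient-suc k n) ⟩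
    (n C suc k) · (q ^ n * quotient k n)
      ≤⟨ ·-monoˡ-≤ (0≤* (0≤q^ n) (0≤quotient k n)) (nC[1+k]≤n*nCk n k) ⟩
    (n ℕ.* (n C k)) · (q ^ n * quotient k n)        ≈⟨ ·-*-distrib n (n C k) (q ^ n) (quotient k n) ⟨
    (n · q ^ n) * scale k n                         ∎
    where open ≤-Reasoning

  scale-decay : ∀ k {ε} → 0# < ε → Eventually λ n → scale (suc k) n ≤ ε * scale k n
  scale-decay k {ε} 0<ε = eventually-map
    (λ n nq^n≤ → *-cancelˡ-≤ (0<q^n (suc k)) (begin
      q ^ suc k * scale (suc k) n    ≈⟨ *-comm _ _ ⟩
      scale (suc k) n * q ^ suc k    ≤⟨ scale-suc k n ⟩
      (n · q ^ n) * scale k n        ≤⟨ *-monoˡ-≤ (0≤scale k n) nq^n≤ ⟩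
      q ^ suc k * ε * scale k n      ≈⟨ *-assoc _ _ _ ⟩
      q ^ suc k * (ε * scale k n)    ∎))
    (n·x^n→0 0≤q 0<p q+p≈1 (*-pos (0<q^n (suc k)) 0<ε))
    where open ≤-Reasoning

  scale-=o : ∀ k → scale (suc k) =o scale k
  scale-=o k ε 0<ε = eventually-map
    (λ n le → 0≤x⇒∣x∣≤ (0≤scale (suc k) n) (≤-trans le (*-monoʳ-≤ (<⇒≤ 0<ε) (x≤∣x∣ _))))
    (scale-decay k 0<ε)

  scale-antitone : ∀ k j → Eventually λ n → scale (k ℕ.+ j) n ≤ scale k n
  scale-antitone k zero    = 0 , λ n _ → ≤-reflexive (reflexive (≡.cong (λ i → scale i n) (ℕ.+-identityʳ k)))
  scale-antitone k (suc j) = eventually-map₂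
    (λ n le₁ le₂ → begin
      scale (k ℕ.+ suc j) n    ≡⟨ ≡.cong (λ i → scale i n) (ℕ.+-suc k j) ⟩
      scale (suc (k ℕ.+ j)) n  ≤⟨ le₁ ⟩
      1# * scale (k ℕ.+ j) n   ≈⟨ *-identityˡ _ ⟩
      scale (k ℕ.+ j) n        ≤⟨ le₂ ⟩
      scale k n                ∎)
    (scale-decay (k ℕ.+ j) 0<1) (scale-antitone k j)
    where open ≤-Reasoning

  -- n k = k (k + 1) / 2 + k (k - 1) / 2 + k (n - k)
  scale-term : ∀ {k n a α} → k ℕ.≤ n → a * q ^ triangular k ≈ α →
    (n C k) · (q ^ (k ℕ.* (n ∸ k)) * (α * 1#)) ≈ a * scale k n
  scale-term {k} {n} {a} {α} k≤n aq^≈α = begin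
    (n C k) · (q ^ (k ℕ.* (n ∸ k)) * (α * 1#))
      ≈⟨ ×-congʳ (n C k) (*-congˡ (*-congʳ aq^≈α)) ⟨
    (n C k) · (q ^ (k ℕ.* (n ∸ k)) * (a * q ^ triangular k * 1#))
      ≈⟨ ×-congʳ (n C k) (solve 3 (λ x a y → x :* (a :* y :* con (+ 1)) := a :* (y :* x)) refl _ _ _) ⟩
    (n C k) · (a * (q ^ triangular k * q ^ (k ℕ.* (n ∸ k))))
      ≈⟨ ×-congʳ (n C k) (*-congˡ (quotient-unique k n exponents)) ⟨
    (n C k) · (a * quotient k n)
      ≈⟨ ×-comm-* (n C k) a (quotient k n) ⟨
    a * scale k n ∎
    where
    open ≈-Reasoning
    2triangular : ∀ k → triangular (suc k) ℕ.+ triangular k ≡ k ℕ.* k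
    2triangular zero    = ≡.refl
    2triangular (suc k) = ≡.trans (rearrange k (triangular k))
      (≡.trans (≡.cong (λ m → suc (k ℕ.+ k ℕ.+ m)) (2triangular k)) (square k))
      where
      rearrange : ∀ k t → suc k ℕ.+ (k ℕ.+ t) ℕ.+ (k ℕ.+ t) ≡ suc (k ℕ.+ k ℕ.+ (k ℕ.+ t ℕ.+ t))
      rearrange = ℕ-Solver.solve-∀
      square : ∀ k → suc (k ℕ.+ k ℕ.+ k ℕ.* k) ≡ suc k ℕ.* suc k
      square = ℕ-Solver.solve-∀
    exponents : q ^ triangular (suc k) * (q ^ triangular k * q ^ (k ℕ.* (n ∸ k))) ≈ q ^ (n ℕ.* k)
    exponents = begin
      q ^ triangular (suc k) * (q ^ triangular k * q ^ (k ℕ.* (n ∸ k)))  ≈⟨ *-assoc _ _ _ ⟨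
      q ^ triangular (suc k) * q ^ triangular k * q ^ (k ℕ.* (n ∸ k))
        ≈⟨ *-congʳ (^-homo-* q (triangular (suc k)) (triangular k)) ⟨
      q ^ (triangular (suc k) ℕ.+ triangular k) * q ^ (k ℕ.* (n ∸ k))
        ≈⟨ ^-homo-* q (triangular (suc k) ℕ.+ triangular k) (k ℕ.* (n ∸ k)) ⟨
      q ^ (triangular (suc k) ℕ.+ triangular k ℕ.+ k ℕ.* (n ∸ k))
        ≡⟨ ≡.cong (λ m → q ^ (m ℕ.+ k ℕ.* (n ∸ k))) (2triangular k) ⟩
      q ^ (k ℕ.* k ℕ.+ k ℕ.* (n ∸ k))
        ≡⟨ ≡.cong (q ^_) (≡.trans (≡.sym (ℕ.*-distribˡ-+ k k (n ∸ k)))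
             (≡.trans (≡.cong (k ℕ.*_) (ℕ.m+[n∸m]≡n k≤n)) (ℕ.*-comm k n))) ⟩
      q ^ (n ℕ.* k) ∎

  -- Asymptotics

  -- Big O relative to the scale with a constant known to be nonnegative and the nonnegative scale
  -- free of absolute values, so that bounds add up termwise.
  record Dominated (k : ℕ) (f : ℕ → Carrier) : Set (c ⊔ ℓ₂) where
    constructor dominated
    field
      constant : Carrier
      0≤       : 0# ≤ constant
      bound    : Eventually λ n → ∣ f n ∣ ≤ constant * scale k n

  dominated-+ : ∀ {k f g} → Dominated k f → Dominated k g → Dominated k (λ n → f n + g n)
  dominated-+ (dominated K 0≤K f≤) (dominated L 0≤L g≤) = dominated (K + L) (0≤+ 0≤K 0≤L)
    (eventually-map₂ (λ n f≤ g≤ → ≤-trans (∣+∣≤ f≤ g≤) (≤-reflexive (sym (distribʳ _ K L)))) f≤ g≤)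

  dominated-Σ< : ∀ {k} N {f : ℕ → ℕ → Carrier} → (∀ j → Dominated k (f j)) →
    Dominated k (λ n → Σ< N (λ j → f j n))
  dominated-Σ< zero    f≤ = dominated 0# ≤-refl (0 , λ n _ → ≤-trans ∣0∣≤0 (≤-reflexive (sym (zeroˡ _))))
  dominated-Σ< (suc N) f≤ = dominated-+ (f≤ 0) (dominated-Σ< N λ j → f≤ (suc j))

  dominated-resp-≈ : ∀ {k} {f g : ℕ → Carrier} → Eventually (λ n → f n ≈ g n) → Dominated k f → Dominated k g
  dominated-resp-≈ f≈g (dominated K 0≤K f≤) = dominated K 0≤K (eventually-map₂ (λ n → ∣∣≤-resp-≈) f≈g f≤)

  dominated⇒=O : ∀ {k f} → Dominated k f → f =O scale k
  dominated⇒=O (dominated K 0≤K f≤) =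
    K , eventually-map (λ n f≤ → ≤-trans f≤ (*-monoʳ-≤ 0≤K (x≤∣x∣ _))) f≤

  dominated-scale : ∀ k j a → Dominated k (λ n → a * scale (k ℕ.+ j) n)
  dominated-scale k j a = dominated ∣ a ∣ (0≤∣x∣ a) (eventually-map
    (λ n le → ∣*∣≤ ≤-refl (0≤x⇒∣x∣≤ (0≤scale (k ℕ.+ j) n) le)) (scale-antitone k j))

  Σ<-+ : ∀ M N f → Σ< (M ℕ.+ N) f ≈ Σ< M f + Σ< N (λ j → f (M ℕ.+ j))
  Σ<-+ zero    N f = sym (+-identityˡ _)
  Σ<-+ (suc M) N f = trans (+-congˡ (Σ<-+ M N (λ k → f (suc k)))) (sym (+-assoc _ _ _))

  ⊛𝟏-binomial : ∀ {α L} → (∀ k → L ℕ.≤ k → α k ≈ 0#) → ∀ n →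
    (α ⊛ 𝟏) n ≈ Σ< L (λ k → (n C k) · (q ^ (k ℕ.* (n ∸ k)) * (α k * 1#)))
  ⊛𝟏-binomial {α} {L} α≈0 n = Σ⊆-binomial (λ k l → q ^ (k ℕ.* l) * (α k * 1#)) L n
    λ k l L≤k → trans (*-congˡ (trans (*-congʳ (α≈0 k L≤k)) (zeroˡ _))) (zeroʳ _)

  -- Of the finitely many terms of α ⊛ 𝟏 the first M are those of the expansion, and each later one
  -- is a constant multiple of a scale function of index at least M. Once n ≥ M + L every index k
  -- that occurs is at most n, so `scale-term` applies to it.
  dominated-⊛𝟏 : ∀ {α a : Sequence} M → FiniteSupport α → (∀ k → k ℕ.< M → a k * q ^ triangular k ≈ α k) →
    Dominated M (λ n → (α ⊛ 𝟏) n - Σ< M (λ k → a k * scale k n))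
  dominated-⊛𝟏 {α} {a} M (L , α≈0) aq^≈α = dominated-resp-≈
    (M ℕ.+ L , λ n M+L≤n → sym (begin
      (α ⊛ 𝟏) n - Σ< M (λ k → a k * scale k n)
        ≈⟨ +-congʳ (trans (⊛𝟏-binomial (λ k M+L≤k → α≈0 k (ℕ.m+n≤o⇒n≤o M M+L≤k)) n) (Σ<-+ M L (term n))) ⟩
      Σ< M (term n) + Σ< L (λ j → term n (M ℕ.+ j)) - Σ< M (λ k → a k * scale k n)
        ≈⟨ +-congʳ (+-congʳ (sum-cong-≋ {M} λ i → scale-term
             (ℕ.≤-trans (ℕ.<⇒≤ (Fin.toℕ<n i)) (ℕ.m+n≤o⇒m≤o M M+L≤n)) (aq^≈α (toℕ i) (Fin.toℕ<n i)))) ⟩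
      Σ< M (λ k → a k * scale k n) + Σ< L (λ j → term n (M ℕ.+ j)) - Σ< M (λ k → a k * scale k n)
        ≈⟨ solve 2 (λ x y → x :+ y :- x := y) refl _ _ ⟩
      Σ< L (λ j → term n (M ℕ.+ j)) ∎))
    (dominated-Σ< L λ j → dominated-resp-≈
      (M ℕ.+ j , λ n M+j≤n → sym (scale-term M+j≤n (divided (M ℕ.+ j))))
      (dominated-scale M j (α (M ℕ.+ j) * inverse (M ℕ.+ j))))
    where
    open ≈-Reasoning
    term : ℕ → ℕ → Carrier
    term n k = (n C k) · (q ^ (k ℕ.* (n ∸ k)) * (α k * 1#))
    -- `a` is tied to α only below M; the coefficients of the later terms are found by dividing α k
    -- by its power of q.
    inverse : ℕ → Carrier
    inverse k = proj₁ (0<x⇒Σ-inverse (0<q^n (triangular k)))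
    divided : ∀ k → α k * inverse k * q ^ triangular k ≈ α k
    divided k = trans (solve 3 (λ x y z → x :* y :* z := x :* (z :* y)) refl _ _ _)
      (trans (*-congˡ (proj₂ (proj₂ (0<x⇒Σ-inverse (0<q^n (triangular k)))))) (*-identityʳ _))

  ^-monoˡ-≤ : ∀ {x y} n → 0# ≤ x → x ≤ y → x ^ n ≤ y ^ n
  ^-monoˡ-≤ zero    0≤x x≤y = ≤-refl
  ^-monoˡ-≤ (suc n) 0≤x x≤y = *-mono-≤ 0≤x (0≤^ n (≤-trans 0≤x x≤y)) x≤y (^-monoˡ-≤ n 0≤x x≤y)

  -- The surplus j pays for the number of subsets: 2 q ^ (M + j) ≤ q ^ M, and the n-th power of this
  -- gives 2 ^ n q ^ (R n) ≤ q ^ (n M). The constant w is the inverse of q ^ (R R).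
  dominated-tail : ∀ {u v} M j → (1# + 1#) * q ^ j ≤ 1# → Bounded u → Bounded v →
    VanishesBelow (M ℕ.+ j) u → VanishesBelow (M ℕ.+ j) v → Dominated M (u ⊛ v)
  dominated-tail {u} {v} M j 2q^j≤1 (A , u≤A) (B , v≤B) u≈0 v≈0 =
    dominated (w * (A * B)) (0≤* 0≤w 0≤AB) (M , λ n M≤n → ∣∣≤-resp-≈
      (begin-equality
        w * (q ^ (R ℕ.* R) * (u ⊛ v) n)  ≈⟨ *-assoc _ _ _ ⟨
        w * q ^ (R ℕ.* R) * (u ⊛ v) n    ≈⟨ *-congʳ (trans (*-comm _ _) (proj₂ (proj₂ inverse))) ⟩
        1# * (u ⊛ v) n                   ≈⟨ *-identityˡ _ ⟩
        (u ⊛ v) n                        ∎)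
      (≤-trans
        (∣*∣≤ (0≤x⇒∣x∣≤ 0≤w ≤-refl) (⊛-tail-estimate R A B u≤A v≤B u≈0 v≈0 n))
        (begin
          w * ((1# + 1#) ^ n * (q ^ (R ℕ.* n) * (A * B)))
            ≈⟨ solve 4 (λ w x y z → w :* (x :* (y :* z)) := w :* z :* (x :* y)) refl _ _ _ _ ⟩
          w * (A * B) * ((1# + 1#) ^ n * q ^ (R ℕ.* n))
            ≤⟨ *-monoʳ-≤ (0≤* 0≤w 0≤AB) (≤-trans (2^nq^Rn≤ n) (q^≤scale M≤n)) ⟩
          w * (A * B) * scale M n ∎)))
    where
    open ≤-Reasoning
    R = M ℕ.+ j
    inverse = 0<x⇒Σ-inverse (0<q^n (R ℕ.* R))
    w = proj₁ inverse
    0≤w = <⇒≤ (proj₁ (proj₂ inverse))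
    0≤AB = 0≤* (bound-nonneg (u≤A 0)) (bound-nonneg (v≤B 0))
    2q^R≤q^M : (1# + 1#) * q ^ R ≤ q ^ M
    2q^R≤q^M = begin
      (1# + 1#) * q ^ R            ≈⟨ *-congˡ (^-homo-* q M j) ⟩
      (1# + 1#) * (q ^ M * q ^ j)  ≈⟨ solve 3 (λ a b c → a :* (b :* c) := b :* (a :* c)) refl _ _ _ ⟩
      q ^ M * ((1# + 1#) * q ^ j)  ≤⟨ *-monoʳ-≤ (0≤q^ M) 2q^j≤1 ⟩
      q ^ M * 1#                   ≈⟨ *-identityʳ _ ⟩
      q ^ M                        ∎
    2^nq^Rn≤ : ∀ n → (1# + 1#) ^ n * q ^ (R ℕ.* n) ≤ q ^ (n ℕ.* M)
    2^nq^Rn≤ n = begin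
      (1# + 1#) ^ n * q ^ (R ℕ.* n)  ≈⟨ *-congˡ (^-assocʳ q R n) ⟨
      (1# + 1#) ^ n * (q ^ R) ^ n    ≈⟨ ^-distrib-* (1# + 1#) (q ^ R) n ⟨
      ((1# + 1#) * q ^ R) ^ n        ≤⟨ ^-monoˡ-≤ n (0≤* (0≤+ 0≤1 0≤1) (0≤q^ R)) 2q^R≤q^M ⟩
      (q ^ M) ^ n                    ≈⟨ trans (^-assocʳ q M n) (^-congʳ q (ℕ.*-comm M n)) ⟩
      q ^ (n ℕ.* M)                  ∎

  module _ {σ : Sequence} (𝟏≋δ⊕σ⊛𝟏 : 𝟏 ≋ δ ⊕ σ ⊛ 𝟏) (m : ℕ) (a : Sequence)
    (aq^≈ : ∀ k → a k * q ^ triangular k ≈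
      suc m · ((σ Seq.^ m) k - 2 · (σ Seq.^ suc m) k + (σ Seq.^ suc (suc m)) k)) where

    private
      module _ (M j : ℕ) (2q^j≤1 : (1# + 1#) * q ^ j ≤ 1#) where
        R = M ℕ.+ j

        low high rest : Sequence
        low  = truncate R σ
        high = σ Seq.- low
        rest = Seq.remainder low high m 𝟏

        finite-low : FiniteSupport low
        finite-low = truncate-finiteSupport R σ

        bounded-low : Bounded low
        bounded-low = FiniteSupport⇒Bounded finite-low

        bounded-high : Bounded high
        bounded-high = Bounded-⊕ (Bounded-σ 𝟏≋δ⊕σ⊛𝟏) (Bounded-neg bounded-low)

        vanishing-high : VanishesBelow R high
        vanishing-high k k<R = trans (+-congˡ (-‿cong (truncate-agrees R σ k k<R))) (-‿inverseʳ _)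

        low+high≋σ : low ⊕ high ≋ σ
        low+high≋σ n = solve 2 (λ x y → y :+ (x :- y) := x) refl _ _

        -- The equation for 𝟏 says that 𝟏 inverts δ - σ, so it plays the role of t. The bracketing
        -- of the error exhibits two factors that vanish below R.
        σ^1+m≋ : σ Seq.^ suc m ≋ Seq.slope m low ⊛ 𝟏 ⊕ Seq.constantTerm m low ⊕ high ⊛ (high ⊛ rest)
        σ^1+m≋ n = trans (Seq.^-congˡ (suc m) (λ n → sym (low+high≋σ n)) n)
          (Seq.powers-linear low high
            (λ n → trans (𝟏≋δ⊕σ⊛𝟏 n) (+-congˡ (⊛-cong (λ n → sym (low+high≋σ n)) (λ _ → refl) n))) m n)

        slope-coefficient : ∀ k → k ℕ.< M → a k * q ^ triangular k ≈ Seq.slope m low k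
        slope-coefficient k k<M = trans (aq^≈ k) (sym (trans (slope-pointwise m low k)
          (×-congʳ (suc m) (+-cong (+-cong (agree m) (-‿cong (×-congʳ 2 (agree (suc m))))) (agree (suc (suc m)))))))
          where
          agree : ∀ m → (low Seq.^ m) k ≈ (σ Seq.^ m) k
          agree m = agree-^ (truncate-agrees R σ) m k (ℕ.<-≤-trans k<M (ℕ.m≤m+n M j))

        difference : Dominated M λ n → (σ Seq.^ suc m) n - Σ< M (λ k → a k * scale k n)
        difference = dominated-resp-≈
          (eventually-map (λ n const≈0 → sym (begin
            (σ Seq.^ suc m) n - S n
              ≈⟨ +-congʳ (σ^1+m≋ n) ⟩
            (Seq.slope m low ⊛ 𝟏) n + Seq.constantTerm m low n + (high ⊛ (high ⊛ rest)) n - S n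
              ≈⟨ +-congʳ (+-congʳ (trans (+-congˡ const≈0) (+-identityʳ _))) ⟩
            (Seq.slope m low ⊛ 𝟏) n + (high ⊛ (high ⊛ rest)) n - S n
              ≈⟨ solve 3 (λ x y z → x :+ y :- z := x :- z :+ y) refl _ _ _ ⟩
            (Seq.slope m low ⊛ 𝟏) n - S n + (high ⊛ (high ⊛ rest)) n ∎))
            (Seq.IsSubring.constantTerm∈ isSubring-FiniteSupport m finite-low))
          (dominated-+
            (dominated-⊛𝟏 M (Seq.IsSubring.slope∈ isSubring-FiniteSupport m finite-low) slope-coefficient)
            (dominated-tail M j 2q^j≤1 bounded-high
              (Bounded-⊛ bounded-high (Seq.IsSubring.remainder∈ isSubring-Bounded m bounded-low bounded-high (Bounded-const 1#)))
              vanishing-high (VanishesBelow-⊛ rest vanishing-high)))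
          where
          open ≈-Reasoning
          S : ℕ → Carrier
          S n = Σ< M (λ k → a k * scale k n)

    power-expansion : AsymptoticExpansion (σ Seq.^ suc m) a scale
    power-expansion = scale-=o , λ r → dominated⇒=O (from r (A*x^n→0 0≤q 0<p q+p≈1 (1# + 1#) 0<1))
      where
      from : ∀ r → Eventually (λ j → (1# + 1#) * q ^ j ≤ 1#) →
        Dominated (suc r) λ n → (σ Seq.^ suc m) n - Σ< (suc r) (λ k → a k * scale k n)
      -- The terms with k ≤ r are `suc r` in number, hence M = `suc r`.
      from r (j , 2q^j≤1) = difference (suc r) j (2q^j≤1 j ℕ.≤-refl)

-- Combinatorics of tournaments: splitting off the first component

module Decomposition where
  open import Relation.Binary.Construct.Closure.ReflexiveTransitive
    using (Star; ε; _◅_; _◅◅_; gmap)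
  open ≡ using (_≢_; refl; sym; trans; cong; cong₂; subst)

  lookup-injective : ∀ {a} {A : Set a} {xs : List A} → Unique xs →
    ∀ i j → List.lookup xs i ≡ List.lookup xs j → i ≡ j
  lookup-injective (x∉ ∷ uniq) zero    zero    eq = refl
  lookup-injective (x∉ ∷ uniq) zero    (suc j) eq = ⊥-elim (All.lookup x∉ (∈-lookup j) eq)
  lookup-injective (x∉ ∷ uniq) (suc i) zero    eq = ⊥-elim (All.lookup x∉ (∈-lookup i) (sym eq))
  lookup-injective (x∉ ∷ uniq) (suc i) (suc j) eq = cong suc (lookup-injective uniq i j eq)

  vec-ext : ∀ {a} {A : Set a} {n} {xs ys : Vec A n} → (∀ i → lookup xs i ≡ lookup ys i) → xs ≡ ys
  vec-ext {xs = xs} {ys} eq = trans (sym (Vec.tabulate∘lookup xs)) (trans (Vec.tabulate-cong eq) (Vec.tabulate∘lookup ys))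

  does⇒ : ∀ {a} {P : Set a} (P? : Dec P) → does P? ≡ true → P
  does⇒ (yes p) _ = p

  ¬T⇒≡ : ∀ {b} → ¬ T b → false ≡ b
  ¬T⇒≡ {false} _  = refl
  ¬T⇒≡ {true}  ¬T = ⊥-elim (¬T tt)

  -- Counting strongly connected components

  -- A quotient map for mutual reachability onto k classes. It pins down k, so components can be
  -- counted without following the deduplicated list of subsets.
  record Classification {n} (A : Digraph n) (k : ℕ) : Set where
    field
      class      : Fin n → Fin k
      surjective : ∀ c → ∃[ i ] class i ≡ c
      sound      : ∀ {i j} → class i ≡ class j → MutuallyReachable A i j
      complete   : ∀ {i j} → MutuallyReachable A i j → class i ≡ class j

  -- Sending a class of F to the class in G of a chosen representative is injective, since both
  -- identify exactly the mutually reachable vertices.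
  classification-≤ : ∀ {n} {A : Digraph n} {k l} → Classification A k → Classification A l → k ℕ.≤ l
  classification-≤ {k = k} {l} F G = Fin.injective⇒≤ {f = f} injective
    where
    module F = Classification F
    module G = Classification G
    f : Fin k → Fin l
    f c = G.class (proj₁ (F.surjective c))
    injective : Injective _≡_ _≡_ f
    injective {c} {d} eq = trans (sym (proj₂ (F.surjective c)))
      (trans (F.complete (G.sound eq)) (proj₂ (F.surjective d)))

  module _ {n} (A : Digraph n) where
    mutuallyReachable-refl : ∀ {i} → MutuallyReachable A i i
    mutuallyReachable-refl = ε , ε

    mutuallyReachable-sym : ∀ {i j} → MutuallyReachable A i j → MutuallyReachable A j i
    mutuallyReachable-sym (p , r) = r , p

    mutuallyReachable-trans : ∀ {i j k} → MutuallyReachable A i j → MutuallyReachable A j k → MutuallyReachable A i k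
    mutuallyReachable-trans (p , r) (p′ , r′) = p ◅◅ p′ , r′ ◅◅ r

    lookup-component : ∀ i j → lookup (component A i) j ≡ does (mutuallyReachable? A i j)
    lookup-component i = Vec.lookup∘tabulate _

    component-sound : ∀ {i j} → component A i ≡ component A j → MutuallyReachable A i j
    component-sound {i} {j} eq = does⇒ (mutuallyReachable? A i j) (begin
      does (mutuallyReachable? A i j)  ≡⟨ lookup-component i j ⟨
      lookup (component A i) j         ≡⟨ cong (λ v → lookup v j) eq ⟩
      lookup (component A j) j         ≡⟨ lookup-component j j ⟩
      does (mutuallyReachable? A j j)  ≡⟨ dec-true (mutuallyReachable? A j j) mutuallyReachable-refl ⟩
      true                             ∎)
      where open ≡-Reasoning

    component-complete : ∀ {i j} → MutuallyReachable A i j → component A i ≡ component A j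
    component-complete {i} {j} i~j = Vec.tabulate-cong λ k → does-⇔
      (mk⇔ (mutuallyReachable-trans (mutuallyReachable-sym i~j)) (mutuallyReachable-trans i~j))
      (mutuallyReachable? A i k) (mutuallyReachable? A j k)

    component∈components : ∀ i → component A i ∈ components A
    component∈components i = ∈-deduplicate⁺ _ (∈-map⁺ (component A) (∈-allFin i))

    componentClassification : Classification A (numComponents A)
    componentClassification = record
      { class      = class
      ; surjective = surjective
      ; sound      = λ {i} {j} eq → component-sound (trans (lookup-class i)
                       (trans (cong (List.lookup (components A)) eq) (sym (lookup-class j))))
      ; complete   = λ {i} {j} i~j → lookup-injective unique (class i) (class j)
                       (trans (sym (lookup-class i)) (trans (component-complete i~j) (lookup-class j)))
      }
      where
      class : Fin n → Fin (numComponents A)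
      class i = Any.index (component∈components i)
      lookup-class : ∀ i → component A i ≡ List.lookup (components A) (class i)
      lookup-class i = lookup-index (component∈components i)
      unique : Unique (components A)
      unique = UniqueDec.deduplicate-! (Vec.≡-dec Bool._≟_) (List.map (component A) (allFin n))
      surjective : ∀ c → ∃[ i ] class i ≡ c
      surjective c =
        let i , _ , eq = ∈-map⁻ (component A) (∈-deduplicate⁻ _ (List.map (component A) (allFin n)) (∈-lookup c))
        in i , lookup-injective unique (class i) c (trans (sym (lookup-class i)) (sym eq))

  numComponents-unique : ∀ {n k} (A : Digraph n) → Classification A k → numComponents A ≡ k
  numComponents-unique A F = ℕ.≤-antisym
    (classification-≤ (componentClassification A) F) (classification-≤ F (componentClassification A))

  -- Splitting the vertex set

  -- The recursion follows that of `Σ⊆`, so a sum over bit vectors of a function of the two sizes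
  -- unfolds in the same way.
  inside outside : ∀ {n} → Vec Bool n → ℕ
  inside []          = 0
  inside (true  ∷ S) = suc (inside S)
  inside (false ∷ S) = inside S
  outside []          = 0
  outside (true  ∷ S) = outside S
  outside (false ∷ S) = suc (outside S)

  split : ∀ {n} (S : Vec Bool n) → Fin n → Fin (inside S) ⊎ Fin (outside S)
  split (true  ∷ S) zero    = inj₁ zero
  split (true  ∷ S) (suc i) = Sum.map₁ suc (split S i)
  split (false ∷ S) zero    = inj₂ zero
  split (false ∷ S) (suc i) = Sum.map₂ suc (split S i)

  embedˡ : ∀ {n} (S : Vec Bool n) → Fin (inside S) → Fin n
  embedˡ (true  ∷ S) zero    = zero
  embedˡ (true  ∷ S) (suc x) = suc (embedˡ S x)
  embedˡ (false ∷ S) x       = suc (embedˡ S x)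

  embedʳ : ∀ {n} (S : Vec Bool n) → Fin (outside S) → Fin n
  embedʳ (true  ∷ S) y       = suc (embedʳ S y)
  embedʳ (false ∷ S) zero    = zero
  embedʳ (false ∷ S) (suc y) = suc (embedʳ S y)

  embed : ∀ {n} (S : Vec Bool n) → Fin (inside S) ⊎ Fin (outside S) → Fin n
  embed S = [ embedˡ S , embedʳ S ]′

  split-embedˡ : ∀ {n} (S : Vec Bool n) x → split S (embedˡ S x) ≡ inj₁ x
  split-embedˡ (true  ∷ S) zero    = refl
  split-embedˡ (true  ∷ S) (suc x) = cong (Sum.map₁ suc) (split-embedˡ S x)
  split-embedˡ (false ∷ S) x       = cong (Sum.map₂ suc) (split-embedˡ S x)

  split-embedʳ : ∀ {n} (S : Vec Bool n) y → split S (embedʳ S y) ≡ inj₂ y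
  split-embedʳ (true  ∷ S) y       = cong (Sum.map₁ suc) (split-embedʳ S y)
  split-embedʳ (false ∷ S) zero    = refl
  split-embedʳ (false ∷ S) (suc y) = cong (Sum.map₂ suc) (split-embedʳ S y)

  embedˡ-injective : ∀ {n} (S : Vec Bool n) → Injective _≡_ _≡_ (embedˡ S)
  embedˡ-injective S {x} {y} eq =
    inj₁-injective (trans (sym (split-embedˡ S x)) (trans (cong (split S) eq) (split-embedˡ S y)))

  embedʳ-injective : ∀ {n} (S : Vec Bool n) → Injective _≡_ _≡_ (embedʳ S)
  embedʳ-injective S {x} {y} eq =
    inj₂-injective (trans (sym (split-embedʳ S x)) (trans (cong (split S) eq) (split-embedʳ S y)))

  split-embed : ∀ {n} (S : Vec Bool n) u → split S (embed S u) ≡ u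
  split-embed S (inj₁ x) = split-embedˡ S x
  split-embed S (inj₂ y) = split-embedʳ S y

  embed-split : ∀ {n} (S : Vec Bool n) i → embed S (split S i) ≡ i
  embed-split (true ∷ S) zero = refl
  embed-split (true ∷ S) (suc i) with split S i | embed-split S i
  ... | inj₁ x | eq = cong suc eq
  ... | inj₂ y | eq = cong suc eq
  embed-split (false ∷ S) zero = refl
  embed-split (false ∷ S) (suc i) with split S i | embed-split S i
  ... | inj₁ x | eq = cong suc eq
  ... | inj₂ y | eq = cong suc eq

  lookup-embedˡ : ∀ {n} (S : Vec Bool n) x → lookup S (embedˡ S x) ≡ true
  lookup-embedˡ (true  ∷ S) zero    = refl
  lookup-embedˡ (true  ∷ S) (suc x) = lookup-embedˡ S x
  lookup-embedˡ (false ∷ S) x       = lookup-embedˡ S x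

  lookup-embedʳ : ∀ {n} (S : Vec Bool n) y → lookup S (embedʳ S y) ≡ false
  lookup-embedʳ (true  ∷ S) y       = lookup-embedʳ S y
  lookup-embedʳ (false ∷ S) zero    = refl
  lookup-embedʳ (false ∷ S) (suc y) = lookup-embedʳ S y

  embed-elim : ∀ {n p} (S : Vec Bool n) {P : Fin n → Set p} → (∀ u → P (embed S u)) → ∀ i → P i
  embed-elim S {P} f i = subst P (embed-split S i) (f (split S i))

  -- Ties are counted over pairs i < j, so preserving their number requires embeddings that respect
  -- the order.
  embedˡ-<ᵇ : ∀ {n} (S : Vec Bool n) x y → (toℕ (embedˡ S x) ℕ.<ᵇ toℕ (embedˡ S y)) ≡ (toℕ x ℕ.<ᵇ toℕ y)
  embedˡ-<ᵇ (true  ∷ S) zero    zero    = refl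
  embedˡ-<ᵇ (true  ∷ S) zero    (suc y) = refl
  embedˡ-<ᵇ (true  ∷ S) (suc x) zero    = refl
  embedˡ-<ᵇ (true  ∷ S) (suc x) (suc y) = embedˡ-<ᵇ S x y
  embedˡ-<ᵇ (false ∷ S) x       y       = embedˡ-<ᵇ S x y

  embedʳ-<ᵇ : ∀ {n} (S : Vec Bool n) x y → (toℕ (embedʳ S x) ℕ.<ᵇ toℕ (embedʳ S y)) ≡ (toℕ x ℕ.<ᵇ toℕ y)
  embedʳ-<ᵇ (true  ∷ S) x       y       = embedʳ-<ᵇ S x y
  embedʳ-<ᵇ (false ∷ S) zero    zero    = refl
  embedʳ-<ᵇ (false ∷ S) zero    (suc y) = refl
  embedʳ-<ᵇ (false ∷ S) (suc x) zero    = refl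
  embedʳ-<ᵇ (false ∷ S) (suc x) (suc y) = embedʳ-<ᵇ S x y

  adjacent : ∀ {n} → Digraph n → Fin n → Fin n → Bool
  adjacent A i j = lookup (lookup A i) j

  fromFunction : ∀ {n} → (Fin n → Fin n → Bool) → Digraph n
  fromFunction f = tabulate λ i → tabulate (f i)

  adjacent-fromFunction : ∀ {n} (f : Fin n → Fin n → Bool) i j → adjacent (fromFunction f) i j ≡ f i j
  adjacent-fromFunction f i j = trans
    (cong (λ row → lookup row j) (Vec.lookup∘tabulate (λ i → tabulate (f i)) i)) (Vec.lookup∘tabulate (f i) j)

  digraph-ext : ∀ {n} {A B : Digraph n} → (∀ i j → adjacent A i j ≡ adjacent B i j) → A ≡ B
  digraph-ext eq = vec-ext λ i → vec-ext (eq i)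

  dominating : ∀ {k l} → Digraph k → Digraph l → Fin k ⊎ Fin l → Fin k ⊎ Fin l → Bool
  dominating A B (inj₁ x) (inj₁ y) = adjacent A x y
  dominating A B (inj₁ x) (inj₂ y) = true
  dominating A B (inj₂ x) (inj₁ y) = false
  dominating A B (inj₂ x) (inj₂ y) = adjacent B x y

  merge : ∀ {n} (S : Vec Bool n) → Digraph (inside S) → Digraph (outside S) → Digraph n
  merge S A B = fromFunction λ i j → dominating A B (split S i) (split S j)

  restrictˡ : ∀ {n} (S : Vec Bool n) → Digraph n → Digraph (inside S)
  restrictˡ S t = fromFunction λ x y → adjacent t (embedˡ S x) (embedˡ S y)

  restrictʳ : ∀ {n} (S : Vec Bool n) → Digraph n → Digraph (outside S)
  restrictʳ S t = fromFunction λ x y → adjacent t (embedʳ S x) (embedʳ S y)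

  module _ {n} (S : Vec Bool n) (A : Digraph (inside S)) (B : Digraph (outside S)) where

    adjacent-merge : ∀ u v → adjacent (merge S A B) (embed S u) (embed S v) ≡ dominating A B u v
    adjacent-merge u v = trans (adjacent-fromFunction _ (embed S u) (embed S v))
      (cong₂ (dominating A B) (split-embed S u) (split-embed S v))

    restrictˡ-merge : restrictˡ S (merge S A B) ≡ A
    restrictˡ-merge = digraph-ext λ x y →
      trans (adjacent-fromFunction _ x y) (adjacent-merge (inj₁ x) (inj₁ y))

    restrictʳ-merge : restrictʳ S (merge S A B) ≡ B
    restrictʳ-merge = digraph-ext λ x y →
      trans (adjacent-fromFunction _ x y) (adjacent-merge (inj₂ x) (inj₂ y))

    edge-merge⁺ : ∀ u v → T (dominating A B u v) → Edge (merge S A B) (embed S u) (embed S v)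
    edge-merge⁺ u v = subst T (sym (adjacent-merge u v))

    edge-merge⁻ : ∀ u v → Edge (merge S A B) (embed S u) (embed S v) → T (dominating A B u v)
    edge-merge⁻ u v = subst T (adjacent-merge u v)

    -- Reachability in the merged digraph in closed form: no edge leads back into S, so a path
    -- between two vertices of one side stays on that side, and crossing outwards takes one edge.
    Reach : Fin (inside S) ⊎ Fin (outside S) → Fin (inside S) ⊎ Fin (outside S) → Set
    Reach (inj₁ x) (inj₁ y) = Star (Edge A) x y
    Reach (inj₁ x) (inj₂ y) = ⊤
    Reach (inj₂ x) (inj₁ y) = ⊥
    Reach (inj₂ x) (inj₂ y) = Star (Edge B) x y

    star⇒reach : ∀ {i j} → Star (Edge (merge S A B)) i j → Reach (split S i) (split S j)
    star⇒reach ε = reach-refl _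
      where
      reach-refl : ∀ u → Reach u u
      reach-refl (inj₁ x) = ε
      reach-refl (inj₂ y) = ε
    star⇒reach {i} {k} (_◅_ {j = j} e p) = step (split S i) (split S j) (split S k)
      (edge-merge⁻ (split S i) (split S j) (≡.subst₂ (Edge (merge S A B)) (sym (embed-split S i)) (sym (embed-split S j)) e))
      (star⇒reach p)
      where
      step : ∀ u v w → T (dominating A B u v) → Reach v w → Reach u w
      step (inj₁ x) (inj₁ y) (inj₁ z) e r = e ◅ r
      step (inj₁ x) v        (inj₂ z) e r = tt
      step (inj₂ x) (inj₂ y) (inj₂ z) e r = e ◅ r

    star-merge⁻ : ∀ u v → Star (Edge (merge S A B)) (embed S u) (embed S v) → Reach u v
    star-merge⁻ u v p = ≡.subst₂ Reach (split-embed S u) (split-embed S v) (star⇒reach p)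

    star-merge⁺ : ∀ u v → Reach u v → Star (Edge (merge S A B)) (embed S u) (embed S v)
    star-merge⁺ (inj₁ x) (inj₁ y) p = gmap (embedˡ S) (λ {x} {y} → edge-merge⁺ (inj₁ x) (inj₁ y)) p
    star-merge⁺ (inj₁ x) (inj₂ y) _ = edge-merge⁺ (inj₁ x) (inj₂ y) tt ◅ ε
    star-merge⁺ (inj₂ x) (inj₂ y) p = gmap (embedʳ S) (λ {x} {y} → edge-merge⁺ (inj₂ x) (inj₂ y)) p

    mergeClassification : ∀ {k l} → Classification A k → Classification B l →
      Classification (merge S A B) (k ℕ.+ l)
    mergeClassification {k} {l} F G = record
      { class      = λ i → class (split S i)
      ; surjective = surjective
      ; sound      = λ {i} {j} eq → ≡.subst₂ (MutuallyReachable (merge S A B)) (embed-split S i) (embed-split S j)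
                       (let r , r′ = sound (split S i) (split S j) eq in star-merge⁺ _ _ r , star-merge⁺ _ _ r′)
      ; complete   = λ {i} {j} (p , r) → complete (split S i) (split S j) (star⇒reach p) (star⇒reach r)
      }
      where
      module F = Classification F
      module G = Classification G
      class : Fin (inside S) ⊎ Fin (outside S) → Fin (k ℕ.+ l)
      class u = Fin.join k l (Sum.map F.class G.class u)
      class-injective : ∀ u v → class u ≡ class v → Sum.map F.class G.class u ≡ Sum.map F.class G.class v
      class-injective u v eq = trans (sym (Fin.splitAt-join k l _))
        (trans (cong (Fin.splitAt k) eq) (Fin.splitAt-join k l _))
      surjective : ∀ c → ∃[ i ] class (split S i) ≡ c
      surjective c = from (Fin.splitAt k c) (Fin.join-splitAt k l c)
        where
        from : ∀ s → Fin.join k l s ≡ c → ∃[ i ] class (split S i) ≡ c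
        from (inj₁ a) eq = let x , ex = F.surjective a in embedˡ S x ,
          trans (cong class (split-embedˡ S x)) (trans (cong (λ a → Fin.join k l (inj₁ a)) ex) eq)
        from (inj₂ b) eq = let y , ey = G.surjective b in embedʳ S y ,
          trans (cong class (split-embedʳ S y)) (trans (cong (λ b → Fin.join k l (inj₂ b)) ey) eq)
      sound : ∀ u v → class u ≡ class v → Reach u v × Reach v u
      sound (inj₁ x) (inj₁ y) eq = F.sound (inj₁-injective (class-injective (inj₁ x) (inj₁ y) eq))
      sound (inj₂ x) (inj₂ y) eq = G.sound (inj₂-injective (class-injective (inj₂ x) (inj₂ y) eq))
      sound (inj₁ x) (inj₂ y) eq with class-injective (inj₁ x) (inj₂ y) eq
      ... | ()
      sound (inj₂ x) (inj₁ y) eq with class-injective (inj₂ x) (inj₁ y) eq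
      ... | ()
      complete : ∀ u v → Reach u v → Reach v u → class u ≡ class v
      complete (inj₁ x) (inj₁ y) p r = cong (λ a → Fin.join k l (inj₁ a)) (F.complete (p , r))
      complete (inj₂ x) (inj₂ y) p r = cong (λ b → Fin.join k l (inj₂ b)) (G.complete (p , r))

    numComponents-merge : numComponents (merge S A B) ≡ numComponents A ℕ.+ numComponents B
    numComponents-merge = numComponents-unique (merge S A B)
      (mergeClassification (componentClassification A) (componentClassification B))

    isTournament-merge : IsTournamentWithTies A → IsTournamentWithTies B → IsTournamentWithTies (merge S A B)
    isTournament-merge (irreflA , totalA) (irreflB , totalB) =
      embed-elim S (λ u e → irrefl u (edge-merge⁻ u u e)) ,
      embed-elim S (λ u → embed-elim S λ v u≢v → Sum.map (edge-merge⁺ u v) (edge-merge⁺ v u)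
        (total u v (λ u≡v → u≢v (cong (embed S) u≡v))))
      where
      irrefl : ∀ u → ¬ T (dominating A B u u)
      irrefl (inj₁ x) = irreflA x
      irrefl (inj₂ y) = irreflB y
      total : ∀ u v → u ≢ v → T (dominating A B u v) ⊎ T (dominating A B v u)
      total (inj₁ x) (inj₁ y) u≢v = totalA x y (λ eq → u≢v (cong inj₁ eq))
      total (inj₁ x) (inj₂ y) u≢v = inj₁ tt
      total (inj₂ x) (inj₁ y) u≢v = inj₂ tt
      total (inj₂ x) (inj₂ y) u≢v = totalB x y (λ eq → u≢v (cong inj₂ eq))

  -- The first strongly connected component of a tournament consists of the
  -- vertices from which everything is reachable.

  top : ∀ {n} → Digraph n → Vec Bool n
  top t = tabulate λ i → does (Fin.all? λ j → reachable? t i j)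

  -- S can be read off from the merge when A is strongly connected, which makes the decomposition
  -- unique: vertices of S reach each other and everything outside, and no other vertex reaches into
  -- S.
  top-merge : ∀ {n} (S : Vec Bool n) A B → numComponents A ≡ 1 → top (merge S A B) ≡ S
  top-merge S A B nc≡1 = vec-ext λ i → trans (Vec.lookup∘tabulate _ i) (membership i)
    where
    F : Classification A 1
    F = subst (Classification A) nc≡1 (componentClassification A)
    module F = Classification F
    strong : ∀ x y → Star (Edge A) x y
    strong x y = proj₁ (F.sound (one (F.class x) (F.class y)))
      where
      one : (a b : Fin 1) → a ≡ b
      one zero zero = refl
    dec-eq : ∀ {p} {P : Set p} (P? : Dec P) b → (P → b ≡ true) → (b ≡ true → P) → does P? ≡ b
    dec-eq (yes p) b     f g = sym (f p)
    dec-eq (no ¬p) false f g = refl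
    dec-eq (no ¬p) true  f g = ⊥-elim (¬p (g refl))
    membership : ∀ i → does (Fin.all? λ j → reachable? (merge S A B) i j) ≡ lookup S i
    membership = embed-elim S λ
      { (inj₁ x) → dec-eq (Fin.all? λ j → reachable? (merge S A B) (embedˡ S x) j) _
          (λ _ → lookup-embedˡ S x) (λ _ → embed-elim S (reachˡ x))
      ; (inj₂ y) → dec-eq (Fin.all? λ j → reachable? (merge S A B) (embedʳ S y) j) _
          -- A has exactly one component and so at least one vertex, which y cannot reach.
          (λ r → ⊥-elim (star-merge⁻ S A B (inj₂ y) (inj₁ (proj₁ (F.surjective zero))) (r _)))
          (λ eq → ⊥-elim (false≢true (trans (sym (lookup-embedʳ S y)) eq)))
      }
      where
      false≢true : false ≡ true → ⊥
      false≢true ()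
      reachˡ : ∀ x v → Star (Edge (merge S A B)) (embedˡ S x) (embed S v)
      reachˡ x (inj₁ y) = star-merge⁺ S A B (inj₁ x) (inj₁ y) (strong x y)
      reachˡ x (inj₂ y) = star-merge⁺ S A B (inj₁ x) (inj₂ y) tt

  module _ {n} (t : Digraph n) (isT : IsTournamentWithTies t) where

    private
      irrefl = proj₁ isT
      total  = proj₂ isT

      S : Vec Bool n
      S = top t

      ∈top⁻ : ∀ {i} → lookup S i ≡ true → ∀ j → Star (Edge t) i j
      ∈top⁻ {i} eq = does⇒ (Fin.all? λ j → reachable? t i j) (trans (sym (Vec.lookup∘tabulate _ i)) eq)

      ∈top⁺ : ∀ {i} → (∀ j → Star (Edge t) i j) → lookup S i ≡ true
      ∈top⁺ {i} r = trans (Vec.lookup∘tabulate _ i) (dec-true (Fin.all? λ j → reachable? t i j) r)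

      true≢false : true ≢ false
      true≢false ()

    -- A vertex with an edge into `top t` would itself reach everything and lie in it. So no edge
    -- enters from outside, and totality puts an edge on every pair in the other direction.
    merge-restrict : merge (top t) (restrictˡ (top t) t) (restrictʳ (top t) t) ≡ t
    merge-restrict = digraph-ext (embed-elim S λ u → embed-elim S λ v →
      trans (adjacent-merge S (restrictˡ S t) (restrictʳ S t) u v) (agree u v))
      where
      upward : ∀ x y → ¬ Edge t (embedʳ S y) (embedˡ S x)
      upward x y e = true≢false (trans
        (sym (∈top⁺ λ j → e ◅ ∈top⁻ (lookup-embedˡ S x) j)) (lookup-embedʳ S y))
      T⇒≡ : ∀ b → T b → true ≡ b
      T⇒≡ true _ = refl
      agree : ∀ u v → dominating (restrictˡ S t) (restrictʳ S t) u v ≡ adjacent t (embed S u) (embed S v)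
      agree (inj₁ x) (inj₁ y) = adjacent-fromFunction _ x y
      agree (inj₂ x) (inj₂ y) = adjacent-fromFunction _ x y
      agree (inj₂ y) (inj₁ x) = ¬T⇒≡ (upward x y)
      agree (inj₁ x) (inj₂ y) = T⇒≡ _ (downward (total (embedˡ S x) (embedʳ S y) distinct))
        where
        distinct : embedˡ S x ≢ embedʳ S y
        distinct eq = true≢false (trans (sym (lookup-embedˡ S x)) (trans (cong (lookup S) eq) (lookup-embedʳ S y)))
        downward : Edge t (embedˡ S x) (embedʳ S y) ⊎ Edge t (embedʳ S y) (embedˡ S x) → Edge t (embedˡ S x) (embedʳ S y)
        downward (inj₁ e) = e
        downward (inj₂ e) = ⊥-elim (upward x y e)

    isTournament-restrict : ∀ {k} (f : Fin k → Fin n) → Injective _≡_ _≡_ f →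
      IsTournamentWithTies (fromFunction λ x y → adjacent t (f x) (f y))
    isTournament-restrict f f-injective =
      (λ x e → irrefl (f x) (subst T (adjacent-fromFunction _ x x) e)) ,
      (λ x y x≢y → Sum.map (subst T (sym (adjacent-fromFunction _ x y))) (subst T (sym (adjacent-fromFunction _ y x)))
        (total (f x) (f y) (x≢y ∘ f-injective)))

    isTournament-restrictˡ : IsTournamentWithTies (restrictˡ (top t) t)
    isTournament-restrictˡ = isTournament-restrict (embedˡ S) (embedˡ-injective S)

    isTournament-restrictʳ : IsTournamentWithTies (restrictʳ (top t) t)
    isTournament-restrictʳ = isTournament-restrict (embedʳ S) (embedʳ-injective S)

    -- A path between vertices that reach everything stays among such vertices.
    restrictˡ-strong : ∀ x y → Star (Edge (restrictˡ (top t) t)) x y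
    restrictˡ-strong x y = pull (inj₁ x) (∈top⁻ (lookup-embedˡ S x) (embedˡ S y)) refl
      where
      Pulled : Fin (inside S) ⊎ Fin (outside S) → Set
      Pulled (inj₁ x) = Star (Edge (restrictˡ S t)) x y
      Pulled (inj₂ _) = ⊥
      pull : ∀ u {i} → Star (Edge t) i (embedˡ S y) → embed S u ≡ i → Pulled u
      pull (inj₂ z) p eq = true≢false (trans
        (sym (∈top⁺ λ j → subst (λ i → Star (Edge t) i j) (sym eq) (p ◅◅ ∈top⁻ (lookup-embedˡ S y) j)))
        (lookup-embedʳ S z))
      pull (inj₁ x) ε eq = subst (λ z → Star (Edge (restrictˡ S t)) x z) (embedˡ-injective S eq) ε
      pull (inj₁ x) (_◅_ {j = j} e p) refl = continue (split S j) (embed-split S j) (pull (split S j) p (embed-split S j))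
        where
        continue : ∀ v → embed S v ≡ j → Pulled v → Star (Edge (restrictˡ S t)) x y
        continue (inj₁ z) refl q = subst T (sym (adjacent-fromFunction _ x z)) e ◅ q

    private
      -- Among the first k + 1 vertices one reaches all the others. A newcomer either has an edge
      -- from the current such vertex or an edge to it; in the second case the newcomer inherits
      -- everything reached.
      king : ∀ k → k ℕ.< n → ∃[ i ] (∀ j → toℕ j ℕ.≤ k → Star (Edge t) i j)
      king zero 0<n = i , λ j j≤0 → subst (Star (Edge t) i)
        (Fin.toℕ-injective (trans (Fin.toℕ-fromℕ< 0<n) (sym (ℕ.n≤0⇒n≡0 j≤0)))) ε
        where
        i = Fin.fromℕ< 0<n
      king (suc k) 1+k<n = choose (king k (ℕ.<-trans (ℕ.n<1+n k) 1+k<n))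
        where
        new : Fin n
        new = Fin.fromℕ< 1+k<n
        is-new : ∀ j → toℕ j ≡ suc k → new ≡ j
        is-new j eq = Fin.toℕ-injective (trans (Fin.toℕ-fromℕ< 1+k<n) (sym eq))
        choose : ∃[ i ] (∀ j → toℕ j ℕ.≤ k → Star (Edge t) i j) →
                 ∃[ i ] (∀ j → toℕ j ℕ.≤ suc k → Star (Edge t) i j)
        choose (i , r) with i Fin.≟ new
        ... | yes refl = i , λ j j≤ → [ r j ∘ ℕ.s≤s⁻¹ , (λ eq → subst (Star (Edge t) i) (is-new j eq) ε) ]′ (ℕ.m≤n⇒m<n∨m≡n j≤)
        ... | no i≢new with total i new i≢new
        ...   | inj₁ e = i , λ j j≤ → [ r j ∘ ℕ.s≤s⁻¹ , (λ eq → subst (Star (Edge t) i) (is-new j eq) (e ◅ ε)) ]′ (ℕ.m≤n⇒m<n∨m≡n j≤)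
        ...   | inj₂ e = new , λ j j≤ → [ (λ j<1+k → e ◅ r j (ℕ.s≤s⁻¹ j<1+k)) , (λ eq → subst (Star (Edge t) new) (is-new j eq) ε) ]′ (ℕ.m≤n⇒m<n∨m≡n j≤)

    top-inhabited : 0 ℕ.< n → Fin (inside (top t))
    top-inhabited 0<n = from (king (ℕ.pred n) (ℕ.≤-reflexive (ℕ.suc-pred n ⦃ ℕ.>-nonZero 0<n ⦄)))
      where
      from : ∃[ i ] (∀ j → toℕ j ℕ.≤ ℕ.pred n → Star (Edge t) i j) → Fin (inside S)
      from (i , r) = located (split S i) (embed-split S i)
        where
        i∈top : lookup S i ≡ true
        i∈top = ∈top⁺ λ j → r j (ℕ.<⇒≤pred (Fin.toℕ<n j))
        located : ∀ u → embed S u ≡ i → Fin (inside S)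
        located (inj₁ x) _    = x
        located (inj₂ y) refl = ⊥-elim (true≢false (trans (sym i∈top) (lookup-embedʳ S y)))

    numComponents-restrictˡ : 0 ℕ.< n → numComponents (restrictˡ (top t) t) ≡ 1
    numComponents-restrictˡ 0<n = numComponents-unique (restrictˡ (top t) t) record
      { class      = λ _ → zero
      ; surjective = λ { zero → top-inhabited 0<n , refl }
      ; sound      = λ _ → restrictˡ-strong _ _ , restrictˡ-strong _ _
      ; complete   = λ _ → refl
      }

  -- Counting ties

  module ΣFin = CommutativeMonoidSum ℕ.+-0-commutativeMonoid

  indicator : Bool → ℕ
  indicator b = if b then 1 else 0

  length-filter : ∀ {a p} {A : Set a} {P : Pred A p} (P? : Decidable P) xs →
    length (filter P? xs) ≡ ℕ.sum (List.map (indicator ∘ does ∘ P?) xs)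
  length-filter P? []       = refl
  length-filter P? (x ∷ xs) with does (P? x)
  ... | true  = cong suc (length-filter P? xs)
  ... | false = length-filter P? xs

  sum-cartesianProduct : ∀ {a b} {A : Set a} {B : Set b} (f : A × B → ℕ) xs ys →
    ℕ.sum (List.map f (cartesianProduct xs ys)) ≡ ℕ.sum (List.map (λ x → ℕ.sum (List.map (λ y → f (x , y)) ys)) xs)
  sum-cartesianProduct f []       ys = refl
  sum-cartesianProduct f (x ∷ xs) ys = begin
    ℕ.sum (List.map f (List.map (x ,_) ys ++ cartesianProduct xs ys))
      ≡⟨ cong ℕ.sum (List.map-++ f (List.map (x ,_) ys) _) ⟩
    ℕ.sum (List.map f (List.map (x ,_) ys) ++ List.map f (cartesianProduct xs ys))
      ≡⟨ ℕ.sum-++ (List.map f (List.map (x ,_) ys)) _ ⟩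
    ℕ.sum (List.map f (List.map (x ,_) ys)) ℕ.+ ℕ.sum (List.map f (cartesianProduct xs ys))
      ≡⟨ cong₂ ℕ._+_ (cong ℕ.sum (sym (List.map-∘ ys))) (sum-cartesianProduct f xs ys) ⟩
    ℕ.sum (List.map (λ y → f (x , y)) ys) ℕ.+ ℕ.sum (List.map (λ x → ℕ.sum (List.map (λ y → f (x , y)) ys)) xs) ∎
    where open ≡-Reasoning

  sum-tabulate : ∀ {a} {A : Set a} (g : A → ℕ) {n} (f : Fin n → A) →
    ℕ.sum (List.map g (List.tabulate f)) ≡ ΣFin.sum (g ∘ f)
  sum-tabulate g {zero}  f = refl
  sum-tabulate g {suc n} f = cong (g (f zero) ℕ.+_) (sum-tabulate g (f ∘ suc))

  tie : ∀ {n} → Digraph n → Fin n → Fin n → ℕ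
  tie A i j = indicator ((toℕ i ℕ.<ᵇ toℕ j) ∧ (adjacent A i j ∧ adjacent A j i))

  -- `tied?` is local to `numTies`, so it is left to unification; its `does` computes to the Boolean
  -- inside `tie`.
  numTies≡ΣΣ : ∀ {n} (A : Digraph n) → numTies A ≡ ΣFin.sum λ i → ΣFin.sum λ j → tie A i j
  numTies≡ΣΣ {n} A = trans (length-filter _ (cartesianProduct (allFin n) (allFin n)))
    (trans (sum-cartesianProduct _ (allFin n) (allFin n))
      (trans (sum-tabulate _ {n} id) (ΣFin.sum-cong-≗ {n} λ i → sum-tabulate _ {n} id)))

  sum-zero : ∀ {n} {f : Fin n → ℕ} → (∀ i → f i ≡ 0) → ΣFin.sum f ≡ 0
  sum-zero {n} f≡0 = trans (ΣFin.sum-cong-≗ f≡0) (ΣFin.sum-replicate-zero n)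

  sum-embed : ∀ {n} (S : Vec Bool n) (f : Fin n → ℕ) →
    ΣFin.sum f ≡ ΣFin.sum (f ∘ embedˡ S) ℕ.+ ΣFin.sum (f ∘ embedʳ S)
  sum-embed []          f = refl
  sum-embed (true  ∷ S) f = trans (cong (f zero ℕ.+_) (sum-embed S (f ∘ suc))) (sym (ℕ.+-assoc (f zero) _ _))
  sum-embed (false ∷ S) f = trans (cong (f zero ℕ.+_) (sum-embed S (f ∘ suc)))
    (exchange (f zero) (ΣFin.sum (f ∘ suc ∘ embedˡ S)) (ΣFin.sum (f ∘ suc ∘ embedʳ S)))
    where
    exchange : ∀ a b c → a ℕ.+ (b ℕ.+ c) ≡ b ℕ.+ (a ℕ.+ c)
    exchange = ℕ-Solver.solve-∀

  -- Pairs across the split lack the edge into S, so they are never ties; pairs on one side keep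
  -- their order and edges.
  numTies-merge : ∀ {n} (S : Vec Bool n) A B → numTies (merge S A B) ≡ numTies A ℕ.+ numTies B
  numTies-merge S A B = begin
    numTies M
      ≡⟨ numTies≡ΣΣ M ⟩
    (ΣFin.sum λ i → ΣFin.sum (tie M i))
      ≡⟨ sum-embed S (λ i → ΣFin.sum (tie M i)) ⟩
    (ΣFin.sum λ x → ΣFin.sum (tie M (embedˡ S x))) ℕ.+ (ΣFin.sum λ y → ΣFin.sum (tie M (embedʳ S y)))
      ≡⟨ cong₂ ℕ._+_ (ΣFin.sum-cong-≗ rowˡ) (ΣFin.sum-cong-≗ rowʳ) ⟩
    (ΣFin.sum λ x → ΣFin.sum (tie A x)) ℕ.+ (ΣFin.sum λ y → ΣFin.sum (tie B y))
      ≡⟨ cong₂ ℕ._+_ (sym (numTies≡ΣΣ A)) (sym (numTies≡ΣΣ B)) ⟩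
    numTies A ℕ.+ numTies B ∎
    where
    open ≡-Reasoning
    M = merge S A B
    M≡ = adjacent-merge S A B
    ∧-zeroʳ : ∀ {b c d} → d ≡ false → indicator (b ∧ (c ∧ d)) ≡ 0
    ∧-zeroʳ {b} {c} refl rewrite Bool.∧-zeroʳ c | Bool.∧-zeroʳ b = refl
    ∧-zeroˡ : ∀ {b c d} → c ≡ false → indicator (b ∧ (c ∧ d)) ≡ 0
    ∧-zeroˡ {b} refl rewrite Bool.∧-zeroʳ b = refl
    rowˡ : ∀ x → ΣFin.sum (tie M (embedˡ S x)) ≡ ΣFin.sum (tie A x)
    rowˡ x = begin
      ΣFin.sum (tie M (embedˡ S x))
        ≡⟨ sum-embed S (tie M (embedˡ S x)) ⟩
      (ΣFin.sum λ x′ → tie M (embedˡ S x) (embedˡ S x′)) ℕ.+ (ΣFin.sum λ y → tie M (embedˡ S x) (embedʳ S y))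
        ≡⟨ cong₂ ℕ._+_
             (ΣFin.sum-cong-≗ λ x′ → cong indicator (cong₂ _∧_ (embedˡ-<ᵇ S x x′) (cong₂ _∧_ (M≡ (inj₁ x) (inj₁ x′)) (M≡ (inj₁ x′) (inj₁ x)))))
             (sum-zero λ y → ∧-zeroʳ {toℕ (embedˡ S x) ℕ.<ᵇ toℕ (embedʳ S y)} (M≡ (inj₂ y) (inj₁ x))) ⟩
      ΣFin.sum (tie A x) ℕ.+ 0
        ≡⟨ ℕ.+-identityʳ _ ⟩
      ΣFin.sum (tie A x) ∎
    rowʳ : ∀ y → ΣFin.sum (tie M (embedʳ S y)) ≡ ΣFin.sum (tie B y)
    rowʳ y = begin
      ΣFin.sum (tie M (embedʳ S y))
        ≡⟨ sum-embed S (tie M (embedʳ S y)) ⟩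
      (ΣFin.sum λ x → tie M (embedʳ S y) (embedˡ S x)) ℕ.+ (ΣFin.sum λ y′ → tie M (embedʳ S y) (embedʳ S y′))
        ≡⟨ cong₂ ℕ._+_
             (sum-zero λ x → ∧-zeroˡ {toℕ (embedʳ S y) ℕ.<ᵇ toℕ (embedˡ S x)} (M≡ (inj₂ y) (inj₁ x)))
             (ΣFin.sum-cong-≗ λ y′ → cong indicator (cong₂ _∧_ (embedʳ-<ᵇ S y y′) (cong₂ _∧_ (M≡ (inj₂ y) (inj₂ y′)) (M≡ (inj₂ y′) (inj₂ y))))) ⟩
      ΣFin.sum (tie B y) ∎

  -- Adding a vertex

  -- The ways of joining the new vertex to an old one, of weights 1, 1 and ρ - 1. Their sum ρ + 1 is
  -- 1 / q, the total weight of a pair.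
  data Outcome : Set where
    win lose draw : Outcome

  outcomes : List Outcome
  outcomes = win ∷ lose ∷ draw ∷ []

  ∈-outcomes : ∀ o → o ∈ outcomes
  ∈-outcomes win  = here refl
  ∈-outcomes lose = there (here refl)
  ∈-outcomes draw = there (there (here refl))

  outcomes-unique : Unique outcomes
  outcomes-unique = ((λ ()) ∷ (λ ()) ∷ []) ∷ ((λ ()) ∷ []) ∷ [] ∷ []

  outgoing incoming isDraw : Outcome → Bool
  outgoing win  = true
  outgoing lose = false
  outgoing draw = true
  incoming win  = false
  incoming lose = true
  incoming draw = true
  isDraw o = outgoing o ∧ incoming o

  outcome-injective : ∀ o o′ → outgoing o ≡ outgoing o′ → incoming o ≡ incoming o′ → o ≡ o′
  outcome-injective win  win  _ _ = refl
  outcome-injective lose lose _ _ = refl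
  outcome-injective draw draw _ _ = refl
  outcome-injective win  draw _ ()
  outcome-injective draw win  _ ()
  outcome-injective lose draw () _
  outcome-injective draw lose () _

  outcome-surjective : ∀ b c → T b ⊎ T c → ∃[ o ] (outgoing o ≡ b × incoming o ≡ c)
  outcome-surjective true  true  _ = draw , refl , refl
  outcome-surjective true  false _ = win  , refl , refl
  outcome-surjective false true  _ = lose , refl , refl
  outcome-surjective false false (inj₁ ())
  outcome-surjective false false (inj₂ ())

  extended : ∀ {n} → Vec Outcome n → Digraph n → Fin (suc n) → Fin (suc n) → Bool
  extended v t zero    zero    = false
  extended v t zero    (suc j) = outgoing (lookup v j)
  extended v t (suc i) zero    = incoming (lookup v i)
  extended v t (suc i) (suc j) = adjacent t i j

  extend : ∀ {n} → Vec Outcome n → Digraph n → Digraph (suc n)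
  extend v t = fromFunction (extended v t)

  adjacent-extend : ∀ {n} (v : Vec Outcome n) t i j → adjacent (extend v t) i j ≡ extended v t i j
  adjacent-extend v t = adjacent-fromFunction (extended v t)

  isTournament-extend : ∀ {n} (v : Vec Outcome n) t → IsTournamentWithTies t → IsTournamentWithTies (extend v t)
  isTournament-extend v t (irrefl , total) =
    (λ i → irrefl′ i ∘ subst T (adjacent-extend v t i i)) ,
    (λ i j i≢j → Sum.map (subst T (sym (adjacent-extend v t i j))) (subst T (sym (adjacent-extend v t j i))) (total′ i j i≢j))
    where
    irrefl′ : ∀ i → ¬ T (extended v t i i)
    irrefl′ (suc i) = irrefl i
    decided : ∀ o → T (outgoing o) ⊎ T (incoming o)
    decided win  = inj₁ tt
    decided lose = inj₂ tt
    decided draw = inj₁ tt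
    total′ : ∀ i j → i ≢ j → T (extended v t i j) ⊎ T (extended v t j i)
    total′ zero    zero    i≢j = ⊥-elim (i≢j refl)
    total′ zero    (suc j) i≢j = decided (lookup v j)
    total′ (suc i) zero    i≢j = Sum.swap (decided (lookup v i))
    total′ (suc i) (suc j) i≢j = total i j (i≢j ∘ cong suc)

  extend-injective : ∀ {n} {v w : Vec Outcome n} {t u} → extend v t ≡ extend w u → v ≡ w × t ≡ u
  extend-injective {v = v} {w} {t} {u} eq =
    vec-ext (λ i → outcome-injective (lookup v i) (lookup w i) (agree zero (suc i)) (agree (suc i) zero)) ,
    digraph-ext (λ i j → agree (suc i) (suc j))
    where
    agree : ∀ i j → extended v t i j ≡ extended w u i j
    agree i j = trans (sym (adjacent-extend v t i j))
      (trans (cong (λ A → adjacent A i j) eq) (adjacent-extend w u i j))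

  extend-surjective : ∀ {n} (u : Digraph (suc n)) → IsTournamentWithTies u →
    ∃[ v ] ∃[ t ] (IsTournamentWithTies t × extend v t ≡ u)
  extend-surjective {n} u isT@(irrefl , total) = v , t , isTournament-restrict u isT suc Fin.suc-injective ,
    digraph-ext λ i j → trans (adjacent-extend v t i j) (agree i j)
    where
    result : ∀ (j : Fin n) → ∃[ o ] (outgoing o ≡ adjacent u zero (suc j) × incoming o ≡ adjacent u (suc j) zero)
    result j = outcome-surjective _ _ (total zero (suc j) λ ())
    v : Vec Outcome n
    v = tabulate (proj₁ ∘ result)
    t : Digraph n
    t = fromFunction λ i j → adjacent u (suc i) (suc j)
    agree : ∀ i j → extended v t i j ≡ adjacent u i j
    agree zero    zero    = ¬T⇒≡ (irrefl zero)
    agree zero    (suc j) = trans (cong outgoing (Vec.lookup∘tabulate (proj₁ ∘ result) j)) (proj₁ (proj₂ (result j)))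
    agree (suc i) zero    = trans (cong incoming (Vec.lookup∘tabulate (proj₁ ∘ result) i)) (proj₂ (proj₂ (result i)))
    agree (suc i) (suc j) = adjacent-fromFunction _ i j

  numDraws : ∀ {n} → Vec Outcome n → ℕ
  numDraws []      = 0
  numDraws (o ∷ v) = indicator (isDraw o) ℕ.+ numDraws v

  numTies-extend : ∀ {n} (v : Vec Outcome n) t → numTies (extend v t) ≡ numDraws v ℕ.+ numTies t
  numTies-extend {n} v t = begin
    numTies E
      ≡⟨ numTies≡ΣΣ E ⟩
    -- The diagonal entry at `zero` and all pairs with `zero` in second place compute to 0.
    (ΣFin.sum λ j → tie E zero (suc j)) ℕ.+ (ΣFin.sum λ i → ΣFin.sum λ j → tie E (suc i) (suc j))
      ≡⟨ cong₂ ℕ._+_ (trans (ΣFin.sum-cong-≗ λ j → cong indicator (cong₂ _∧_ (E≡ zero (suc j)) (E≡ (suc j) zero))) (sum-draws v))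
           (trans (ΣFin.sum-cong-≗ λ i → ΣFin.sum-cong-≗ λ j →
              cong (λ b → indicator ((toℕ i ℕ.<ᵇ toℕ j) ∧ b)) (cong₂ _∧_ (E≡ (suc i) (suc j)) (E≡ (suc j) (suc i))))
              (sym (numTies≡ΣΣ t))) ⟩
    numDraws v ℕ.+ numTies t ∎
    where
    open ≡-Reasoning
    E = extend v t
    E≡ = adjacent-extend v t
    sum-draws : ∀ {n} (v : Vec Outcome n) → (ΣFin.sum λ j → indicator (isDraw (lookup v j))) ≡ numDraws v
    sum-draws []      = refl
    sum-draws (o ∷ v) = cong (indicator (isDraw o) ℕ.+_) (sum-draws v)

  -- Enumerations

  ∈-vecs : ∀ {a} {A : Set a} {xs : List A} → (∀ x → x ∈ xs) → ∀ {n} (v : Vec A n) → v ∈ vecs xs n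
  ∈-vecs ∈xs []      = here refl
  ∈-vecs ∈xs (x ∷ v) = ∈-cartesianProductWith⁺ Vec._∷_ (∈xs x) (∈-vecs ∈xs v)

  vecs-unique : ∀ {a} {A : Set a} {xs : List A} → Unique xs → ∀ n → Unique (vecs xs n)
  vecs-unique xs! zero    = [] ∷ []
  vecs-unique xs! (suc n) = Unique.cartesianProductWith⁺ Vec._∷_ Vec.∷-injective xs! (vecs-unique xs! n)

  bools : List Bool
  bools = true ∷ false ∷ []

  ∈-bools : ∀ b → b ∈ bools
  ∈-bools true  = here refl
  ∈-bools false = there (here refl)

  bools-unique : Unique bools
  bools-unique = ((λ ()) ∷ []) ∷ [] ∷ []

  ∈-tournaments⁺ : ∀ {n} {t : Digraph n} → IsTournamentWithTies t → t ∈ tournaments n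
  ∈-tournaments⁺ {n} {t} isT = ∈-filter⁺ isTournamentWithTies? (∈-vecs (∈-vecs ∈-bools) t) isT

  ∈-tournaments⁻ : ∀ {n} {t : Digraph n} → t ∈ tournaments n → IsTournamentWithTies t
  ∈-tournaments⁻ {n} t∈ = proj₂ (∈-filter⁻ isTournamentWithTies? {xs = digraphs n} t∈)

  tournaments-unique : ∀ n → Unique (tournaments n)
  tournaments-unique n = Unique.filter⁺ isTournamentWithTies? (vecs-unique (vecs-unique bools-unique n) n)

  -- Two enumerations of the same objects in different orders have equal weighted sums once
  -- membership and absence of repetitions are checked; this turns each structural decomposition
  -- into a sum identity.
  unique⇒↭ : ∀ {a} {A : Set a} {xs ys : List A} → Unique xs → Unique ys →
    (∀ {x} → x ∈ xs → x ∈ ys) → (∀ {x} → x ∈ ys → x ∈ xs) → xs ↭ ys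
  unique⇒↭ xs! ys! xs⊆ys ys⊆xs = ∼bag⇒↭ (unique∧set⇒bag xs! ys! (mk⇔ xs⊆ys ys⊆xs))

  extensions : ∀ n → List (Digraph (suc n))
  extensions n = cartesianProductWith extend (vecs outcomes n) (tournaments n)

  tournaments↭extensions : ∀ n → tournaments (suc n) ↭ extensions n
  tournaments↭extensions n = unique⇒↭ (tournaments-unique (suc n))
    (Unique.cartesianProductWith⁺ extend extend-injective (vecs-unique outcomes-unique n) (tournaments-unique n))
    to from
    where
    to : ∀ {u} → u ∈ tournaments (suc n) → u ∈ extensions n
    to {u} u∈ with extend-surjective u (∈-tournaments⁻ u∈)
    ... | v , t , isT , refl = ∈-cartesianProductWith⁺ extend (∈-vecs ∈-outcomes v) (∈-tournaments⁺ {t = t} isT)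
    from : ∀ {u} → u ∈ extensions n → u ∈ tournaments (suc n)
    from u∈ with ∈-cartesianProductWith⁻ extend (vecs outcomes n) (tournaments n) u∈
    ... | v , t , _ , t∈ , refl = ∈-tournaments⁺ (isTournament-extend v t (∈-tournaments⁻ t∈))

  pieces : ∀ {n} → Vec Bool n → List (Digraph n)
  pieces S = cartesianProductWith (merge S) (tournamentsWithComponents 1 (inside S)) (tournaments (outside S))

  decompositions : ∀ n → List (Digraph n)
  decompositions n = concat (List.map pieces (vecs bools n))

  ∈-tournamentsWithComponents⁺ : ∀ {m n} {t : Digraph n} → IsTournamentWithTies t → numComponents t ≡ m →
    t ∈ tournamentsWithComponents m n
  ∈-tournamentsWithComponents⁺ {m} isT nc≡m = ∈-filter⁺ (λ t → numComponents t ℕ.≟ m) (∈-tournaments⁺ isT) nc≡m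

  ∈-tournamentsWithComponents⁻ : ∀ {m n} {t : Digraph n} → t ∈ tournamentsWithComponents m n →
    IsTournamentWithTies t × numComponents t ≡ m
  ∈-tournamentsWithComponents⁻ {m} {n} t∈ with ∈-filter⁻ (λ t → numComponents t ℕ.≟ m) {xs = tournaments n} t∈
  ... | t∈′ , nc≡m = ∈-tournaments⁻ t∈′ , nc≡m

  ∈-pieces⁻ : ∀ {n} (S : Vec Bool n) {t} → t ∈ pieces S → IsTournamentWithTies t × top t ≡ S
  ∈-pieces⁻ S t∈
    with ∈-cartesianProductWith⁻ (merge S) (tournamentsWithComponents 1 (inside S)) (tournaments (outside S)) t∈
  ... | A , B , A∈ , B∈ , refl with ∈-tournamentsWithComponents⁻ A∈
  ...   | isA , nc≡1 = isTournament-merge S A B isA (∈-tournaments⁻ B∈) , top-merge S A B nc≡1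

  -- Existence is `merge-restrict`; absence of repetitions holds because `top` recovers S and
  -- restriction recovers the two parts. The assumption 0 < n provides a first component.
  tournaments↭decompositions : ∀ n → 0 ℕ.< n → tournaments n ↭ decompositions n
  tournaments↭decompositions n 0<n = unique⇒↭ (tournaments-unique n)
    (Unique.concat⁺
      (All.map⁺ (All.universal pieces-unique (vecs bools n)))
      (AllPairs.map⁺ (AllPairs.map disjoint (vecs-unique bools-unique n))))
    to from
    where
    pieces-unique : ∀ S → Unique (pieces {n} S)
    pieces-unique S = Unique.cartesianProductWith⁺ (merge S)
      (λ {A} {A′} {B} {B′} eq →
        trans (sym (restrictˡ-merge S A B)) (trans (cong (restrictˡ S) eq) (restrictˡ-merge S A′ B′)) ,
        trans (sym (restrictʳ-merge S A B)) (trans (cong (restrictʳ S) eq) (restrictʳ-merge S A′ B′)))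
      (Unique.filter⁺ (λ t → numComponents t ℕ.≟ 1) (tournaments-unique (inside S)))
      (tournaments-unique (outside S))
    disjoint : ∀ {S S′} → S ≢ S′ → Disjoint (pieces {n} S) (pieces S′)
    disjoint {S} {S′} S≢S′ (t∈ , t∈′) = S≢S′ (trans (sym (proj₂ (∈-pieces⁻ S t∈))) (proj₂ (∈-pieces⁻ S′ t∈′)))
    to : ∀ {t} → t ∈ tournaments n → t ∈ decompositions n
    to {t} t∈ = ∈-concat⁺′ (subst (_∈ pieces (top t)) (merge-restrict t isT)
        (∈-cartesianProductWith⁺ (merge (top t))
          (∈-tournamentsWithComponents⁺ (isTournament-restrictˡ t isT) (numComponents-restrictˡ t isT 0<n))
          (∈-tournaments⁺ (isTournament-restrictʳ t isT))))
      (∈-map⁺ pieces (∈-vecs ∈-bools (top t)))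
      where isT = ∈-tournaments⁻ t∈
    from : ∀ {t} → t ∈ decompositions n → t ∈ tournaments n
    from t∈ with ∈-concat⁻′ (List.map pieces (vecs bools n)) t∈
    ... | ts , t∈ts , ts∈ with ∈-map⁻ pieces ts∈
    ...   | S , _ , refl = ∈-tournaments⁺ (proj₁ (∈-pieces⁻ S t∈ts))

-- Sums over lists

module ListSum {c ℓ₁ ℓ₂} (ℝ : CompleteOrderedField c ℓ₁ ℓ₂) where
  open CompleteOrderedField ℝ
  open OrderedField ℝ using (solve; _:=_; _:+_)

  ΣL : ∀ {a} {A : Set a} → (A → Carrier) → List A → Carrier
  ΣL f = foldr (λ x s → f x + s) 0#

  module _ {a} {A : Set a} where

    ΣL-cong : ∀ {f g : A → Carrier} xs → (∀ {x} → x ∈ xs → f x ≈ g x) → ΣL f xs ≈ ΣL g xs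
    ΣL-cong []       f≈g = refl
    ΣL-cong (x ∷ xs) f≈g = +-cong (f≈g (here ≡.refl)) (ΣL-cong xs (λ x∈ → f≈g (there x∈)))

    ΣL-++ : ∀ (f : A → Carrier) xs ys → ΣL f (xs ++ ys) ≈ ΣL f xs + ΣL f ys
    ΣL-++ f []       ys = sym (+-identityˡ _)
    ΣL-++ f (x ∷ xs) ys = trans (+-congˡ (ΣL-++ f xs ys)) (sym (+-assoc _ _ _))

    ΣL-concat : ∀ (f : A → Carrier) xss → ΣL f (concat xss) ≈ ΣL (ΣL f) xss
    ΣL-concat f []         = refl
    ΣL-concat f (xs ∷ xss) = trans (ΣL-++ f xs (concat xss)) (+-congˡ (ΣL-concat f xss))

    ΣL-↭ : ∀ (f : A → Carrier) {xs ys} → xs ↭ ys → ΣL f xs ≈ ΣL f ys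
    ΣL-↭ f Permutation.refl         = refl
    ΣL-↭ f (Permutation.prep x p)   = +-congˡ (ΣL-↭ f p)
    ΣL-↭ f (Permutation.swap x y p) = trans (+-congˡ (+-congˡ (ΣL-↭ f p)))
      (solve 3 (λ x y z → x :+ (y :+ z) := y :+ (x :+ z)) refl _ _ _)
    ΣL-↭ f (Permutation.trans p r)  = trans (ΣL-↭ f p) (ΣL-↭ f r)

    *-distribˡ-ΣL : ∀ x (f : A → Carrier) xs → x * ΣL f xs ≈ ΣL (λ y → x * f y) xs
    *-distribˡ-ΣL x f []       = zeroʳ x
    *-distribˡ-ΣL x f (y ∷ ys) = trans (distribˡ x _ _) (+-congˡ (*-distribˡ-ΣL x f ys))

    *-distribʳ-ΣL : ∀ x (f : A → Carrier) xs → ΣL f xs * x ≈ ΣL (λ y → f y * x) xs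
    *-distribʳ-ΣL x f []       = zeroˡ x
    *-distribʳ-ΣL x f (y ∷ ys) = trans (distribʳ x _ _) (+-congˡ (*-distribʳ-ΣL x f ys))

    ΣL-filter : ∀ {p} {P : Pred A p} (P? : Decidable P) (f : A → Carrier) xs →
      ΣL f (filter P? xs) ≈ ΣL (λ x → f x * (if does (P? x) then 1# else 0#)) xs
    ΣL-filter P? f []       = refl
    ΣL-filter P? f (x ∷ xs) with does (P? x)
    ... | true  = +-cong (sym (*-identityʳ _)) (ΣL-filter P? f xs)
    ... | false = trans (ΣL-filter P? f xs) (trans (sym (+-identityˡ _)) (+-congʳ (sym (zeroʳ _))))

  module _ {a b} {A : Set a} {B : Set b} where

    ΣL-map : ∀ (f : B → Carrier) (g : A → B) xs → ΣL f (List.map g xs) ≈ ΣL (f ∘ g) xs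
    ΣL-map f g []       = refl
    ΣL-map f g (x ∷ xs) = +-congˡ (ΣL-map f g xs)

  module _ {a b d} {A : Set a} {B : Set b} {D : Set d} where

    ΣL-cartesianProductWith : ∀ (f : D → Carrier) (g : A → B → D) xs ys →
      ΣL f (cartesianProductWith g xs ys) ≈ ΣL (λ x → ΣL (λ y → f (g x y)) ys) xs
    ΣL-cartesianProductWith f g []       ys = refl
    ΣL-cartesianProductWith f g (x ∷ xs) ys = trans (ΣL-++ f (List.map (g x) ys) _)
      (+-cong (ΣL-map f (g x) ys) (ΣL-cartesianProductWith f g xs ys))

    ΣL-cartesianProductWith-* : ∀ (f : D → Carrier) (g : A → B → D) (h : A → Carrier) (k : B → Carrier) xs ys →
      (∀ {x y} → x ∈ xs → y ∈ ys → f (g x y) ≈ h x * k y) →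
      ΣL f (cartesianProductWith g xs ys) ≈ ΣL h xs * ΣL k ys
    ΣL-cartesianProductWith-* f g h k xs ys f≈ = trans (ΣL-cartesianProductWith f g xs ys) (trans
      (ΣL-cong xs λ {x} x∈ → trans (ΣL-cong ys λ y∈ → f≈ x∈ y∈) (sym (*-distribˡ-ΣL (h x) k ys)))
      (sym (*-distribʳ-ΣL (ΣL k ys) h xs)))

-- Weighted counts as powers in the ring of sequences

module WeightedCounts {c ℓ₁ ℓ₂} (ℝ : CompleteOrderedField c ℓ₁ ℓ₂)
  (p : CompleteOrderedField.Carrier ℝ)
  (0<p : CompleteOrderedField._<_ ℝ (CompleteOrderedField.0# ℝ) p)
  (p<1 : CompleteOrderedField._<_ ℝ p (CompleteOrderedField.1# ℝ)) where

  open Decomposition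
  open CompleteOrderedField ℝ
  open OrderedField ℝ
  open Asymptotics ℝ
  open Weights ℝ p 0<p p<1
  open ListSum ℝ
  open BinomialSum ℝ
  open TwistedProduct ℝ q
  open Expansion ℝ p 0<p p<1 using (q+p≈1; module Seq)
  open TwistedEstimates ℝ 0<q 0<p q+p≈1 using (𝟏)
  open SemiringExp semiring using (^-homo-*; ^-congʳ; ^-congˡ)
  open SemiringMult semiring using (×-congʳ; ×-assoc-*)
  open CommutativeSemiringExp (CommutativeRing.commutativeSemiring commutativeRing) using (^-distrib-*)
  open SetoidReasoning setoid

  weight-merge : ∀ {n} (S : Vec Bool n) A B → weight (merge S A B) ≈ weight A * weight B
  weight-merge S A B = trans (^-congʳ (ρ - 1#) (numTies-merge S A B)) (^-homo-* (ρ - 1#) (numTies A) (numTies B))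

  weight-extend : ∀ {n} (v : Vec Outcome n) t → weight (extend v t) ≈ (ρ - 1#) ^ numDraws v * weight t
  weight-extend v t = trans (^-congʳ (ρ - 1#) (numTies-extend v t)) (^-homo-* (ρ - 1#) (numDraws v) (numTies t))

  -- The new vertex meets the n old ones independently, so the sum over outcome vectors factors into
  -- n equal sums.
  Σ-draws : ∀ x n → ΣL (λ v → x ^ numDraws v) (vecs outcomes n) ≈ (1# + 1# + x) ^ n
  Σ-draws x zero    = +-identityʳ 1#
  Σ-draws x (suc n) = trans
    (ΣL-cartesianProductWith-* (λ v → x ^ numDraws v) Vec._∷_ (λ o → x ^ indicator (isDraw o)) (λ v → x ^ numDraws v)
      outcomes (vecs outcomes n) (λ {o} {v} _ _ → ^-homo-* x (indicator (isDraw o)) (numDraws v)))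
    (*-cong (solve 1 (λ x → con (+ 1) :+ (con (+ 1) :+ (x :* con (+ 1) :+ con (+ 0))) := con (+ 1) :+ con (+ 1) :+ x) refl x)
      (Σ-draws x n))

  𝔦𝔱-suc : ∀ n → 𝔦𝔱 (suc n) ≈ (1# + 1# + (ρ - 1#)) ^ n * 𝔦𝔱 n
  𝔦𝔱-suc n = trans (ΣL-↭ weight (tournaments↭extensions n)) (trans
    (ΣL-cartesianProductWith-* weight extend (λ v → (ρ - 1#) ^ numDraws v) weight
      (vecs outcomes n) (tournaments n) (λ {v} {t} _ _ → weight-extend v t))
    (*-congʳ (Σ-draws (ρ - 1#) n)))

  ρ*q≈p : ρ * q ≈ p
  ρ*q≈p = ÷-* p (pos⇒#0 0<q)

  𝔦𝔱*q^≈1 : ∀ n → 𝔦𝔱 n * q ^ triangular n ≈ 1#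
  𝔦𝔱*q^≈1 zero    = solve 0 ((con (+ 1) :+ con (+ 0)) :* con (+ 1) := con (+ 1)) refl
  𝔦𝔱*q^≈1 (suc n) = begin
    𝔦𝔱 (suc n) * q ^ (n ℕ.+ triangular n)
      ≈⟨ *-cong (𝔦𝔱-suc n) (^-homo-* q n (triangular n)) ⟩
    (1# + 1# + (ρ - 1#)) ^ n * 𝔦𝔱 n * (q ^ n * q ^ triangular n)
      ≈⟨ solve 4 (λ a b c d → a :* b :* (c :* d) := a :* c :* (b :* d)) refl _ _ _ _ ⟩
    (1# + 1# + (ρ - 1#)) ^ n * q ^ n * (𝔦𝔱 n * q ^ triangular n)
      ≈⟨ *-cong (trans (sym (^-distrib-* _ q n)) (trans (^-congˡ n per-pair) (1^ n))) (𝔦𝔱*q^≈1 n) ⟩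
    1# * 1#
      ≈⟨ *-identityˡ 1# ⟩
    1# ∎
    where
    1^ : ∀ n → 1# ^ n ≈ 1#
    1^ zero    = refl
    1^ (suc n) = trans (*-identityˡ _) (1^ n)
    per-pair : (1# + 1# + (ρ - 1#)) * q ≈ 1#
    per-pair = begin
      (1# + 1# + (ρ - 1#)) * q
        ≈⟨ solve 2 (λ ρ q → (con (+ 1) :+ con (+ 1) :+ (ρ :- con (+ 1))) :* q := q :+ ρ :* q) refl ρ q ⟩
      q + ρ * q  ≈⟨ +-congˡ ρ*q≈p ⟩
      q + p      ≈⟨ q+p≈1 ⟩
      1#         ∎

  -- Weights may be negative, so this is not a matter of positivity of summands: a power of q is an
  -- explicit inverse.
  𝔦𝔱#0 : ∀ n → 𝔦𝔱 n # 0#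
  𝔦𝔱#0 n = invertible⇒#0 (𝔦𝔱*q^≈1 n)

  Σ-subsets : ∀ φ n → ΣL (λ S → φ (inside S) (outside S)) (vecs bools n) ≈ Σ⊆ φ n
  Σ-subsets φ zero    = +-identityʳ _
  Σ-subsets φ (suc n) = trans (ΣL-cartesianProductWith (λ S → φ (inside S) (outside S)) Vec._∷_ bools (vecs bools n))
    (+-cong (Σ-subsets (λ k l → φ (suc k) l) n)
      (trans (+-identityʳ _) (Σ-subsets (λ k l → φ k (suc l)) n)))

  -- F is left free to serve twice: constantly 1 it gives the equation for all tournaments, and as
  -- an indicator it leads from m to m + 1 components. The `suc` accounts for the component split
  -- off.
  first-component : ∀ (F : ℕ → Carrier) n → 0 ℕ.< n →
    ΣL (λ t → weight t * F (numComponents t)) (tournaments n) ≈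
    Σ⊆ (λ k l → 𝔦𝔱⁽ 1 ⁾ k * ΣL (λ t → weight t * F (suc (numComponents t))) (tournaments l)) n
  first-component F n 0<n = begin
    ΣL f (tournaments n)
      ≈⟨ ΣL-↭ f (tournaments↭decompositions n 0<n) ⟩
    ΣL f (decompositions n)
      ≈⟨ ΣL-concat f (List.map pieces (vecs bools n)) ⟩
    ΣL (ΣL f) (List.map pieces (vecs bools n))
      ≈⟨ ΣL-map (ΣL f) pieces (vecs bools n) ⟩
    ΣL (λ S → ΣL f (pieces S)) (vecs bools n)
      ≈⟨ ΣL-cong (vecs bools n) (λ {S} _ → piece S) ⟩
    ΣL (λ S → φ (inside S) (outside S)) (vecs bools n)
      ≈⟨ Σ-subsets φ n ⟩
    Σ⊆ φ n ∎
    where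
    f g : ∀ {n} → Digraph n → Carrier
    f t = weight t * F (numComponents t)
    g t = weight t * F (suc (numComponents t))
    φ : ℕ → ℕ → Carrier
    φ k l = 𝔦𝔱⁽ 1 ⁾ k * ΣL g (tournaments l)
    piece : ∀ S → ΣL f (pieces {n} S) ≈ φ (inside S) (outside S)
    piece S = ΣL-cartesianProductWith-* f (merge S) weight g
      (tournamentsWithComponents 1 (inside S)) (tournaments (outside S))
      λ {A} {B} A∈ _ → trans
        (*-cong (weight-merge S A B) (reflexive (≡.cong F (≡.trans (numComponents-merge S A B)
          (≡.cong (ℕ._+ numComponents B) (proj₂ (∈-tournamentsWithComponents⁻ A∈)))))))
        (*-assoc _ _ _)

  [_≡_] : ℕ → ℕ → Carrier
  [ k ≡ m ] = if does (k ℕ.≟ m) then 1# else 0#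

  𝔦𝔱⁽⁾≈ : ∀ m n → 𝔦𝔱⁽ m ⁾ n ≈ ΣL (λ t → weight t * [ numComponents t ≡ m ]) (tournaments n)
  𝔦𝔱⁽⁾≈ (suc m) n    = ΣL-filter (λ t → numComponents t ℕ.≟ suc m) weight (tournaments n)
  𝔦𝔱⁽⁾≈ zero zero    = solve 0 (con (+ 1) := con (+ 1) :* con (+ 1) :+ con (+ 0)) refl
  𝔦𝔱⁽⁾≈ zero (suc n) = sym (trans
    -- With `suc n` vertices the list of components is a cons, so the indicator of 0 components
    -- computes to `0#`.
    (ΣL-cong {g = λ _ → 0#} (tournaments (suc n)) λ {t} _ → zeroʳ (weight t))
    (Σ0 (tournaments (suc n))))
    where
    Σ0 : ∀ {a} {A : Set a} (xs : List A) → ΣL (λ _ → 0#) xs ≈ 0#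
    Σ0 []       = refl
    Σ0 (x ∷ xs) = trans (+-identityˡ _) (Σ0 xs)

  normalise : (ℕ → Carrier) → Sequence
  normalise a n = a n * q ^ triangular n

  -- The pairs of a split set are those within either side and the k l crossing pairs; the latter
  -- are the source of the twist in ⊛.
  triangular-+ : ∀ k l → triangular (k ℕ.+ l) ≡ k ℕ.* l ℕ.+ (triangular k ℕ.+ triangular l)
  triangular-+ zero    l = ≡.refl
  triangular-+ (suc k) l = ≡.trans (≡.cong (k ℕ.+ l ℕ.+_) (triangular-+ k l)) (rearrange k l (triangular k) (triangular l))
    where
    rearrange : ∀ k l a b → k ℕ.+ l ℕ.+ (k ℕ.* l ℕ.+ (a ℕ.+ b)) ≡ l ℕ.+ k ℕ.* l ℕ.+ (k ℕ.+ a ℕ.+ b)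
    rearrange = ℕ-Solver.solve-∀

  normalise-Σ⊆ : ∀ a b → normalise (Σ⊆ λ k l → a k * b l) ≋ normalise a ⊛ normalise b
  normalise-Σ⊆ a b n = trans (*-comm _ _) (trans (*-distribˡ-Σ⊆ (q ^ triangular n) (λ k l → a k * b l) n)
    (Σ⊆-cong n λ { k l ≡.refl → begin
      q ^ triangular (k ℕ.+ l) * (a k * b l)
        ≡⟨ ≡.cong (λ e → q ^ e * (a k * b l)) (triangular-+ k l) ⟩
      q ^ (k ℕ.* l ℕ.+ (triangular k ℕ.+ triangular l)) * (a k * b l)
        ≈⟨ *-congʳ (trans (^-homo-* q (k ℕ.* l) _) (*-congˡ (^-homo-* q (triangular k) (triangular l)))) ⟩
      q ^ (k ℕ.* l) * (q ^ triangular k * q ^ triangular l) * (a k * b l)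
        ≈⟨ solve 5 (λ x y z a b → x :* (y :* z) :* (a :* b) := x :* (a :* y :* (b :* z))) refl _ _ _ _ _ ⟩
      q ^ (k ℕ.* l) * (a k * q ^ triangular k * (b l * q ^ triangular l)) ∎ }))

  Σ⊆-product-congʳ : ∀ (a : ℕ → Carrier) {b b′ : ℕ → Carrier} → (∀ l → b l ≈ b′ l) → ∀ n →
    Σ⊆ (λ k l → a k * b l) n ≈ Σ⊆ (λ k l → a k * b′ l) n
  Σ⊆-product-congʳ a b≈b′ n = Σ⊆-cong n λ k l _ → *-congˡ (b≈b′ l)

  σ : Sequence
  σ = normalise 𝔦𝔱⁽ 1 ⁾

  𝟏≋δ⊕σ⊛𝟏 : 𝟏 ≋ δ ⊕ σ ⊛ 𝟏
  𝟏≋δ⊕σ⊛𝟏 zero    = solve 0 (con (+ 1) :=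
    con (+ 1) :+ con (+ 1) :* (con (+ 0) :* con (+ 1) :* con (+ 1))) refl
  𝟏≋δ⊕σ⊛𝟏 (suc n) = sym (begin
    0# + (σ ⊛ 𝟏) (suc n)
      ≈⟨ +-identityˡ _ ⟩
    (σ ⊛ 𝟏) (suc n)
      ≈⟨ ⊛-cong {u = σ} (λ _ → refl) 𝔦𝔱*q^≈1 (suc n) ⟨
    (σ ⊛ normalise 𝔦𝔱) (suc n)
      ≈⟨ normalise-Σ⊆ 𝔦𝔱⁽ 1 ⁾ 𝔦𝔱 (suc n) ⟨
    normalise (Σ⊆ λ k l → 𝔦𝔱⁽ 1 ⁾ k * 𝔦𝔱 l) (suc n)
      ≈⟨ *-congʳ (trans (Σ⊆-product-congʳ 𝔦𝔱⁽ 1 ⁾ unweighted (suc n))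
           (trans (sym (first-component (λ _ → 1#) (suc n) (ℕ.s≤s ℕ.z≤n))) (sym (unweighted (suc n))))) ⟩
    normalise 𝔦𝔱 (suc n)
      ≈⟨ 𝔦𝔱*q^≈1 (suc n) ⟩
    1# ∎)
    where
    unweighted : ∀ n → 𝔦𝔱 n ≈ ΣL (λ t → weight t * 1#) (tournaments n)
    unweighted n = ΣL-cong (tournaments n) λ _ → sym (*-identityʳ _)

  -- Components are peeled off one at a time. Index 0 is treated apart because the empty tournament
  -- has no first component; for positive m both sides are 0 there, as `𝔦𝔱⁽ 1 ⁾ 0` computes to `0#`.
  𝔦𝔱⁽⁾≋σ^ : ∀ m → normalise 𝔦𝔱⁽ m ⁾ ≋ σ Seq.^ m
  𝔦𝔱⁽⁾≋σ^ zero    zero    = *-identityˡ 1#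
  𝔦𝔱⁽⁾≋σ^ zero    (suc n) = zeroˡ _
  𝔦𝔱⁽⁾≋σ^ (suc m) zero    = solve 1 (λ x → con (+ 0) :* con (+ 1) := con (+ 1) :* (con (+ 0) :* con (+ 1) :* x)) refl _
  𝔦𝔱⁽⁾≋σ^ (suc m) (suc n) = begin
    normalise 𝔦𝔱⁽ suc m ⁾ (suc n)
      ≈⟨ *-congʳ (trans (𝔦𝔱⁽⁾≈ (suc m) (suc n)) (first-component [_≡ suc m ] (suc n) (ℕ.s≤s ℕ.z≤n))) ⟩
    normalise (Σ⊆ λ k l → 𝔦𝔱⁽ 1 ⁾ k * ΣL (λ t → weight t * [ suc (numComponents t) ≡ suc m ]) (tournaments l)) (suc n)
      ≈⟨ *-congʳ (Σ⊆-product-congʳ 𝔦𝔱⁽ 1 ⁾ (𝔦𝔱⁽⁾≈ m) (suc n)) ⟨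
    normalise (Σ⊆ λ k l → 𝔦𝔱⁽ 1 ⁾ k * 𝔦𝔱⁽ m ⁾ l) (suc n)
      ≈⟨ normalise-Σ⊆ 𝔦𝔱⁽ 1 ⁾ 𝔦𝔱⁽ m ⁾ (suc n) ⟩
    (σ ⊛ normalise 𝔦𝔱⁽ m ⁾) (suc n)
      ≈⟨ ⊛-cong {u = σ} (λ _ → refl) (𝔦𝔱⁽⁾≋σ^ m) (suc n) ⟩
    (σ ⊛ σ Seq.^ m) (suc n) ∎

  coefficient : ℕ → ℕ → Carrier
  coefficient m k = suc m · (𝔦𝔱⁽ m ⁾ k - 2 · 𝔦𝔱⁽ suc m ⁾ k + 𝔦𝔱⁽ suc (suc m) ⁾ k)

  coefficient-normalised : ∀ m k → coefficient m k * q ^ triangular k ≈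
    suc m · ((σ Seq.^ m) k - 2 · (σ Seq.^ suc m) k + (σ Seq.^ suc (suc m)) k)
  coefficient-normalised m k = trans (×-assoc-* (suc m) _ _) (×-congʳ (suc m) (trans
    (solve 4 (λ a b c x → (a :- (b :+ (b :+ con (+ 0))) :+ c) :* x :=
       a :* x :- (b :* x :+ (b :* x :+ con (+ 0))) :+ c :* x) refl _ _ _ _)
    (+-cong (+-cong (𝔦𝔱⁽⁾≋σ^ m k) (-‿cong (×-congʳ 2 (𝔦𝔱⁽⁾≋σ^ (suc m) k)))) (𝔦𝔱⁽⁾≋σ^ (suc (suc m)) k))))

  ratio≈σ^ : ∀ m n → 𝔦𝔱⁽ m ⁾ n ÷ 𝔦𝔱 n [ 𝔦𝔱#0 n ] ≈ (σ Seq.^ m) n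
  ratio≈σ^ m n = ÷-unique (𝔦𝔱#0 n) (begin
    (σ Seq.^ m) n * 𝔦𝔱 n                      ≈⟨ *-congʳ (𝔦𝔱⁽⁾≋σ^ m n) ⟨
    𝔦𝔱⁽ m ⁾ n * q ^ triangular n * 𝔦𝔱 n       ≈⟨ solve 3 (λ a b c → a :* b :* c := a :* (c :* b)) refl _ _ _ ⟩
    𝔦𝔱⁽ m ⁾ n * (𝔦𝔱 n * q ^ triangular n)     ≈⟨ *-congˡ (𝔦𝔱*q^≈1 n) ⟩
    𝔦𝔱⁽ m ⁾ n * 1#                            ≈⟨ *-identityʳ _ ⟩
    𝔦𝔱⁽ m ⁾ n                                 ∎)

  asymptoticExpansion-resp-≈ : ∀ {f g : ℕ → Carrier} a {s} → (∀ n → f n ≈ g n) →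
    AsymptoticExpansion f a s → AsymptoticExpansion g a s
  asymptoticExpansion-resp-≈ a f≈g (s=o , f=O) = s=o , λ r →
    let K , N , f≤ = f=O r in K , N , λ n N≤n → ∣∣≤-resp-≈ (+-congʳ (f≈g n)) (f≤ n N≤n)

theorem4p9 : ∀ {c ℓ₁ ℓ₂} (ℝ : CompleteOrderedField c ℓ₁ ℓ₂) →
    let open CompleteOrderedField ℝ
        open Asymptotics ℝ
    in
    (p : Carrier) (0<p : 0# < p) (p<1 : p < 1#) (m : ℕ) → 1 ≤ℕ m →
    let open Weights ℝ p 0<p p<1 in
    Σ[ 𝔦𝔱#0 ∈ (∀ n → 𝔦𝔱 n # 0#) ]
      AsymptoticExpansion
        (λ n → 𝔦𝔱⁽ m ⁾ n ÷ 𝔦𝔱 n [ 𝔦𝔱#0 n ])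
        (λ k → m · (𝔦𝔱⁽ m ∸ 1 ⁾ k - 2 · 𝔦𝔱⁽ m ⁾ k + 𝔦𝔱⁽ suc m ⁾ k))
        scale
-- Matching on `suc m` lets `suc m ∸ 1` reduce to m, so the claimed coefficients are those of
-- `coefficient m` by computation.
theorem4p9 ℝ p 0<p p<1 (suc m) 1≤m = 𝔦𝔱#0 ,
  asymptoticExpansion-resp-≈ (coefficient m) (λ n → sym (ratio≈σ^ (suc m) n))
    (power-expansion 𝟏≋δ⊕σ⊛𝟏 m (coefficient m) (coefficient-normalised m))
  where
  open CompleteOrderedField ℝ using (sym)
  open WeightedCounts ℝ p 0<p p<1
  open Expansion ℝ p 0<p p<1 using (power-expansion)
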